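{- Let $d$ be a positive integer and $G$ a graph. If $G$ is $d(d+1)^2$-connected, or $\mathcal{R}_d(G)$ is vertically $(d(d+1))^2$-connected, then $G$ is $\mathcal{R}_d$-reconstructible.
   Context: All graphs are finite and simple, without isolated vertices. For a graph $G$ and a map $p:V(G)\to\mathbb{R}^d$, the rigidity matrix $R(G,p)$ has one row per edge and $d$ columns per vertex; the row of edge $uv$ has entries $p(u)-p(v)$ in the columns of $u$, $p(v)-p(u)$ in the columns of $v$, and $0$ elsewhere. The generic $d$-dimensional rigidity matroid $\mathcal{R}_d(G)$ is the row matroid of $R(G,p)$ for a generic $p$ (e.g., with algebraically independent coordinates over $\mathbb{Q}$); it is a matroid on $E(G)$. $G$ is $\mathcal{R}_d$-reconstructible if for every graph $H$ and every matroid isomorphism $\psi:E(G)\to E(H)$ between $\mathcal{R}_d(G)$ and $\mathcal{R}_d(H)$, there is a graph isomorphism $\varphi:V(G)\to V(H)$ with $\psi(uv)=\varphi(u)\varphi(v)$ for all $uv\in E(G)$. For a matroid $(E,r)$, a vertical $k$-separation is a bipartition $(E_1,E_2)$ of $E$ with $r(E_1),r(E_2)\ge k$ and $r(E_1)+r(E_2)\le r(E)+k-1$; the matroid is vertically $k$-connected if $k\le r(E)$ and it has no vertical $k'$-separation for any positive integer $k'<k$. -}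

module Defs where

open import Data.Nat using (ℕ; zero; suc; _+_; _*_; _≤_; _<_)
open import Data.Fin using (Fin; zero; suc; _≟_)
open import Data.Bool using (Bool; true; false; if_then_else_; not)
open import Data.Product using (Σ; ∃; _×_; _,_; proj₁; proj₂)
open import Data.Sum using (_⊎_)
open import Data.Rational using (ℚ; 0ℚ; _-_) renaming (_+_ to _+ℚ_; _*_ to _*ℚ_)
open import Relation.Nullary using (¬_; does)
open import Relation.Binary.PropositionalEquality using (_≡_; _≢_)
open import Function.Bundles using (_↔_; Inverse)

SamePair : ∀ {n} → Fin n × Fin n → Fin n × Fin n → Set
SamePair (a , b) (c , d) = ((a ≡ c) × (b ≡ d)) ⊎ ((a ≡ d) × (b ≡ c))

record Graph : Set where
  field
    n : ℕ
    m : ℕ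
    ends : Fin m → Fin n × Fin n
    loopless : ∀ e → proj₁ (ends e) ≢ proj₂ (ends e)
    simple : ∀ e e′ → SamePair (ends e) (ends e′) → e ≡ e′
    noIsolated : ∀ v → ∃ λ e → (proj₁ (ends e) ≡ v) ⊎ (proj₂ (ends e) ≡ v)
open Graph public

sumℚ : (k : ℕ) → (Fin k → ℚ) → ℚ
sumℚ zero f = 0ℚ
sumℚ (suc k) f = f zero +ℚ sumℚ k (λ i → f (suc i))

count : (k : ℕ) → (Fin k → Bool) → ℕ
count zero S = 0
count (suc k) S = (if S zero then 1 else 0) + count k (λ i → S (suc i))

Subset : ℕ → Set
Subset k = Fin k → Bool

_⊆_ : ∀ {k} → Subset k → Subset k → Set
I ⊆ S = ∀ i → I i ≡ true → S i ≡ true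

full : ∀ {k} → Subset k
full _ = true

rigEntry : (d : ℕ) (G : Graph) → (Fin (n G) → Fin d → ℚ) →
           Fin (m G) → Fin (n G) → Fin d → ℚ
rigEntry d G p e v k with ends G e
... | (u , w) =
  if does (v ≟ u) then p u k - p w k
  else if does (v ≟ w) then p w k - p u k
  else 0ℚ

RowsIndependent : (d : ℕ) (G : Graph) → (Fin (n G) → Fin d → ℚ) → Subset (m G) → Set
RowsIndependent d G p S =
  (c : Fin (m G) → ℚ) →
  (∀ e → S e ≡ false → c e ≡ 0ℚ) →
  (∀ v k → sumℚ (m G) (λ e → c e *ℚ rigEntry d G p e v k) ≡ 0ℚ) →
  ∀ e → c e ≡ 0ℚ

-- Independence in the generic d-dimensional rigidity matroid R_d(G):
-- S is independent iff the rows of R(G,p) indexed by S are linearly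
-- independent for some placement p (equivalently, for generic p).
Indep : (d : ℕ) (G : Graph) → Subset (m G) → Set
Indep d G S = ∃ λ (p : Fin (n G) → Fin d → ℚ) → RowsIndependent d G p S

HasRank : (d : ℕ) (G : Graph) → Subset (m G) → ℕ → Set
HasRank d G S r =
  (∃ λ I → I ⊆ S × Indep d G I × count (m G) I ≡ r) ×
  (∀ I → I ⊆ S → Indep d G I → count (m G) I ≤ r)

VerticalSeparation : (d : ℕ) (G : Graph) → ℕ → Set
VerticalSeparation d G k =
  ∃ λ (S : Subset (m G)) → ∃ λ r₁ → ∃ λ r₂ → ∃ λ r →
    HasRank d G S r₁ × HasRank d G (λ e → not (S e)) r₂ × HasRank d G full r ×
    k ≤ r₁ × k ≤ r₂ × r₁ + r₂ + 1 ≤ r + k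

VerticallyConnected : (d : ℕ) (G : Graph) → ℕ → Set
VerticallyConnected d G k =
  (∀ r → HasRank d G full r → k ≤ r) ×
  (∀ k′ → 1 ≤ k′ → k′ < k → ¬ VerticalSeparation d G k′)

Adj : (G : Graph) → Fin (n G) → Fin (n G) → Set
Adj G u v = ∃ λ e → SamePair (ends G e) (u , v)

data Reach (G : Graph) (X : Subset (n G)) : Fin (n G) → Fin (n G) → Set where
  here : ∀ {u} → X u ≡ false → Reach G X u u
  step : ∀ {u v w} → X u ≡ false → Adj G u v → Reach G X v w → Reach G X u w

KConnected : ℕ → Graph → Set
KConnected k G =
  k < n G ×
  (∀ (X : Subset (n G)) → count (n G) X < k →
     ∀ u v → X u ≡ false → X v ≡ false → Reach G X u v)

MatroidIso : (d : ℕ) (G H : Graph) → Fin (m G) ↔ Fin (m H) → Set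
MatroidIso d G H ψ =
  ∀ (S : Subset (m G)) →
    (Indep d G S → Indep d H (λ j → S (Inverse.from ψ j))) ×
    (Indep d H (λ j → S (Inverse.from ψ j)) → Indep d G S)

Reconstructible : (d : ℕ) → Graph → Set
Reconstructible d G =
  ∀ (H : Graph) (ψ : Fin (m G) ↔ Fin (m H)) → MatroidIso d G H ψ →
    Σ (Fin (n G) ↔ Fin (n H)) λ φ →
      ∀ e → SamePair (ends H (Inverse.to ψ e))
                     (Inverse.to φ (proj₁ (ends G e)) , Inverse.to φ (proj₂ (ends G e)))

{-# OPTIONS --safe #-}

-- Write D = d(d+1) and k = d(d+1)² = dD + D.
--
-- Rigidity from connectivity (Villányi): let adjacency mean "linked", and call a
-- vertex simplicial if its neighbourhood is a clique. In a uniformly random vertex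
-- order, a vertex with s earlier neighbours raises the rank by at least min(d, s),
-- and by d + 1 if s > d and those neighbours are not a clique. If all degrees are at
-- least D and every simplicial vertex sees at least D non-simplicial ones, the
-- expected gain of a non-simplicial vertex is at least d; placing the simplicial
-- vertices last, the rank is at least d times the number of vertices, which is
-- impossible unless the graph is rigid.
--
-- If G is k-connected and (E₁, E₂) covers its edges, deleting a vertex that meets
-- both parts lowers r(E₁) + r(E₂) − r(E) by at least one as long as the graph stays
-- D-connected. Hence this overlap is at least dD − 1 unless one part spans, also in
-- G − v. This property passes to the isomorphic matroid of a graph H; there, a
-- simplicial vertex with q < D non-simplicial neighbours would give an overlap of at
-- most d(q − 1), so the image of G − v in H is rigid. By rank it has n − 1 vertices, so
-- it misses a single vertex of H, whose star is the image of the star of v.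
--
-- A vertically dk-connected matroid forces k-connectivity, since s common vertices
-- allow an overlap of at most d(s − 1).
--
-- The classical steps are carried out under double negation: the conclusion for each
-- vertex is a decidable statement.
module Submission where

open import Defs
open import Data.Nat as ℕ using (ℕ; zero; suc; _+_; _*_; _∸_; _^_; _≤_; _<_; z≤n; s≤s; _⊓_)
import Data.Nat.Properties as ℕP
import Data.Nat.Coprimality as Coprime
import Data.Nat.Solver as ℕSolver
import Data.Integer as ℤ
open import Data.Fin using (Fin; zero; suc; punchIn; splitAt; _↑ˡ_; _↑ʳ_; toℕ; fromℕ<; inject≤; combine; remQuot; finToFun; funToFin)
import Data.Fin.Properties as FinP
import Data.Bool
open import Data.Bool using (Bool; true; false; if_then_else_; not; _∧_; _∨_)
open import Data.Product using (Σ; ∃; _×_; _,_; proj₁; proj₂)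
open import Data.Sum using (_⊎_; inj₁; inj₂; [_,_]′)
open import Data.Empty using (⊥; ⊥-elim)
open import Data.Maybe using (Maybe; just; nothing; maybe)
open import Data.Rational as ℚ using (ℚ; 0ℚ; 1ℚ; mkℚ)
import Data.Rational.Properties as ℚP
import Data.Rational.Solver as ℚSolver
open import Data.Vec.Functional using (insertAt)
open import Data.Vec.Functional.Properties using (insertAt-lookup; insertAt-punchIn)
open import Relation.Nullary using (¬_; Dec; yes; no; does; ¬?)
open import Relation.Nullary.Decidable using (dec-true; dec-false; decidable-stable; map′; _→-dec_; _×-dec_; _⊎-dec_)
open import Relation.Binary.PropositionalEquality
open import Function using (_∘_; case_of_; id)
open import Function.Bundles using (_↔_; Inverse; mk↔ₛ′)
open import Algebra.Properties.CommutativeMonoid.Sum ℕP.+-0-commutativeMonoid using (sum; sum-cong-≗; ∑-distrib-+; ∑-comm)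

-- No rational placement has algebraically independent coordinates, so genericity becomes a finite
-- list of demands: whatever rows are linearly independent, or at most `d + 1` points affinely
-- independent, at some placement are so at the chosen one. Two placements are merged by passing to
-- `s p + q` with `s` large, where a demand met at either of them still holds; the matrix pencils
-- serve this purpose. The resulting rank function is packaged as `RigidityRank`, and the later
-- combinatorics uses only the fields of that record.
--
-- The constant `D` is the point where a bound reaches `d`: a non-simplicial vertex with `s ≥ d`
-- neighbours has expected gain at least `d + 1/2 - D / (2s)`. The budget `k = 1 + (dD - 1) + D` is
-- spent on the vertex whose star is to be recognised, on the deletions that build up the overlap,
-- and on the `D`-connectivity that must survive all of them, since it keeps each remainder rigid.

NN : ∀ {a} → Set a → Set a
NN A = ¬ ¬ A

infixl 1 _>>=_
_>>=_ : ∀ {a b} {A : Set a} {B : Set b} → NN A → (A → NN B) → NN B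
(m >>= f) k = m (λ x → f x k)

return : ∀ {a} {A : Set a} → A → NN A
return x k = k x

em : ∀ {a} (A : Set a) → NN (Dec A)
em A k = k (no (λ x → k (yes x)))

-- Finiteness of the index set is what makes this double-negation shift provable; it later lets a
-- basis be chosen for all pair sets at once.
nn-Fin : ∀ {p} k {P : Fin k → Set p} → (∀ i → NN (P i)) → NN (∀ i → P i)
nn-Fin zero h = return (λ ())
nn-Fin (suc k) h = h zero >>= λ p₀ → nn-Fin k (h ∘ suc) >>= λ ps →
  return (λ { zero → p₀ ; (suc i) → ps i })

-- Boolean reasoning

bool-cases : ∀ b → b ≡ true ⊎ b ≡ false
bool-cases true = inj₁ refl
bool-cases false = inj₂ refl

true≢false : ∀ {b} → b ≡ true → b ≡ false → ⊥
true≢false refl ()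

¬true⇒false : ∀ {b} → ¬ (b ≡ true) → b ≡ false
¬true⇒false {true} h = ⊥-elim (h refl)
¬true⇒false {false} h = refl

∧-intro : ∀ {a b} → a ≡ true → b ≡ true → a ∧ b ≡ true
∧-intro refl refl = refl

∧-fst : ∀ {a b} → a ∧ b ≡ true → a ≡ true
∧-fst {true} h = refl

∧-snd : ∀ {a b} → a ∧ b ≡ true → b ≡ true
∧-snd {true} h = h

not-intro : ∀ {a} → ¬ (a ≡ true) → not a ≡ true
not-intro {true} h = ⊥-elim (h refl)
not-intro {false} h = refl

not-elim : ∀ {a} → not a ≡ true → a ≡ true → ⊥
not-elim () refl

∨-inl : ∀ {a b} → a ≡ true → a ∨ b ≡ true
∨-inl refl = refl

∨-inr : ∀ {a b} → b ≡ true → a ∨ b ≡ true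
∨-inr {true} h = refl
∨-inr {false} h = h

∨-elim : ∀ {a b} → a ∨ b ≡ true → a ≡ true ⊎ b ≡ true
∨-elim {true} h = inj₁ refl
∨-elim {false} h = inj₂ h

does-elim : ∀ {a} {A : Set a} (a? : Dec A) → does a? ≡ true → A
does-elim (yes x) _ = x

bool-ext : ∀ {a b} → (a ≡ true → b ≡ true) → (b ≡ true → a ≡ true) → a ≡ b
bool-ext {true} {true} f g = refl
bool-ext {true} {false} f g = sym (f refl)
bool-ext {false} {true} f g = g refl
bool-ext {false} {false} f g = refl

infix 4 _==_
_==_ : ∀ {k} → Fin k → Fin k → Bool
i == j = does (i FinP.≟ j)

-- Rational sums

infixl 6 _⊕_
infixl 7 _⊗_

-- Opaque copies of the field operations: ℚ's own are defined by pattern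
-- matching, which blocks the inference of implicit arguments.
opaque
  _⊕_ : ℚ → ℚ → ℚ
  _⊕_ = ℚ._+_

  _⊗_ : ℚ → ℚ → ℚ
  _⊗_ = ℚ._*_

  ⊖_ : ℚ → ℚ
  ⊖_ = ℚ.-_

opaque
  ∑ : (k : ℕ) → (Fin k → ℚ) → ℚ
  ∑ zero f = 0ℚ
  ∑ (suc k) f = f zero ⊕ ∑ k (f ∘ suc)

module FieldLaws where
  opaque
    unfolding _⊕_ _⊗_ ⊖_ ∑
    open ℚSolver.+-*-Solver using (solve; _:=_; _:+_; _:*_; :-_)

    ⊗-unfold : ∀ a b → a ⊗ b ≡ a ℚ.* b
    ⊗-unfold a b = refl

    -unfold : ∀ a b → a ⊕ ⊖ b ≡ a ℚ.- b
    -unfold a b = refl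

    ∑-unfold : ∀ k f → ∑ k f ≡ sumℚ k f
    ∑-unfold zero f = refl
    ∑-unfold (suc k) f = cong (f zero ℚ.+_) (∑-unfold k (f ∘ suc))

    ⊕-comm : ∀ a b → a ⊕ b ≡ b ⊕ a
    ⊕-comm = ℚP.+-comm

    ⊕-assoc : ∀ a b c → (a ⊕ b) ⊕ c ≡ a ⊕ (b ⊕ c)
    ⊕-assoc = ℚP.+-assoc

    ⊕-idˡ : ∀ a → 0ℚ ⊕ a ≡ a
    ⊕-idˡ = ℚP.+-identityˡ

    ⊕-idʳ : ∀ a → a ⊕ 0ℚ ≡ a
    ⊕-idʳ = ℚP.+-identityʳ

    ⊗-comm : ∀ a b → a ⊗ b ≡ b ⊗ a
    ⊗-comm = ℚP.*-comm

    ⊗-assoc : ∀ a b c → (a ⊗ b) ⊗ c ≡ a ⊗ (b ⊗ c)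
    ⊗-assoc = ℚP.*-assoc

    ⊗-zeroˡ : ∀ a → 0ℚ ⊗ a ≡ 0ℚ
    ⊗-zeroˡ = ℚP.*-zeroˡ

    ⊗-zeroʳ : ∀ a → a ⊗ 0ℚ ≡ 0ℚ
    ⊗-zeroʳ = ℚP.*-zeroʳ

    ⊗-idˡ : ∀ a → 1ℚ ⊗ a ≡ a
    ⊗-idˡ = ℚP.*-identityˡ

    ⊗-distribˡ : ∀ a b c → a ⊗ (b ⊕ c) ≡ a ⊗ b ⊕ a ⊗ c
    ⊗-distribˡ = ℚP.*-distribˡ-+

    ⊗-distribʳ : ∀ a b c → (b ⊕ c) ⊗ a ≡ b ⊗ a ⊕ c ⊗ a
    ⊗-distribʳ = ℚP.*-distribʳ-+

    ⊕-inverseʳ : ∀ a → a ⊕ ⊖ a ≡ 0ℚ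
    ⊕-inverseʳ = ℚP.+-inverseʳ

    ⊖-zero : ⊖ 0ℚ ≡ 0ℚ
    ⊖-zero = refl

    ⊖-⊗ : ∀ a b → (⊖ a) ⊗ b ≡ ⊖ (a ⊗ b)
    ⊖-⊗ = solve 2 (λ a b → (:- a) :* b := :- (a :* b)) refl

    ⊕-interchange : ∀ a b c d → (a ⊕ b) ⊕ (c ⊕ d) ≡ (a ⊕ c) ⊕ (b ⊕ d)
    ⊕-interchange = solve 4 (λ a b c d → (a :+ b) :+ (c :+ d) := (a :+ c) :+ (b :+ d)) refl

    ⊕-swap : ∀ a b c → a ⊕ (b ⊕ c) ≡ b ⊕ (a ⊕ c)
    ⊕-swap = solve 3 (λ a b c → a :+ (b :+ c) := b :+ (a :+ c)) refl

    ⊖-unique : ∀ a b → a ⊕ b ≡ 0ℚ → b ≡ ⊖ a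
    ⊖-unique a b h = trans (lem a b) (trans (cong (ℚ._+ (ℚ.- a)) h) (ℚP.+-identityˡ _))
      where
      lem : ∀ a b → b ≡ (a ℚ.+ b) ℚ.+ (ℚ.- a)
      lem = solve 2 (λ a b → b := (a :+ b) :+ (:- a)) refl

    recip : ∀ {p} → p ≢ 0ℚ → ∃ λ q → q ⊗ p ≡ 1ℚ
    recip {p} p≢0 = (ℚ.1/ p) {{ℚ.≢-nonZero p≢0}} , ℚP.*-inverseˡ p {{ℚ.≢-nonZero p≢0}}

open FieldLaws

⊗-cancel-0 : ∀ {p q} → p ≢ 0ℚ → p ⊗ q ≡ 0ℚ → q ≡ 0ℚ
⊗-cancel-0 {p} {q} p≢0 pq≡0 with recip p≢0
... | i , ip≡1 = begin
  q            ≡⟨ sym (⊗-idˡ q) ⟩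
  1ℚ ⊗ q       ≡⟨ cong (_⊗ q) (sym ip≡1) ⟩
  (i ⊗ p) ⊗ q  ≡⟨ ⊗-assoc i p q ⟩
  i ⊗ (p ⊗ q)  ≡⟨ cong (i ⊗_) pq≡0 ⟩
  i ⊗ 0ℚ       ≡⟨ ⊗-zeroʳ i ⟩
  0ℚ ∎
  where open ≡-Reasoning

module RingIdentities where
  opaque
    unfolding _⊕_ _⊗_ ⊖_
    open ℚSolver.+-*-Solver using (solve; _:=_; _:+_; _:*_; :-_; con)

    cross-zero : ∀ a b → a ⊗ b ⊕ (⊖ b) ⊗ a ≡ 0ℚ
    cross-zero = solve 2 (λ a b → a :* b :+ (:- b) :* a := con 0ℚ) refl

    pencil-eq₁ : ∀ b s c a x → b ⊗ (c ⊗ (s ⊗ a ⊕ x)) ≡ ((b ⊗ s) ⊗ c) ⊗ a ⊕ (b ⊗ c) ⊗ x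
    pencil-eq₁ = solve 5 (λ b s c a x → b :* (c :* (s :* a :+ x)) := ((b :* s) :* c) :* a :+ (b :* c) :* x) refl

    pencil-eq₂ : ∀ b s t c → (b ⊗ (s ⊕ ⊖ t)) ⊗ c ≡ (b ⊗ s) ⊗ c ⊕ (⊖ t) ⊗ (b ⊗ c)
    pencil-eq₂ = solve 4 (λ b s t c → (b :* (s :+ (:- t))) :* c := (b :* s) :* c :+ (:- t) :* (b :* c)) refl

    diff≡0 : ∀ s t → s ⊕ ⊖ t ≡ 0ℚ → s ≡ t
    diff≡0 s t h = trans (lem s t) (trans (cong (ℚ._+ t) h) (ℚP.+-identityˡ t))
      where
      lem : ∀ s t → s ≡ (s ℚ.+ (ℚ.- t)) ℚ.+ t
      lem = solve 2 (λ s t → s := (s :+ (:- t)) :+ t) refl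

    row-linear : ∀ e s a b a′ b′ →
      e ⊗ ((s ⊗ a ⊕ b) ⊕ ⊖ (s ⊗ a′ ⊕ b′)) ≡ s ⊗ (e ⊗ (a ⊕ ⊖ a′)) ⊕ e ⊗ (b ⊕ ⊖ b′)
    row-linear = solve 6 (λ e s a b a′ b′ → e :* ((s :* a :+ b) :+ (:- (s :* a′ :+ b′))) :=
      s :* (e :* (a :+ (:- a′))) :+ e :* (b :+ (:- b′))) refl

    row-symmetric : ∀ a b c d → (a ⊕ ⊖ b) ⊗ (c ⊕ ⊖ d) ≡ (b ⊕ ⊖ a) ⊗ (d ⊕ ⊖ c)
    row-symmetric = solve 4 (λ a b c d → (a :+ (:- b)) :* (c :+ (:- d)) := (b :+ (:- a)) :* (d :+ (:- c))) refl

    zero-difference : ∀ a → (0ℚ ⊕ ⊖ 0ℚ) ⊗ a ≡ 0ℚ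
    zero-difference = solve 1 (λ a → (con 0ℚ :+ (:- con 0ℚ)) :* a := con 0ℚ) refl

    unit-difference : ∀ a → (1ℚ ⊕ ⊖ 0ℚ) ⊗ a ≡ a
    unit-difference = solve 1 (λ a → (con 1ℚ :+ (:- con 0ℚ)) :* a := a) refl

    loop-difference : ∀ a b → (a ⊕ ⊖ a) ⊗ b ≡ 0ℚ
    loop-difference = solve 2 (λ a b → (a :+ (:- a)) :* b := con 0ℚ) refl

    spread : ∀ g a b → g ⊗ (a ⊕ ⊖ b) ≡ g ⊗ a ⊕ (⊖ g) ⊗ b
    spread = solve 3 (λ g a b → g :* (a :+ (:- b)) := g :* a :+ (:- g) :* b) refl

    ⊖-involutive-0 : ∀ a → ⊖ a ≡ 0ℚ → a ≡ 0ℚ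
    ⊖-involutive-0 a h = trans (lem a) (cong ℚ.-_ h)
      where
      lem : ∀ a → a ≡ ℚ.- (ℚ.- a)
      lem = solve 1 (λ a → a := :- (:- a)) refl

    double-0 : ∀ a → a ⊕ a ≡ 0ℚ → a ≡ 0ℚ
    double-0 a h = ⊗-cancel-0 {1ℚ ℚ.+ 1ℚ} (λ ()) (trans (lem a) h)
      where
      lem : ∀ a → (1ℚ ℚ.+ 1ℚ) ℚ.* a ≡ a ℚ.+ a
      lem = solve 1 (λ a → (con 1ℚ :+ con 1ℚ) :* a := a :+ a) refl

    midpoint-mass : ∀ g s → (g ⊕ g) ⊕ (⊖ g ⊕ 0ℚ) ⊕ ⊖ s ≡ g ⊕ ⊖ s
    midpoint-mass = solve 2 (λ g s → (g :+ g) :+ ((:- g) :+ con 0ℚ) :+ (:- s) := g :+ (:- s)) refl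

    midpoint-moment : ∀ g a b → (g ⊕ g) ⊗ a ⊕ ((⊖ g) ⊗ b ⊕ 0ℚ) ≡ g ⊗ ((a ⊕ a) ⊕ ⊖ b)
    midpoint-moment = solve 3 (λ g a b → (g :+ g) :* a :+ ((:- g) :* b :+ con 0ℚ) := g :* ((a :+ a) :+ (:- b))) refl

    -- Weights -2γ and γ on the edges to a and b from the point 2a-b act like weight 2γ on ab.
    edge-split : ∀ γ α β a b → (⊖ (γ ⊕ γ)) ⊗ ((0ℚ ⊕ ⊖ α) ⊗ (((a ⊕ a) ⊕ ⊖ b) ⊕ ⊖ a)) ⊕
      (γ ⊗ ((0ℚ ⊕ ⊖ β) ⊗ (((a ⊕ a) ⊕ ⊖ b) ⊕ ⊖ b)) ⊕ 0ℚ) ≡ (γ ⊕ γ) ⊗ ((α ⊕ ⊖ β) ⊗ (a ⊕ ⊖ b))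
    edge-split = solve 5 (λ γ α β a b → (:- (γ :+ γ)) :* ((con 0ℚ :+ (:- α)) :* (((a :+ a) :+ (:- b)) :+ (:- a))) :+
      (γ :* ((con 0ℚ :+ (:- β)) :* (((a :+ a) :+ (:- b)) :+ (:- b))) :+ con 0ℚ) :=
      (γ :+ γ) :* ((α :+ (:- β)) :* (a :+ (:- b)))) refl

    -- With `Γ` eliminated, the weights at `a` and `b` in the affine dependence of `extend₁′` become
    -- the pair `-2γ`, `γ` that `edge-split` expects.
    weight-relation : ∀ Γ g₀ g₁ → (Γ ⊕ Γ) ⊕ ⊖ g₀ ≡ 0ℚ → (⊖ Γ) ⊕ ⊖ g₁ ≡ 0ℚ → g₀ ≡ ⊖ (g₁ ⊕ g₁)
    weight-relation Γ g₀ g₁ h₀ h₁ = trans (lem Γ g₀ g₁) (trans (cong₂ (λ a b → ((ℚ.- a) ℚ.+ ((ℚ.- b) ℚ.+ (ℚ.- b))) ℚ.+ (ℚ.- (g₁ ℚ.+ g₁))) h₀ h₁) (ℚP.+-identityˡ _))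
      where
      lem : ∀ Γ g₀ g₁ → g₀ ≡ ((ℚ.- ((Γ ℚ.+ Γ) ℚ.+ (ℚ.- g₀))) ℚ.+ ((ℚ.- ((ℚ.- Γ) ℚ.+ (ℚ.- g₁))) ℚ.+ (ℚ.- ((ℚ.- Γ) ℚ.+ (ℚ.- g₁))))) ℚ.+ (ℚ.- (g₁ ℚ.+ g₁))
      lem = solve 3 (λ Γ g₀ g₁ → g₀ := ((:- ((Γ :+ Γ) :+ (:- g₀))) :+ ((:- ((:- Γ) :+ (:- g₁))) :+ (:- ((:- Γ) :+ (:- g₁))))) :+ (:- (g₁ :+ g₁))) refl

    -- Grouped so that each of the four terms has a factor that an affine dependence kills: the
    -- first two when summed over the second index, the last two when summed over the first.
    stress-expand : ∀ a b X Y P Q → (a ⊗ b) ⊗ ((X ⊕ ⊖ Y) ⊗ (P ⊕ ⊖ Q)) ≡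
      ((a ⊗ (X ⊗ P)) ⊗ b ⊕ (⊖ (a ⊗ X)) ⊗ (b ⊗ Q)) ⊕ ((⊖ (a ⊗ P)) ⊗ (b ⊗ Y) ⊕ a ⊗ (b ⊗ (Y ⊗ Q)))
    stress-expand = solve 6 (λ a b X Y P Q → (a :* b) :* ((X :+ (:- Y)) :* (P :+ (:- Q))) :=
      ((a :* (X :* P)) :* b :+ (:- (a :* X)) :* (b :* Q)) :+ ((:- (a :* P)) :* (b :* Y) :+ a :* (b :* (Y :* Q)))) refl

    isolate : ∀ l₀ l₁ R a b c d′ e → (l₀ ⊗ l₀) ⊗ a ⊕ ((l₀ ⊗ l₁) ⊗ R ⊕ b) ⊕ (((l₁ ⊗ l₀) ⊗ R ⊕ ((l₁ ⊗ l₁) ⊗ c ⊕ d′)) ⊕ e) ≡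
      (l₀ ⊗ l₁ ⊕ l₀ ⊗ l₁) ⊗ R ⊕ ((l₀ ⊗ l₀) ⊗ a ⊕ (1ℚ ⊗ b ⊕ ((l₁ ⊗ l₁) ⊗ c ⊕ (1ℚ ⊗ d′ ⊕ e))))
    isolate = solve 8 (λ l₀ l₁ R a b c d′ e → (l₀ :* l₀) :* a :+ ((l₀ :* l₁) :* R :+ b) :+ (((l₁ :* l₀) :* R :+ ((l₁ :* l₁) :* c :+ d′)) :+ e) :=
      (l₀ :* l₁ :+ l₀ :* l₁) :* R :+ ((l₀ :* l₀) :* a :+ (con 1ℚ :* b :+ ((l₁ :* l₁) :* c :+ (con 1ℚ :* d′ :+ e))))) refl

open RingIdentities

opaque
  unfolding ∑

  ∑-suc : ∀ k f → ∑ (suc k) f ≡ f zero ⊕ ∑ k (f ∘ suc)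
  ∑-suc k f = refl

  ∑-cong : ∀ k {f g : Fin k → ℚ} → (∀ i → f i ≡ g i) → ∑ k f ≡ ∑ k g
  ∑-cong zero h = refl
  ∑-cong (suc k) h = cong₂ _⊕_ (h zero) (∑-cong k (h ∘ suc))

  ∑-zero : ∀ k {f : Fin k → ℚ} → (∀ i → f i ≡ 0ℚ) → ∑ k f ≡ 0ℚ
  ∑-zero zero h = refl
  ∑-zero (suc k) h = trans (cong₂ _⊕_ (h zero) (∑-zero k (h ∘ suc))) (⊕-idˡ 0ℚ)

  ∑-⊕ : ∀ k (f g : Fin k → ℚ) → ∑ k (λ i → f i ⊕ g i) ≡ ∑ k f ⊕ ∑ k g
  ∑-⊕ zero f g = sym (⊕-idˡ 0ℚ)
  ∑-⊕ (suc k) f g = trans (cong₂ _⊕_ refl (∑-⊕ k (f ∘ suc) (g ∘ suc))) (⊕-interchange _ _ _ _)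

  ∑-⊖ : ∀ k (f : Fin k → ℚ) → ∑ k (λ i → ⊖ (f i)) ≡ ⊖ (∑ k f)
  ∑-⊖ k f = ⊖-unique _ _ (trans (sym (∑-⊕ k f _)) (∑-zero k (λ i → ⊕-inverseʳ (f i))))

  ∑-⊗ˡ : ∀ k c (f : Fin k → ℚ) → ∑ k (λ i → c ⊗ f i) ≡ c ⊗ ∑ k f
  ∑-⊗ˡ zero c f = sym (⊗-zeroʳ c)
  ∑-⊗ˡ (suc k) c f = trans (cong₂ _⊕_ refl (∑-⊗ˡ k c (f ∘ suc))) (sym (⊗-distribˡ c _ _))

  ∑-⊗ʳ : ∀ k c (f : Fin k → ℚ) → ∑ k (λ i → f i ⊗ c) ≡ ∑ k f ⊗ c
  ∑-⊗ʳ k c f = trans (∑-cong k (λ i → ⊗-comm (f i) c)) (trans (∑-⊗ˡ k c f) (⊗-comm c _))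

  ∑-swap : ∀ k l (f : Fin k → Fin l → ℚ) →
    ∑ k (λ i → ∑ l (f i)) ≡ ∑ l (λ j → ∑ k (λ i → f i j))
  ∑-swap zero l f = sym (∑-zero l (λ _ → refl))
  ∑-swap (suc k) l f = trans (cong₂ _⊕_ refl (∑-swap k l (f ∘ suc)))
    (sym (∑-⊕ l (f zero) (λ j → ∑ k (λ i → f (suc i) j))))

  ∑-punch : ∀ k (i : Fin (suc k)) (f : Fin (suc k) → ℚ) →
    ∑ (suc k) f ≡ f i ⊕ ∑ k (f ∘ punchIn i)
  ∑-punch k zero f = refl
  ∑-punch (suc k) (suc i) f = trans (cong (f zero ⊕_) (∑-punch k i (f ∘ suc))) (⊕-swap _ _ _)

  ∑-single : ∀ k (i : Fin k) (f : Fin k → ℚ) → (∀ j → j ≢ i → f j ≡ 0ℚ) → ∑ k f ≡ f i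
  ∑-single (suc k) i f h = trans (∑-punch k i f)
    (trans (cong (f i ⊕_) (∑-zero k (λ j → h _ (FinP.punchInᵢ≢i i j)))) (⊕-idʳ _))

  ∑-split : ∀ a b (f : Fin (a + b) → ℚ) →
    ∑ (a + b) f ≡ ∑ a (λ i → f (i ↑ˡ b)) ⊕ ∑ b (λ i → f (a ↑ʳ i))
  ∑-split zero b f = sym (⊕-idˡ _)
  ∑-split (suc a) b f = trans (cong (f zero ⊕_) (∑-split a b (f ∘ suc))) (sym (⊕-assoc _ _ _))

-- Subsets and counting

count-cong : ∀ k {S T : Subset k} → (∀ i → S i ≡ T i) → count k S ≡ count k T
count-cong zero h = refl
count-cong (suc k) h = cong₂ (λ b m → (if b then 1 else 0) + m) (h zero) (count-cong k (h ∘ suc))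

count-mono : ∀ k {S T : Subset k} → S ⊆ T → count k S ≤ count k T
count-mono zero h = z≤n
count-mono (suc k) {S} {T} h = ℕP.+-mono-≤ (lem (S zero) (T zero) (h zero)) (count-mono k (h ∘ suc))
  where
  lem : ∀ a b → (a ≡ true → b ≡ true) → (if a then 1 else 0) ≤ (if b then 1 else 0)
  lem false b h = z≤n
  lem true b h rewrite h refl = ℕP.≤-refl

count-full : ∀ k → count k full ≡ k
count-full zero = refl
count-full (suc k) = cong suc (count-full k)

∅ : ∀ {k} → Subset k
∅ _ = false

count-∅ : ∀ k {S : Subset k} → (∀ i → S i ≡ false) → count k S ≡ 0
count-∅ zero h = refl
count-∅ (suc k) h rewrite h zero = count-∅ k (h ∘ suc)

count-pos : ∀ k (S : Subset k) → 0 < count k S → ∃ λ i → S i ≡ true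
count-pos (suc k) S h with S zero in eq
... | true = zero , eq
... | false with count-pos k (S ∘ suc) h
... | i , p = suc i , p

count-in : ∀ k (S : Subset k) i → S i ≡ true → 0 < count k S
count-in (suc k) S zero p rewrite p = s≤s z≤n
count-in (suc k) S (suc i) p = ℕP.≤-trans (count-in k (S ∘ suc) i p) (ℕP.m≤n+m _ _)

infixl 22 _─_ _∖_
infixl 21 _∩_ _⊔_
_∖_ : ∀ {k} → Subset k → Subset k → Subset k
(S ∖ T) i = S i ∧ not (T i)

_∩_ : ∀ {k} → Subset k → Subset k → Subset k
(S ∩ T) i = S i ∧ T i

_⊔_ : ∀ {k} → Subset k → Subset k → Subset k
(S ⊔ T) i = S i ∨ T i

⟦_⟧ : ∀ {k} → Fin k → Subset k
⟦ x ⟧ i = i == x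

_─_ : ∀ {k} → Subset k → Fin k → Subset k
S ─ x = S ∖ ⟦ x ⟧

count-split : ∀ k (S T : Subset k) → count k (S ∩ T) + count k (S ∖ T) ≡ count k S
count-split zero S T = refl
count-split (suc k) S T with S zero | T zero
... | false | _ = count-split k (S ∘ suc) (T ∘ suc)
... | true | true = cong suc (count-split k (S ∘ suc) (T ∘ suc))
... | true | false = trans (ℕP.+-suc _ _) (cong suc (count-split k (S ∘ suc) (T ∘ suc)))

==-refl : ∀ {k} (x : Fin k) → (x == x) ≡ true
==-refl x = dec-true (x FinP.≟ x) refl

==-elim : ∀ {k} {x y : Fin k} → (x == y) ≡ true → x ≡ y
==-elim {x = x} {y} = does-elim (x FinP.≟ y)

==-neq : ∀ {k} {x y : Fin k} → x ≢ y → (x == y) ≡ false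
==-neq {x = x} {y} = dec-false (x FinP.≟ y)

count-⟦⟧ : ∀ k (x : Fin k) → count k ⟦ x ⟧ ≡ 1
count-⟦⟧ (suc k) zero = cong suc (count-∅ k (λ i → refl))
count-⟦⟧ (suc k) (suc x) = trans (count-cong k (λ i → bool-ext
  (λ p → dec-true (i FinP.≟ x) (FinP.suc-injective (==-elim {x = suc i} {suc x} p)))
  (λ p → dec-true (suc i FinP.≟ suc x) (cong suc (==-elim {x = i} p))))) (count-⟦⟧ k x)

─-in : ∀ {k} {S : Subset k} {x y} → S y ≡ true → y ≢ x → (S ─ x) y ≡ true
─-in p ne = ∧-intro p (cong not (==-neq ne))

─-ne : ∀ {k} {S : Subset k} {x y} → (S ─ x) y ≡ true → y ≢ x
─-ne {S = S} {x} p refl with S x | x == x | ==-refl x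
─-ne {S = S} {x} () refl | true | .true | refl
─-ne {S = S} {x} () refl | false | .true | refl

─-self : ∀ {k} {S : Subset k} {x} → (S ─ x) x ≡ false
─-self {S = S} {x} = ¬true⇒false (λ p → ─-ne {S = S} p refl)

count-─ : ∀ {k} (S : Subset k) x → S x ≡ true → count k S ≡ suc (count k (S ─ x))
count-─ {k} S x p = trans (sym (count-split k S ⟦ x ⟧)) (cong (_+ count k (S ─ x))
  (trans (count-cong k (λ i → bool-ext ∧-snd (λ q → ∧-intro (subst (λ z → S z ≡ true) (sym (==-elim {x = i} q)) p) q)))
   (count-⟦⟧ k x)))

count-─≥ : ∀ {k} (S : Subset k) x → count k S ≤ suc (count k (S ─ x))
count-─≥ {k} S x with bool-cases (S x)
... | inj₁ p = ℕP.≤-reflexive (count-─ S x p)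
... | inj₂ p = ℕP.m≤n⇒m≤1+n (count-mono k (λ y q → ─-in {S = S} q (λ { refl → true≢false q p })))

count-∪≤ : ∀ k (S A B : Subset k) → (∀ i → S i ≡ true → A i ≡ true ⊎ B i ≡ true) →
  count k S ≤ count k A + count k B
count-∪≤ k S A B h = subst (_≤ count k A + count k B) (count-split k S A)
  (ℕP.+-mono-≤ (count-mono k (λ i p → ∧-snd p)) (count-mono k (λ i p → lem i p (h i (∧-fst p)))))
  where
  lem : ∀ i → (S ∖ A) i ≡ true → A i ≡ true ⊎ B i ≡ true → B i ≡ true
  lem i p (inj₁ q) = ⊥-elim (not-elim (∧-snd {a = S i} p) q)
  lem i p (inj₂ q) = q

count-∪≥ : ∀ k (S A B : Subset k) → A ⊆ S → B ⊆ S → (∀ i → A i ≡ true → B i ≡ true → ⊥) →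
  count k A + count k B ≤ count k S
count-∪≥ k S A B h₁ h₂ dj = subst (count k A + count k B ≤_) (count-split k S A)
  (ℕP.+-mono-≤ (count-mono k (λ i p → ∧-intro (h₁ i p) p))
    (count-mono k (λ i p → ∧-intro (h₂ i p) (not-intro (λ q → dj i q p)))))

count-<-witness : ∀ k (S T : Subset k) → count k S < count k T → ∃ λ i → T i ≡ true × S i ≡ false
count-<-witness k S T h with count-pos k (T ∖ S) (ℕP.≰⇒> λ q → ℕP.<⇒≱ h (begin
    count k T                         ≡⟨ sym (count-split k T S) ⟩
    count k (T ∩ S) + count k (T ∖ S) ≤⟨ ℕP.+-mono-≤ (count-mono k (λ i → ∧-snd)) q ⟩
    count k S + 0                     ≡⟨ ℕP.+-identityʳ _ ⟩
    count k S ∎))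
  where open ℕP.≤-Reasoning
... | i , p = i , ∧-fst p , ¬true⇒false (not-elim (∧-snd {a = T i} p))

count-≤-full : ∀ k (S : Subset k) → count k S ≤ k
count-≤-full k S = subst (count k S ≤_) (count-full k) (count-mono k (λ _ _ → refl))

choose : ∀ k (S : Subset k) j → j ≤ count k S → ∃ λ T → T ⊆ S × count k T ≡ j
choose k S zero h = ∅ , (λ _ ()) , count-∅ k (λ _ → refl)
choose zero S (suc j) ()
choose (suc k) S (suc j) h with S zero in eq
... | true with choose k (S ∘ suc) j (ℕP.≤-pred h)
... | T , sub , c = (λ { zero → true ; (suc i) → T i }) , (λ { zero _ → eq ; (suc i) p → sub i p }) , cong suc c
choose (suc k) S (suc j) h | false with choose k (S ∘ suc) (suc j) h
... | T , sub , c = (λ { zero → false ; (suc i) → T i }) , (λ { zero () ; (suc i) p → sub i p }) , c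

enum : ∀ k (S : Subset k) → Fin (count k S) → Fin k
enum (suc k) S i with S zero
enum (suc k) S zero | true = zero
enum (suc k) S (suc i) | true = suc (enum k (S ∘ suc) i)
enum (suc k) S i | false = suc (enum k (S ∘ suc) i)

enum-in : ∀ k (S : Subset k) i → S (enum k S i) ≡ true
enum-in (suc k) S i with S zero in eq
enum-in (suc k) S zero | true = eq
enum-in (suc k) S (suc i) | true = enum-in k (S ∘ suc) i
enum-in (suc k) S i | false = enum-in k (S ∘ suc) i

enum-inj : ∀ k (S : Subset k) i j → enum k S i ≡ enum k S j → i ≡ j
enum-inj (suc k) S i j h with S zero
enum-inj (suc k) S zero zero h | true = refl
enum-inj (suc k) S (suc i) (suc j) h | true = cong suc (enum-inj k (S ∘ suc) i j (FinP.suc-injective h))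
enum-inj (suc k) S i j h | false = enum-inj k (S ∘ suc) i j (FinP.suc-injective h)

enum-surj : ∀ k (S : Subset k) x → S x ≡ true → ∃ λ i → enum k S i ≡ x
enum-surj (suc k) S x p with S zero in eq
enum-surj (suc k) S zero p | true = zero , refl
enum-surj (suc k) S (suc x) p | true with enum-surj k (S ∘ suc) x p
... | i , q = suc i , cong suc q
enum-surj (suc k) S zero p | false = ⊥-elim (true≢false p eq)
enum-surj (suc k) S (suc x) p | false with enum-surj k (S ∘ suc) x p
... | i , q = i , cong suc q

inj⇒≤count : ∀ k (S : Subset k) j (g : Fin j → Fin k) → (∀ x y → g x ≡ g y → x ≡ y) →
  (∀ x → S (g x) ≡ true) → j ≤ count k S
inj⇒≤count k S zero g inj h = z≤n
inj⇒≤count k S (suc j) g inj h = subst (suc j ≤_) (sym (count-─ S (g zero) (h zero)))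
  (s≤s (inj⇒≤count k (S ─ g zero) j (g ∘ suc) (λ x y e → FinP.suc-injective (inj _ _ e))
    (λ x → ─-in {S = S} (h (suc x)) (λ e → case inj _ _ e of λ ()))))

-- Linear independence, elimination of columns and exchange

Ind : ∀ {ρ} {C : Set} → (Fin ρ → C → ℚ) → Set
Ind {ρ} b = ∀ (c : Fin ρ → ℚ) → (∀ x → ∑ ρ (λ i → c i ⊗ b i x) ≡ 0ℚ) → ∀ i → c i ≡ 0ℚ

Ind-stable : ∀ {ρ} {C : Set} (b : Fin ρ → C → ℚ) → NN (Ind b) → Ind b
Ind-stable b h c z i = decidable-stable (c i ℚP.≟ 0ℚ) (h >>= λ ind → return (ind c z i))

Ind-cong : ∀ {ρ} {C : Set} {b b′ : Fin ρ → C → ℚ} → (∀ i x → b i x ≡ b′ i x) → Ind b → Ind b′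
Ind-cong {ρ} e ind c z = ind c (λ x → trans (∑-cong ρ (λ i → cong (c i ⊗_) (e i x))) (z x))

¬Ind⇒ : ∀ {ρ} {C : Set} (b : Fin ρ → C → ℚ) → ¬ Ind b →
  NN (∃ λ (c : Fin ρ → ℚ) → (∀ x → ∑ ρ (λ i → c i ⊗ b i x) ≡ 0ℚ) × ∃ λ e → c e ≢ 0ℚ)
¬Ind⇒ b h k = h (λ c z i → decidable-stable (c i ℚP.≟ 0ℚ) (λ ne → k (c , z , i , ne)))

∑-lin : ∀ k s t (u c w : Fin k → ℚ) →
  ∑ k (λ i → (s ⊗ u i ⊕ t ⊗ c i) ⊗ w i) ≡ s ⊗ ∑ k (λ i → u i ⊗ w i) ⊕ t ⊗ ∑ k (λ i → c i ⊗ w i)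
∑-lin k s t u c w = begin
  ∑ k (λ i → (s ⊗ u i ⊕ t ⊗ c i) ⊗ w i)
    ≡⟨ ∑-cong k (λ i → trans (⊗-distribʳ _ _ _) (cong₂ _⊕_ (⊗-assoc _ _ _) (⊗-assoc _ _ _))) ⟩
  ∑ k (λ i → s ⊗ (u i ⊗ w i) ⊕ t ⊗ (c i ⊗ w i))
    ≡⟨ ∑-⊕ k _ _ ⟩
  ∑ k (λ i → s ⊗ (u i ⊗ w i)) ⊕ ∑ k (λ i → t ⊗ (c i ⊗ w i))
    ≡⟨ cong₂ _⊕_ (∑-⊗ˡ k s _) (∑-⊗ˡ k t _) ⟩
  s ⊗ ∑ k (λ i → u i ⊗ w i) ⊕ t ⊗ ∑ k (λ i → c i ⊗ w i) ∎
  where open ≡-Reasoning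

lin-zero : ∀ s t {x y} → x ≡ 0ℚ → y ≡ 0ℚ → s ⊗ x ⊕ t ⊗ y ≡ 0ℚ
lin-zero s t refl refl = trans (cong₂ _⊕_ (⊗-zeroʳ s) (⊗-zeroʳ t)) (⊕-idˡ 0ℚ)

-- If c is a relation among the remaining columns with c e ≠ 0, then row e can be removed.
drop-column : ∀ ρ {C : Set} (a : Fin ρ → C → ℚ) (z : Fin ρ → ℚ) →
  (∀ (c : Fin ρ → ℚ) → (∀ x → ∑ ρ (λ i → c i ⊗ a i x) ≡ 0ℚ) → ∑ ρ (λ i → c i ⊗ z i) ≡ 0ℚ → ∀ i → c i ≡ 0ℚ) →
  NN (∃ λ ρ′ → Σ (Fin ρ′ → Fin ρ) λ g → ρ ≤ suc ρ′ × Ind (a ∘ g))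
drop-column ρ a z h = em (Ind a) >>= λ where
    (yes ind) → return (ρ , id , ℕP.n≤1+n ρ , ind)
    (no dep) → ¬Ind⇒ a dep >>= λ (c , k , e , ne) → return (go ρ a z h c k e ne)
  where
  go : ∀ ρ {C : Set} (a : Fin ρ → C → ℚ) (z : Fin ρ → ℚ) →
    (∀ (c : Fin ρ → ℚ) → (∀ x → ∑ ρ (λ i → c i ⊗ a i x) ≡ 0ℚ) → ∑ ρ (λ i → c i ⊗ z i) ≡ 0ℚ → ∀ i → c i ≡ 0ℚ) →
    ∀ (c : Fin ρ → ℚ) → (∀ x → ∑ ρ (λ i → c i ⊗ a i x) ≡ 0ℚ) → ∀ e → c e ≢ 0ℚ →
    ∃ λ ρ′ → Σ (Fin ρ′ → Fin ρ) λ g → ρ ≤ suc ρ′ × Ind (a ∘ g)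
  go (suc ρ) a z h c k e ne = ρ , punchIn e , ℕP.≤-refl , ind
    where
    ind : Ind (a ∘ punchIn e)
    ind c′ k′ j = trans (sym (insertAt-punchIn c′ e 0ℚ j)) (h c″ k″ β≡0 (punchIn e j))
      where
      c″ = insertAt c′ e 0ℚ
      ∑c″ : ∀ w → ∑ (suc ρ) (λ i → c″ i ⊗ w i) ≡ ∑ ρ (λ i → c′ i ⊗ w (punchIn e i))
      ∑c″ w = trans (∑-punch ρ e _) (trans (cong₂ _⊕_
        (trans (cong (_⊗ w e) (insertAt-lookup c′ e 0ℚ)) (⊗-zeroˡ _))
        (∑-cong ρ (λ i → cong (_⊗ w (punchIn e i)) (insertAt-punchIn c′ e 0ℚ i)))) (⊕-idˡ _))
      k″ : ∀ x → ∑ (suc ρ) (λ i → c″ i ⊗ a i x) ≡ 0ℚ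
      k″ x = trans (∑c″ (λ i → a i x)) (k′ x)
      α = ∑ (suc ρ) (λ i → c i ⊗ z i)
      β = ∑ (suc ρ) (λ i → c″ i ⊗ z i)
      -- Two relations among the columns of `a`, combined so that their values at `z` cancel. The
      -- hypothesis kills the combination, and at coordinate `e`, where `c″` is zero, this leaves
      -- `β ⊗ c e`.
      comb≡0 : ∀ i → α ⊗ c″ i ⊕ (⊖ β) ⊗ c i ≡ 0ℚ
      comb≡0 = h _ (λ x → trans (∑-lin (suc ρ) α (⊖ β) c″ c _) (lin-zero α (⊖ β) (k″ x) (k x)))
        (trans (∑-lin (suc ρ) α (⊖ β) c″ c z) (cross-zero α β))
      βc≡0 : c e ⊗ β ≡ 0ℚ
      βc≡0 = begin
        c e ⊗ β ≡⟨ ⊗-comm _ _ ⟩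
        β ⊗ c e ≡⟨ sym (⊕-idˡ _) ⟩
        0ℚ ⊕ β ⊗ c e ≡⟨ cong (_⊕ β ⊗ c e) (sym (trans (cong₂ _⊕_ (sym (trans (cong (α ⊗_) (insertAt-lookup c′ e 0ℚ)) (⊗-zeroʳ α))) refl) (comb≡0 e))) ⟩
        (0ℚ ⊕ (⊖ β) ⊗ c e) ⊕ β ⊗ c e ≡⟨ cong₂ _⊕_ (trans (⊕-idˡ _) (⊖-⊗ β (c e))) refl ⟩
        ⊖ (β ⊗ c e) ⊕ β ⊗ c e ≡⟨ trans (⊕-comm _ _) (⊕-inverseʳ _) ⟩
        0ℚ ∎
        where open ≡-Reasoning
      β≡0 : β ≡ 0ℚ
      β≡0 = ⊗-cancel-0 ne βc≡0

-- Each column costs at most one row. With no columns left over this bounds the size of an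
-- independent family; in `separate′` the dropped columns are those of the shared vertices.
drop-columns : ∀ j ρ {C : Set} (a : Fin ρ → C → ℚ) (b : Fin ρ → Fin j → ℚ) →
  (∀ (c : Fin ρ → ℚ) → (∀ x → ∑ ρ (λ i → c i ⊗ a i x) ≡ 0ℚ) → (∀ y → ∑ ρ (λ i → c i ⊗ b i y) ≡ 0ℚ) → ∀ i → c i ≡ 0ℚ) →
  NN (∃ λ ρ′ → Σ (Fin ρ′ → Fin ρ) λ g → ρ ≤ ρ′ + j × Ind (a ∘ g))
drop-columns zero ρ a b h = return (ρ , id , ℕP.≤-reflexive (sym (ℕP.+-identityʳ ρ)) , λ c k → h c k (λ ()))
drop-columns (suc j) ρ a b h =
  drop-column ρ (λ i → [ a i , b i ∘ suc ]′) (λ i → b i zero)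
    (λ c k k₀ → h c (k ∘ inj₁) (λ { zero → k₀ ; (suc y) → k (inj₂ y) })) >>= λ (ρ₁ , g₁ , le₁ , ind₁) →
  drop-columns j ρ₁ (a ∘ g₁) (λ i y → b (g₁ i) (suc y))
    (λ c k k′ → ind₁ c (λ { (inj₁ x) → k x ; (inj₂ y) → k′ y })) >>= λ (ρ₂ , g₂ , le₂ , ind₂) →
  return (ρ₂ , g₁ ∘ g₂ , ℕP.≤-trans le₁ (ℕP.≤-trans (s≤s le₂) (ℕP.≤-reflexive (sym (ℕP.+-suc ρ₂ j)))) , ind₂)

-- Over the empty set of columns only the empty family is independent, so dropping all `j` columns
-- must have used up every row.
Ind-size : ∀ {ρ j} (b : Fin ρ → Fin j → ℚ) → Ind b → ρ ≤ j
Ind-size {ρ} {j} b ind = decidable-stable (ρ ℕP.≤? j)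
  (drop-columns j ρ {⊥} (λ _ ()) b (λ c _ → ind c) >>= λ where
    (zero , g , le , _) → return le
    (suc ρ′ , g , le , ind′) → λ _ → case ind′ (λ _ → 1ℚ) (λ ()) zero of λ ())

InSpan : ∀ {σ} {C : Set} → (Fin σ → C → ℚ) → (C → ℚ) → Set
InSpan {σ} b v = ∃ λ (z : Fin σ → ℚ) → ∀ x → v x ≡ ∑ σ (λ j → z j ⊗ b j x)

∑-combine : ∀ k l (c : Fin k → ℚ) (z : Fin k → Fin l → ℚ) (w : Fin l → ℚ) →
  ∑ k (λ i → c i ⊗ ∑ l (λ j → z i j ⊗ w j)) ≡ ∑ l (λ j → ∑ k (λ i → c i ⊗ z i j) ⊗ w j)
∑-combine k l c z w = begin
  ∑ k (λ i → c i ⊗ ∑ l (λ j → z i j ⊗ w j))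
    ≡⟨ ∑-cong k (λ i → sym (∑-⊗ˡ l (c i) _)) ⟩
  ∑ k (λ i → ∑ l (λ j → c i ⊗ (z i j ⊗ w j)))
    ≡⟨ ∑-swap k l _ ⟩
  ∑ l (λ j → ∑ k (λ i → c i ⊗ (z i j ⊗ w j)))
    ≡⟨ ∑-cong l (λ j → trans (∑-cong k (λ i → sym (⊗-assoc _ _ _))) (∑-⊗ʳ k (w j) _)) ⟩
  ∑ l (λ j → ∑ k (λ i → c i ⊗ z i j) ⊗ w j) ∎
  where open ≡-Reasoning

-- The coefficient matrix of the `b i` over `b′` has independent rows and only `σ` columns.
steinitz : ∀ {ρ σ} {C : Set} (b : Fin ρ → C → ℚ) (b′ : Fin σ → C → ℚ) →
  Ind b → (∀ i → InSpan b′ (b i)) → ρ ≤ σ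
steinitz {ρ} {σ} b b′ ind sp = Ind-size (λ i → proj₁ (sp i)) λ c k → ind c λ x → begin
  ∑ ρ (λ i → c i ⊗ b i x)
    ≡⟨ ∑-cong ρ (λ i → cong (c i ⊗_) (proj₂ (sp i) x)) ⟩
  ∑ ρ (λ i → c i ⊗ ∑ σ (λ j → proj₁ (sp i) j ⊗ b′ j x))
    ≡⟨ ∑-combine ρ σ c _ _ ⟩
  ∑ σ (λ j → ∑ ρ (λ i → c i ⊗ proj₁ (sp i) j) ⊗ b′ j x)
    ≡⟨ ∑-zero σ (λ j → trans (cong (_⊗ b′ j x) (k j)) (⊗-zeroˡ _)) ⟩
  0ℚ ∎
  where open ≡-Reasoning

infixr 5 _◂_
_◂_ : ∀ {ρ} {A : Set} → A → (Fin ρ → A) → Fin (suc ρ) → A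
(v ◂ b) zero = v
(v ◂ b) (suc i) = b i

Ind-◂ : ∀ {ρ} {C : Set} (v : C → ℚ) (b : Fin ρ → C → ℚ) → Ind b → ¬ InSpan b v → Ind (v ◂ b)
Ind-◂ {ρ} v b ind out c k = λ { zero → c₀≡0 ; (suc i) → ind (c ∘ suc) rest i }
  where
  c₀≡0 : c zero ≡ 0ℚ
  c₀≡0 = decidable-stable (c zero ℚP.≟ 0ℚ) λ ne → let (q , q*c≡1) = recip ne in
    out ((λ j → q ⊗ ⊖ (c (suc j))) , λ x → begin
      v x                   ≡⟨ sym (⊗-idˡ _) ⟩
      1ℚ ⊗ v x              ≡⟨ cong (_⊗ v x) (sym q*c≡1) ⟩
      (q ⊗ c zero) ⊗ v x    ≡⟨ ⊗-assoc _ _ _ ⟩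
      q ⊗ (c zero ⊗ v x)    ≡⟨ cong (q ⊗_) (⊖-unique _ _ (trans (⊕-comm _ _) (trans (sym (∑-suc ρ _)) (k x)))) ⟩
      q ⊗ ⊖ (∑ ρ (λ i → c (suc i) ⊗ b i x)) ≡⟨ cong (q ⊗_) (sym (∑-⊖ ρ (λ i → c (suc i) ⊗ b i x))) ⟩
      q ⊗ ∑ ρ (λ i → ⊖ (c (suc i) ⊗ b i x)) ≡⟨ sym (∑-⊗ˡ ρ q _) ⟩
      ∑ ρ (λ i → q ⊗ ⊖ (c (suc i) ⊗ b i x))
        ≡⟨ ∑-cong ρ (λ i → trans (cong (q ⊗_) (sym (⊖-⊗ _ _))) (sym (⊗-assoc _ _ _))) ⟩
      ∑ ρ (λ i → (q ⊗ ⊖ (c (suc i))) ⊗ b i x) ∎)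
    where open ≡-Reasoning
  rest : ∀ x → ∑ ρ (λ i → c (suc i) ⊗ b i x) ≡ 0ℚ
  rest x = trans (sym (⊕-idˡ _)) (trans (cong₂ _⊕_ (sym (trans (cong (_⊗ v x) c₀≡0) (⊗-zeroˡ _))) refl) (trans (sym (∑-suc ρ _)) (k x)))

-- Pencils of matrices

-- Left kernel vectors of s A + B for distinct s behave like eigenvectors for distinct eigenvalues.
pencil-kernels-independent : ∀ {ρ} {C : Set} (A B : Fin ρ → C → ℚ) → Ind A →
  ∀ j (σ : Fin j → ℚ) (c : Fin j → Fin ρ → ℚ) → (∀ i i′ → σ i ≡ σ i′ → i ≡ i′) →
  (∀ i → ∃ λ e → c i e ≢ 0ℚ) →
  (∀ i x → ∑ ρ (λ e → c i e ⊗ (σ i ⊗ A e x ⊕ B e x)) ≡ 0ℚ) → Ind c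
pencil-kernels-independent {ρ} A B ind zero σ c inj nz ker β k ()
pencil-kernels-independent {ρ} A B ind (suc j) σ c inj nz ker β k = λ { zero → β₀ ; (suc i) → βs i }
  where
  open ≡-Reasoning
  -- The kernel equations add up to `(Σ β σ c) A + (Σ β c) B`; the second part vanishes by `k`, and
  -- the rows of `A` are independent.
  weighted : ∀ e → ∑ (suc j) (λ i → (β i ⊗ σ i) ⊗ c i e) ≡ 0ℚ
  weighted = ind _ λ x → begin
    ∑ ρ (λ e → ∑ (suc j) (λ i → (β i ⊗ σ i) ⊗ c i e) ⊗ A e x)
      ≡⟨ sym (⊕-idʳ _) ⟩
    ∑ ρ (λ e → ∑ (suc j) (λ i → (β i ⊗ σ i) ⊗ c i e) ⊗ A e x) ⊕ 0ℚ
      ≡⟨ cong₂ _⊕_ refl (sym (∑-zero ρ (λ e → trans (cong (_⊗ B e x) (k e)) (⊗-zeroˡ _)))) ⟩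
    ∑ ρ (λ e → ∑ (suc j) (λ i → (β i ⊗ σ i) ⊗ c i e) ⊗ A e x) ⊕ ∑ ρ (λ e → ∑ (suc j) (λ i → β i ⊗ c i e) ⊗ B e x)
      ≡⟨ sym (∑-⊕ ρ _ _) ⟩
    ∑ ρ (λ e → ∑ (suc j) (λ i → (β i ⊗ σ i) ⊗ c i e) ⊗ A e x ⊕ ∑ (suc j) (λ i → β i ⊗ c i e) ⊗ B e x)
      ≡⟨ ∑-cong ρ (λ e → trans (cong₂ _⊕_ (sym (∑-⊗ʳ (suc j) (A e x) _)) (sym (∑-⊗ʳ (suc j) (B e x) _)))
           (trans (sym (∑-⊕ (suc j) _ _)) (∑-cong (suc j) (λ i → sym (pencil-eq₁ (β i) (σ i) (c i e) (A e x) (B e x)))))) ⟩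
    ∑ ρ (λ e → ∑ (suc j) (λ i → β i ⊗ (c i e ⊗ (σ i ⊗ A e x ⊕ B e x))))
      ≡⟨ ∑-swap ρ (suc j) _ ⟩
    ∑ (suc j) (λ i → ∑ ρ (λ e → β i ⊗ (c i e ⊗ (σ i ⊗ A e x ⊕ B e x))))
      ≡⟨ ∑-zero (suc j) (λ i → trans (∑-⊗ˡ ρ (β i) _) (trans (cong (β i ⊗_) (ker i x)) (⊗-zeroʳ _))) ⟩
    0ℚ ∎
  -- Subtracting `σ zero` times the given relation removes the term of index zero, which leaves a
  -- relation for the induction.
  full-shift : ∀ e → ∑ (suc j) (λ i → (β i ⊗ (σ i ⊕ ⊖ σ zero)) ⊗ c i e) ≡ 0ℚ
  full-shift e = begin
    ∑ (suc j) (λ i → (β i ⊗ (σ i ⊕ ⊖ σ zero)) ⊗ c i e)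
      ≡⟨ ∑-cong (suc j) (λ i → pencil-eq₂ (β i) (σ i) (σ zero) (c i e)) ⟩
    ∑ (suc j) (λ i → (β i ⊗ σ i) ⊗ c i e ⊕ (⊖ σ zero) ⊗ (β i ⊗ c i e))
      ≡⟨ ∑-⊕ (suc j) _ _ ⟩
    _ ≡⟨ cong₂ _⊕_ (weighted e) (trans (∑-⊗ˡ (suc j) (⊖ σ zero) _) (trans (cong (⊖ σ zero ⊗_) (k e)) (⊗-zeroʳ _))) ⟩
    0ℚ ⊕ 0ℚ ≡⟨ ⊕-idˡ _ ⟩
    0ℚ ∎
  shifted : ∀ e → ∑ j (λ i → (β (suc i) ⊗ (σ (suc i) ⊕ ⊖ σ zero)) ⊗ c (suc i) e) ≡ 0ℚ
  shifted e = trans (sym (⊕-idˡ _)) (trans (cong₂ _⊕_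
    (sym (trans (cong (_⊗ c zero e) (trans (cong (β zero ⊗_) (⊕-inverseʳ _)) (⊗-zeroʳ _))) (⊗-zeroˡ _))) refl)
    (trans (sym (∑-suc j _)) (full-shift e)))
  βs : ∀ i → β (suc i) ≡ 0ℚ
  βs i = ⊗-cancel-0 {p = σ (suc i) ⊕ ⊖ σ zero}
    (λ eq → case inj (suc i) zero (diff≡0 _ _ eq) of λ ())
    (trans (⊗-comm _ _) (pencil-kernels-independent A B ind j (σ ∘ suc) (c ∘ suc)
      (λ i i′ eq → FinP.suc-injective (inj _ _ eq)) (nz ∘ suc) (ker ∘ suc) _ shifted i))
  β₀ : β zero ≡ 0ℚ
  β₀ = let (e , ne) = nz zero in ⊗-cancel-0 ne (begin
    c zero e ⊗ β zero ≡⟨ ⊗-comm _ _ ⟩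
    β zero ⊗ c zero e ≡⟨ sym (⊕-idʳ _) ⟩
    β zero ⊗ c zero e ⊕ 0ℚ ≡⟨ cong₂ _⊕_ refl (sym (∑-zero j (λ i → trans (cong (_⊗ c (suc i) e) (βs i)) (⊗-zeroˡ _)))) ⟩
    _ ≡⟨ sym (∑-suc j (λ i → β i ⊗ c i e)) ⟩
    ∑ (suc j) (λ i → β i ⊗ c i e) ≡⟨ k e ⟩
    0ℚ ∎)

Eventually : (ℕ → Set) → Set
Eventually P = NN (∃ λ N → ∀ s → N ≤ s → P s)

ev-map : {P Q : ℕ → Set} → (∀ s → P s → Q s) → Eventually P → Eventually Q
ev-map f h = h >>= λ (N , p) → return (N , λ s le → f s (p s le))

ev-all : ∀ k {P : Fin k → ℕ → Set} → (∀ i → Eventually (P i)) → Eventually (λ s → ∀ i → P i s)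
ev-all zero h = return (0 , λ _ _ ())
ev-all (suc k) h = h zero >>= λ (N , p) → ev-all k (h ∘ suc) >>= λ (M , q) →
  return (N ℕ.⊔ M , λ s le → λ { zero → p s (ℕP.≤-trans (ℕP.m≤m⊔n N M) le)
                              ; (suc i) → q s (ℕP.≤-trans (ℕP.m≤n⊔m N M) le) i })

-- If dependence recurred for arbitrarily large `s`, `collect` would gather `ρ + 1` distinct
-- parameters with nonzero kernel vectors. These would be independent vectors of length `ρ`.
pencil-independent : ∀ {ρ} {C : Set} (σ : ℕ → ℚ) → (∀ s t → σ s ≡ σ t → s ≡ t) →
  (A B : Fin ρ → C → ℚ) → Ind A → Eventually (λ s → Ind (λ e x → σ s ⊗ A e x ⊕ B e x))
pencil-independent {ρ} {C} σ inj A B ind notEv = collect (suc ρ) λ (s , N , bd , sinj , c , nz , ker) →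
    ℕP.1+n≰n (Ind-size c (pencil-kernels-independent A B ind (suc ρ) (σ ∘ s) c
      (λ i i′ eq → sinj i i′ (inj _ _ eq)) nz ker))
  where
  M : ℕ → Fin ρ → C → ℚ
  M s e x = σ s ⊗ A e x ⊕ B e x
  Bad : ℕ → Set
  Bad j = Σ (Fin j → ℕ) λ s → ∃ λ N → (∀ i → s i < N) × (∀ i i′ → s i ≡ s i′ → i ≡ i′) ×
    Σ (Fin j → Fin ρ → ℚ) λ c → (∀ i → ∃ λ e → c i e ≢ 0ℚ) × (∀ i x → ∑ ρ (λ e → c i e ⊗ M (s i) e x) ≡ 0ℚ)
  next : ∀ N → NN (∃ λ s → N ≤ s × ¬ Ind (M s))
  next N k = notEv (N , λ s le → Ind-stable (M s) (λ ¬i → k (s , le , ¬i)))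
  collect : ∀ j → NN (Bad j)
  collect zero = return ((λ ()) , 0 , (λ ()) , (λ ()) , (λ ()) , (λ ()) , (λ ()))
  collect (suc j) = collect j >>= λ (s , N , bd , sinj , c , nz , ker) → next N >>= λ (t , le , ¬i) →
    ¬Ind⇒ (M t) ¬i >>= λ (c₀ , ker₀ , nz₀) →
    return (t ◂ s , suc t
      , (λ { zero → ℕP.≤-refl ; (suc i) → ℕP.m≤n⇒m≤1+n (ℕP.≤-trans (bd i) le) })
      , (λ { zero zero _ → refl
           ; zero (suc i) eq → ⊥-elim (ℕP.<⇒≢ (ℕP.≤-trans (bd i) le) (sym eq))
           ; (suc i) zero eq → ⊥-elim (ℕP.<⇒≢ (ℕP.≤-trans (bd i) le) eq)
           ; (suc i) (suc i′) eq → cong suc (sinj i i′ eq) })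
      , c₀ ◂ c , (λ { zero → nz₀ ; (suc i) → nz i }) , (λ { zero → ker₀ ; (suc i) → ker i }))

-- The parameter is `s + 1`, never zero, so that a pencil can be divided by it.
ι : ℕ → ℚ
ι s = mkℚ (ℤ.+ suc s) 0 (Coprime.sym (Coprime.1-coprimeTo (suc s)))

ι-inj : ∀ s t → ι s ≡ ι t → s ≡ t
ι-inj s t eq = ℕP.suc-injective (cong (ℤ.∣_∣ ∘ ℚ.↥_) eq)

ι≢0 : ∀ s → ι s ≢ 0ℚ
ι≢0 s ()

-- Division by `ι s` turns the pencil into `A + τ s B` with distinct parameters `τ s`, and the
-- previous lemma applies with the two matrices exchanged.
pencil-independent′ : ∀ {ρ} {C : Set} (A B : Fin ρ → C → ℚ) → Ind B →
  Eventually (λ s → Ind (λ e x → ι s ⊗ A e x ⊕ B e x))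
pencil-independent′ {ρ} A B ind = ev-map flip (pencil-independent τ τ-inj B A ind)
  where
  τ : ℕ → ℚ
  τ s = proj₁ (recip (ι≢0 s))
  τι : ∀ s → τ s ⊗ ι s ≡ 1ℚ
  τι s = proj₂ (recip (ι≢0 s))
  τ-inj : ∀ s t → τ s ≡ τ t → s ≡ t
  τ-inj s t eq = ι-inj s t (begin
    ι s ≡⟨ sym (⊗-idˡ _) ⟩
    1ℚ ⊗ ι s ≡⟨ cong (_⊗ ι s) (sym (trans (⊗-comm _ _) (τι t))) ⟩
    (ι t ⊗ τ t) ⊗ ι s ≡⟨ ⊗-assoc _ _ _ ⟩
    ι t ⊗ (τ t ⊗ ι s) ≡⟨ cong (ι t ⊗_) (trans (cong (_⊗ ι s) (sym eq)) (τι s)) ⟩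
    ι t ⊗ 1ℚ ≡⟨ trans (⊗-comm _ _) (⊗-idˡ _) ⟩
    ι t ∎)
    where open ≡-Reasoning
  flip : ∀ s → Ind (λ e x → τ s ⊗ B e x ⊕ A e x) → Ind (λ e x → ι s ⊗ A e x ⊕ B e x)
  flip s i c k = i c λ x → begin
    ∑ ρ (λ e → c e ⊗ (τ s ⊗ B e x ⊕ A e x)) ≡⟨ ∑-cong ρ (λ e → rescale (c e) (A e x) (B e x)) ⟩
    ∑ ρ (λ e → τ s ⊗ (c e ⊗ (ι s ⊗ A e x ⊕ B e x))) ≡⟨ ∑-⊗ˡ ρ (τ s) _ ⟩
    τ s ⊗ ∑ ρ (λ e → c e ⊗ (ι s ⊗ A e x ⊕ B e x)) ≡⟨ cong (τ s ⊗_) (k x) ⟩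
    τ s ⊗ 0ℚ ≡⟨ ⊗-zeroʳ _ ⟩
    0ℚ ∎
    where
    open ≡-Reasoning
    rescale : ∀ c a b → c ⊗ (τ s ⊗ b ⊕ a) ≡ τ s ⊗ (c ⊗ (ι s ⊗ a ⊕ b))
    rescale c a b = sym (begin
      τ s ⊗ (c ⊗ (ι s ⊗ a ⊕ b)) ≡⟨ trans (sym (⊗-assoc _ _ _)) (trans (cong (_⊗ (ι s ⊗ a ⊕ b)) (⊗-comm _ _)) (⊗-assoc _ _ _)) ⟩
      c ⊗ (τ s ⊗ (ι s ⊗ a ⊕ b)) ≡⟨ cong (c ⊗_) (⊗-distribˡ _ _ _) ⟩
      c ⊗ (τ s ⊗ (ι s ⊗ a) ⊕ τ s ⊗ b)
        ≡⟨ cong (c ⊗_) (cong (_⊕ τ s ⊗ b) (trans (sym (⊗-assoc _ _ _)) (trans (cong (_⊗ a) (τι s)) (⊗-idˡ a)))) ⟩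
      c ⊗ (a ⊕ τ s ⊗ b) ≡⟨ cong (c ⊗_) (⊕-comm _ _) ⟩
      c ⊗ (τ s ⊗ b ⊕ a) ∎)

-- Concatenation of families and spans

infixr 5 _⧺_
_⧺_ : ∀ {ρ σ} {A : Set} → (Fin ρ → A) → (Fin σ → A) → Fin (ρ + σ) → A
_⧺_ {ρ} f g i = [ f , g ]′ (splitAt ρ i)

⧺-left : ∀ {ρ σ} {A : Set} (f : Fin ρ → A) (g : Fin σ → A) i → (f ⧺ g) (i ↑ˡ σ) ≡ f i
⧺-left {ρ} {σ} f g i = cong [ f , g ]′ (FinP.splitAt-↑ˡ ρ i σ)

⧺-right : ∀ {ρ σ} {A : Set} (f : Fin ρ → A) (g : Fin σ → A) i → (f ⧺ g) (ρ ↑ʳ i) ≡ g i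
⧺-right {ρ} {σ} f g i = cong [ f , g ]′ (FinP.splitAt-↑ʳ ρ σ i)

⧺-all : ∀ {ρ σ} {A : Set} (P : A → Set) (f : Fin ρ → A) (g : Fin σ → A) →
  (∀ i → P (f i)) → (∀ i → P (g i)) → ∀ i → P ((f ⧺ g) i)
⧺-all {ρ} P f g hf hg i with splitAt ρ i
... | inj₁ j = hf j
... | inj₂ j = hg j

∑-⧺ : ∀ {ρ σ} {A : Set} (f : Fin ρ → A) (g : Fin σ → A) (h : A → ℚ) (c : Fin (ρ + σ) → ℚ) →
  ∑ (ρ + σ) (λ i → c i ⊗ h ((f ⧺ g) i)) ≡
  ∑ ρ (λ i → c (i ↑ˡ σ) ⊗ h (f i)) ⊕ ∑ σ (λ i → c (ρ ↑ʳ i) ⊗ h (g i))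
∑-⧺ {ρ} {σ} f g h c = trans (∑-split ρ σ _) (cong₂ _⊕_
  (∑-cong ρ (λ i → cong (λ a → c (i ↑ˡ σ) ⊗ h a) (⧺-left f g i)))
  (∑-cong σ (λ i → cong (λ a → c (ρ ↑ʳ i) ⊗ h a) (⧺-right f g i))))

↑-all : ∀ {ρ σ} (P : Fin (ρ + σ) → Set) → (∀ i → P (i ↑ˡ σ)) → (∀ i → P (ρ ↑ʳ i)) → ∀ i → P i
↑-all {ρ} {σ} P l r i with splitAt ρ i in eq
... | inj₁ j = subst P (FinP.splitAt⁻¹-↑ˡ eq) (l j)
... | inj₂ j = subst P (FinP.splitAt⁻¹-↑ʳ eq) (r j)

-- Typically b₂′ consists of columns of b₂ on which b₁ vanishes.
Ind-⧺ : ∀ {ρ σ} {C C′ : Set} (b₁ : Fin ρ → C → ℚ) (b₂ : Fin σ → C → ℚ) (b₂′ : Fin σ → C′ → ℚ) →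
  (∀ (c : Fin (ρ + σ) → ℚ) → (∀ x → ∑ (ρ + σ) (λ i → c i ⊗ (b₁ ⧺ b₂) i x) ≡ 0ℚ) →
     ∀ y → ∑ σ (λ i → c (ρ ↑ʳ i) ⊗ b₂′ i y) ≡ 0ℚ) →
  Ind b₂′ → Ind b₁ → Ind (b₁ ⧺ b₂)
Ind-⧺ {ρ} {σ} b₁ b₂ b₂′ h ind₂ ind₁ c k = ↑-all (λ i → c i ≡ 0ℚ) (ind₁ _ left) right
  where
  right : ∀ i → c (ρ ↑ʳ i) ≡ 0ℚ
  right = ind₂ _ (h c k)
  left : ∀ x → ∑ ρ (λ i → c (i ↑ˡ σ) ⊗ b₁ i x) ≡ 0ℚ
  left x = trans (sym (⊕-idʳ _)) (trans (cong₂ _⊕_ refl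
    (sym (∑-zero σ (λ i → trans (cong (_⊗ b₂ i x) (right i)) (⊗-zeroˡ _)))))
    (trans (sym (∑-⧺ b₁ b₂ (λ v → v x) c)) (k x)))

δ : ∀ {k} → Fin k → Fin k → ℚ
δ a b = if a == b then 1ℚ else 0ℚ

δ-refl : ∀ {k} (a : Fin k) → δ a a ≡ 1ℚ
δ-refl a = cong (if_then 1ℚ else 0ℚ) (==-refl a)

δ-neq : ∀ {k} {a b : Fin k} → a ≢ b → δ a b ≡ 0ℚ
δ-neq ne = cong (if_then 1ℚ else 0ℚ) (==-neq ne)

InSpan-mem : ∀ {σ} {C : Set} (b : Fin σ → C → ℚ) i → InSpan b (b i)
InSpan-mem {σ} b i = δ i , λ x → sym (trans
  (∑-single σ i _ (λ j ne → trans (cong (_⊗ b j x) (δ-neq (ne ∘ sym))) (⊗-zeroˡ _)))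
  (trans (cong (_⊗ b i x) (δ-refl i)) (⊗-idˡ _)))

InSpan-cong : ∀ {σ} {C : Set} {b : Fin σ → C → ℚ} {v w} → (∀ x → v x ≡ w x) → InSpan b v → InSpan b w
InSpan-cong e (z , h) = z , λ x → trans (sym (e x)) (h x)

InSpan-zero : ∀ {σ} {C : Set} {b : Fin σ → C → ℚ} → InSpan b (λ _ → 0ℚ)
InSpan-zero {σ} = (λ _ → 0ℚ) , λ x → sym (∑-zero σ (λ i → ⊗-zeroˡ _))

InSpan-lin : ∀ {σ} {C : Set} {b : Fin σ → C → ℚ} {v w} s → InSpan b v → InSpan b w →
  InSpan b (λ x → s ⊗ v x ⊕ w x)
InSpan-lin {σ} {b = b} s (z , h) (y , g) = (λ j → s ⊗ z j ⊕ 1ℚ ⊗ y j) , λ x →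
  trans (cong₂ _⊕_ (cong (s ⊗_) (h x)) (trans (g x) (sym (⊗-idˡ _)))) (sym (∑-lin σ s 1ℚ z y (λ j → b j x)))

InSpan-⧺ˡ : ∀ {ρ σ} {C : Set} (b₁ : Fin ρ → C → ℚ) (b₂ : Fin σ → C → ℚ) {v} → InSpan b₁ v → InSpan (b₁ ⧺ b₂) v
InSpan-⧺ˡ {ρ} {σ} b₁ b₂ (z , h) = z ⧺ (λ _ → 0ℚ) , λ x → trans (h x) (sym (trans
  (∑-⧺ b₁ b₂ (λ v → v x) (z ⧺ (λ _ → 0ℚ)))
  (trans (cong₂ _⊕_ (∑-cong ρ (λ i → cong (_⊗ b₁ i x) (⧺-left z _ i)))
    (∑-zero σ (λ i → trans (cong (_⊗ b₂ i x) (⧺-right z _ i)) (⊗-zeroˡ _)))) (⊕-idʳ _))))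

InSpan-⧺ʳ : ∀ {ρ σ} {C : Set} (b₁ : Fin ρ → C → ℚ) (b₂ : Fin σ → C → ℚ) {v} → InSpan b₂ v → InSpan (b₁ ⧺ b₂) v
InSpan-⧺ʳ {ρ} {σ} b₁ b₂ (z , h) = (λ _ → 0ℚ) ⧺ z , λ x → trans (h x) (sym (trans
  (∑-⧺ b₁ b₂ (λ v → v x) ((λ (_ : Fin ρ) → 0ℚ) ⧺ z))
  (trans (cong₂ _⊕_ (∑-zero ρ (λ i → trans (cong (_⊗ b₁ i x) (⧺-left _ z i)) (⊗-zeroˡ _)))
    (∑-cong σ (λ i → cong (_⊗ b₂ i x) (⧺-right {ρ} (λ _ → 0ℚ) z i)))) (⊕-idˡ _))))

-- Generic placements

module Placements (n d : ℕ) where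

  Placement : Set
  Placement = Fin n → Fin d → ℚ

  Column : Set
  Column = Fin n × Fin d

  row : Placement → Fin n × Fin n → Column → ℚ
  row p (u , w) (v , k) = (δ v u ⊕ ⊖ δ v w) ⊗ (p u k ⊕ ⊖ p w k)

  mix : ℕ → Placement → Placement → Placement
  mix s p q v k = ι s ⊗ p v k ⊕ q v k

  row-mix : ∀ s p q e x → row (mix s p q) e x ≡ ι s ⊗ row p e x ⊕ row q e x
  row-mix s p q (u , w) (v , k) = row-linear _ (ι s) _ _ _ _

  -- The part of Zariski openness that is used: on the line `s p + q`, with `q` at parameter zero
  -- and `p` at infinity, a condition true at either end holds for all large `s`.
  record Open (P : Placement → Set) : Set where
    field
      fst-dominant : ∀ p q → P p → Eventually (λ s → P (mix s p q))
      snd-dominant : ∀ p q → P q → Eventually (λ s → P (mix s p q))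
  open Open

  Good : (Placement → Set) → Set
  Good P = Open P × NN (∃ P)

  -- At one large parameter, `fst-dominant` keeps the newly added condition while `snd-dominant`
  -- keeps the conditions accumulated so far.
  good-all : ∀ k {P : Fin k → Placement → Set} → (∀ i → Good (P i)) → Good (λ p → ∀ i → P i p)
  good-all k {P} h = op k h , sat k h
    where
    op : ∀ k {P : Fin k → Placement → Set} → (∀ i → Good (P i)) → Open (λ p → ∀ i → P i p)
    fst-dominant (op k h) p q a = ev-all k (λ i → fst-dominant (proj₁ (h i)) p q (a i))
    snd-dominant (op k h) p q a = ev-all k (λ i → snd-dominant (proj₁ (h i)) p q (a i))
    sat : ∀ k {P : Fin k → Placement → Set} → (∀ i → Good (P i)) → NN (∃ λ p → ∀ i → P i p)
    sat zero h = return ((λ _ _ → 0ℚ) , λ ())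
    sat (suc k) {P} h = proj₂ (h zero) >>= λ (p₀ , a₀) → sat k (h ∘ suc) >>= λ (p₁ , a₁) →
      fst-dominant (proj₁ (h zero)) p₀ p₁ a₀ >>= λ (N , e₀) →
      snd-dominant (op k (h ∘ suc)) p₀ p₁ a₁ >>= λ (M , e₁) →
      return (mix (N ℕ.⊔ M) p₀ p₁ , λ { zero → e₀ _ (ℕP.m≤m⊔n N M) ; (suc i) → e₁ _ (ℕP.m≤n⊔m N M) i })

  -- Guarding a condition by its own satisfiability makes every open condition good, so it need
  -- never be decided which families can be independent.
  good-transfer : {P : Placement → Set} → Open P → Good (λ p → ∃ P → P p)
  good-transfer {P} o = op , (em (∃ P) >>= λ where
      (yes (p , a)) → return (p , λ _ → a)
      (no none) → return ((λ _ _ → 0ℚ) , λ e → ⊥-elim (none e)))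
    where
    op : Open (λ p → ∃ P → P p)
    fst-dominant op p q f = em (∃ P) >>= λ where
      (yes e) → ev-map (λ s a _ → a) (fst-dominant o p q (f e))
      (no none) → return (0 , λ s _ e → ⊥-elim (none e))
    snd-dominant op p q f = em (∃ P) >>= λ where
      (yes e) → ev-map (λ s a _ → a) (snd-dominant o p q (f e))
      (no none) → return (0 , λ s _ e → ⊥-elim (none e))

  Rows : ∀ {ρ} → Placement → (Fin ρ → Fin n × Fin n) → Fin ρ → Column → ℚ
  Rows p us i = row p (us i)

  open-Rows : ∀ {ρ} (us : Fin ρ → Fin n × Fin n) → Open (λ p → Ind (Rows p us))
  fst-dominant (open-Rows us) p q ind = ev-map
    (λ s → Ind-cong (λ i x → sym (row-mix s p q (us i) x))) (pencil-independent ι ι-inj (Rows p us) (Rows q us) ind)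
  snd-dominant (open-Rows us) p q ind = ev-map
    (λ s → Ind-cong (λ i x → sym (row-mix s p q (us i) x))) (pencil-independent′ (Rows p us) (Rows q us) ind)

  Affine : ∀ {j} → (Fin j → Fin n) → Placement → Set
  Affine {j} w p = ∀ (l : Fin j → ℚ) → ∑ j l ≡ 0ℚ → (∀ k → ∑ j (λ i → l i ⊗ p (w i) k) ≡ 0ℚ) → ∀ i → l i ≡ 0ℚ

  -- Affine independence is linear independence after a coordinate 1 is appended to each point, and
  -- this is again a pencil condition.
  open-Affine : ∀ {j} (w : Fin j → Fin n) → Open (Affine w)
  open-Affine {j} w = record
    { fst-dominant = λ p q a → ev-map (back p q) (pencil-independent ι ι-inj (lift p) (lift q) (forth p a))
    ; snd-dominant = λ p q a → ev-map (back p q) (pencil-independent′ (lift p) (lift q) (forth q a)) }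
    where
    lift : Placement → Fin j → Maybe (Fin d) → ℚ
    lift p i = maybe (p (w i)) 1ℚ
    forth : ∀ p → Affine w p → Ind (lift p)
    forth p a l k = a l (trans (∑-cong j (λ i → trans (sym (⊗-idˡ _)) (⊗-comm _ _))) (k nothing)) (k ∘ just)
    back : ∀ p q s → Ind (λ i x → ι s ⊗ lift p i x ⊕ lift q i x) → Affine w (mix s p q)
    back p q s ind l l₀ k = ind l λ where
      -- In the mixture the appended coordinate is the constant `ι s + 1`, which weights of total
      -- zero still annihilate.
      nothing → trans (∑-⊗ʳ j (ι s ⊗ 1ℚ ⊕ 1ℚ) l) (trans (cong (_⊗ (ι s ⊗ 1ℚ ⊕ 1ℚ)) l₀) (⊗-zeroˡ _))
      (just x) → k x

  record Generic (p : Placement) : Set where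
    field
      generic-rows : ∀ {ρ} (us : Fin ρ → Fin n × Fin n) → (∃ λ q → Ind (Rows q us)) → Ind (Rows p us)
      generic-affine : ∀ {j} → j ≤ d → (w : Fin (suc j) → Fin n) → (∃ (Affine w)) → Affine w p
  open Generic public

  Rows-size : ∀ {ρ} p (us : Fin ρ → Fin n × Fin n) → Ind (Rows p us) → ρ ≤ n * d
  Rows-size {ρ} p us ind = Ind-size (λ i x → row p (us i) (remQuot d x)) λ c k →
    ind c λ (v , l) → subst (λ x → ∑ ρ (λ i → c i ⊗ row p (us i) x) ≡ 0ℚ) (FinP.remQuot-combine v l) (k (combine v l))

  decode : ∀ {ρ} → Fin ((n * n) ^ ρ) → Fin ρ → Fin n × Fin n
  decode c i = remQuot n (finToFun c i)

  decode-surj : ∀ {ρ} (us : Fin ρ → Fin n × Fin n) → ∃ λ c → ∀ i → decode c i ≡ us i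
  decode-surj us = funToFin (λ i → combine (proj₁ (us i)) (proj₂ (us i))) , λ i →
    trans (cong (remQuot n) (FinP.finToFun-funToFin _ i)) (FinP.remQuot-combine (proj₁ (us i)) (proj₂ (us i)))

  -- The demands range over families of all lengths, but independent families have at most `n * d`
  -- rows and affine ones at most `d + 1` points; families of fixed length are coded by a finite
  -- type.
  ∃Generic : NN (∃ Generic)
  ∃Generic = proj₂ (good-all 2 {P} λ { zero → rowsGood ; (suc zero) → affGood }) >>= λ (p , h) →
    return (p , record { generic-rows = gr p (h zero) ; generic-affine = ga p (h (suc zero)) })
    where
    P₀ P₁ : Placement → Set
    P₀ p = ∀ (ρ : Fin (suc (n * d))) (c : Fin ((n * n) ^ toℕ ρ)) → (∃ λ q → Ind (Rows q (decode c))) → Ind (Rows p (decode c))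
    P₁ p = ∀ (j : Fin (suc d)) (c : Fin (n ^ suc (toℕ j))) → (∃ (Affine (finToFun c))) → Affine (finToFun {n} {suc (toℕ j)} c) p
    P : Fin 2 → Placement → Set
    P zero = P₀
    P (suc zero) = P₁
    rowsGood : Good P₀
    rowsGood = good-all _ (λ ρ → good-all _ (λ c → good-transfer (open-Rows (decode c))))
    affGood : Good P₁
    affGood = good-all _ (λ j → good-all _ (λ c → good-transfer (open-Affine (finToFun c))))
    Rows-cong : ∀ {ρ} p {us vs : Fin ρ → Fin n × Fin n} → (∀ i → us i ≡ vs i) → Ind (Rows p us) → Ind (Rows p vs)
    Rows-cong p e = Ind-cong (λ i x → cong (λ u → row p u x) (e i))
    gr : ∀ p → P₀ p → ∀ {ρ} (us : Fin ρ → Fin n × Fin n) → (∃ λ q → Ind (Rows q us)) → Ind (Rows p us)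
    gr p h {ρ} us (q , ind) = go (fromℕ< (s≤s (Rows-size q us ind))) (FinP.toℕ-fromℕ< _) us ind
      where
      go : (ρ′ : Fin (suc (n * d))) → toℕ ρ′ ≡ ρ → (us : Fin ρ → Fin n × Fin n) → Ind (Rows q us) → Ind (Rows p us)
      go ρ′ refl us ind = let (c , e) = decode-surj us in
        Rows-cong p e (h ρ′ c (q , Rows-cong q (sym ∘ e) ind))
    Affine-cong : ∀ {j} p {w w′ : Fin j → Fin n} → (∀ i → w i ≡ w′ i) → Affine w p → Affine w′ p
    Affine-cong {j} p e a l l₀ k = a l l₀ (λ x → trans (∑-cong j (λ i → cong (λ u → l i ⊗ p u x) (e i))) (k x))
    ga : ∀ p → P₁ p → ∀ {j} → j ≤ d → (w : Fin (suc j) → Fin n) → (∃ (Affine w)) → Affine w p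
    ga p h {j} le w (q , a) = go (fromℕ< (s≤s le)) (FinP.toℕ-fromℕ< _) w a
      where
      go : (j′ : Fin (suc d)) → toℕ j′ ≡ j → (w : Fin (suc j) → Fin n) → Affine w q → Affine w p
      go j′ refl w a = Affine-cong p (FinP.finToFun-funToFin w)
        (h j′ (funToFin w) (q , Affine-cong q (sym ∘ FinP.finToFun-funToFin w) a))

  Inj : ∀ {j} → (Fin j → Fin n) → Set
  Inj w = ∀ i i′ → w i ≡ w i′ → i ≡ i′

  -- The points become the vertices of a simplex: `w zero` goes to the origin and the others to
  -- distinct unit vectors, for which `j ≤ d` leaves enough axes.
  ∃Affine : ∀ {j} → j ≤ d → (w : Fin (suc j) → Fin n) → Inj w → ∃ (Affine w)
  ∃Affine {j} le w inj = q , aff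
    where
    hit? : ∀ x k → Dec (∃ λ (i : Fin j) → inject≤ i le ≡ k × w (suc i) ≡ x)
    hit? x k = FinP.any? (λ i → (inject≤ i le FinP.≟ k) ×-dec (w (suc i) FinP.≟ x))
    q : Placement
    q x k = if does (hit? x k) then 1ℚ else 0ℚ
    q-hit : ∀ i → q (w (suc i)) (inject≤ i le) ≡ 1ℚ
    q-hit i = cong (if_then 1ℚ else 0ℚ) (dec-true (hit? _ _) (i , refl , refl))
    q-miss : ∀ i i′ → i′ ≢ suc i → q (w i′) (inject≤ i le) ≡ 0ℚ
    q-miss i i′ ne = cong (if_then 1ℚ else 0ℚ) (dec-false (hit? _ _) λ (i″ , e , e′) →
      ne (trans (sym (inj _ _ e′)) (cong suc (FinP.inject≤-injective le le i″ i e))))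
    aff : Affine w q
    aff l l₀ k = λ { zero → trans (sym (∑-single (suc j) zero l (λ { zero ne → ⊥-elim (ne refl) ; (suc i) _ → ls i }))) l₀ ; (suc i) → ls i }
      where
      ls : ∀ i → l (suc i) ≡ 0ℚ
      ls i = begin
        l (suc i) ≡⟨ sym (⊗-idˡ _) ⟩
        1ℚ ⊗ l (suc i) ≡⟨ ⊗-comm _ _ ⟩
        l (suc i) ⊗ 1ℚ ≡⟨ cong (l (suc i) ⊗_) (sym (q-hit i)) ⟩
        l (suc i) ⊗ q (w (suc i)) (inject≤ i le)
          ≡⟨ sym (∑-single (suc j) (suc i) (λ i′ → l i′ ⊗ q (w i′) (inject≤ i le)) (λ i′ ne → trans (cong (l i′ ⊗_) (q-miss i i′ ne)) (⊗-zeroʳ _))) ⟩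
        ∑ (suc j) (λ i′ → l i′ ⊗ q (w i′) (inject≤ i le)) ≡⟨ k (inject≤ i le) ⟩
        0ℚ ∎
        where open ≡-Reasoning

  affine : ∀ {p} → Generic p → ∀ {j} → j ≤ suc d → (w : Fin j → Fin n) → Inj w → Affine w p
  affine g {zero} le w inj l l₀ k ()
  affine g {suc j} (s≤s le) w inj = generic-affine g le w (∃Affine le w inj)

-- Rank functions of generic rigidity matroids

PairSet : ℕ → Set
PairSet n = Fin n → Fin n → Bool

_⊑_ : ∀ {n} → PairSet n → PairSet n → Set
S ⊑ T = ∀ u v → S u v ≡ true → T u v ≡ true

_∪_ : ∀ {n} → PairSet n → PairSet n → PairSet n
(S ∪ T) u v = S u v ∨ T u v

star : ∀ {n} → Fin n → Subset n → PairSet n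
star v N a b = (a == v) ∧ N b

Avoids : ∀ {n} → PairSet n → Fin n → Set
Avoids S v = ∀ u → S u v ≡ false × S v u ≡ false

-- Lk S u v says that the row of uv lies in the span of the rows of S.
record RigidityRank (n d : ℕ) : Set₁ where
  field
    r : PairSet n → ℕ
    Lk : PairSet n → Fin n → Fin n → Set
    Lk? : ∀ S u v → Dec (Lk S u v)
    Lk-in : ∀ {S u v} → S u v ≡ true → Lk S u v
    Lk-trans : ∀ {S T} → (∀ u v → T u v ≡ true → Lk S u v) → ∀ {a b} → Lk T a b → Lk S a b
    Lk-sym : ∀ {S u v} → Lk S u v → Lk S v u
    Lk-loop : ∀ {S} u → Lk S u u
    r-span : ∀ {S T} → (∀ u v → T u v ≡ true → Lk S u v) → r T ≤ r S
    r-∪ : ∀ S T → r (S ∪ T) ≤ r S + r T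
    r-star : ∀ v N → r (star v N) ≤ count n N
    extend₀ : ∀ S v N → Avoids S v → N v ≡ false → count n N ≤ d → r S + count n N ≤ r (S ∪ star v N)
    -- A 1-extension, stated without deleting an edge: since `ab` is unlinked it could be added
    -- independently to `S` and then subdivided by `v`.
    extend₁ : ∀ S v N a b → Avoids S v → N v ≡ false → count n N ≡ suc d → N a ≡ true → N b ≡ true → a ≢ b →
      ¬ Lk S a b → r S + suc d ≤ r (S ∪ star v N)
    -- The pair `xu` completes a complete graph on `d + 2` vertices, which is a circuit of the
    -- generic rigidity matroid.
    simplex : ∀ S N x u → count n N ≡ d → N x ≡ false → N u ≡ false → x ≢ u →
      (∀ a b → N a ≡ true → N b ≡ true → Lk S a b) →
      (∀ a → N a ≡ true → Lk S x a) → (∀ a → N a ≡ true → Lk S u a) → Lk S x u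
    separate : ∀ E₁ E₂ (A B : Subset n) → (∀ v → B v ≡ true → Avoids E₁ v) → (∀ v → A v ≡ true → Avoids E₂ v) →
      r E₁ + r E₂ ≤ r (E₁ ∪ E₂) + d * (count n (λ v → not (A v) ∧ not (B v)) ∸ 1)

∑-const-0 : ∀ k (f : Fin k → ℚ) c → ∑ k f ≡ 0ℚ → ∑ k (λ i → f i ⊗ c) ≡ 0ℚ
∑-const-0 k f c h = trans (∑-⊗ʳ k c f) (trans (cong (_⊗ c) h) (⊗-zeroˡ c))

module Ranks (n d : ℕ) (p : Placements.Placement n d) (generic : Placements.Generic n d p) where
  open Placements n d

  -- The span is inductive because a pair set has no enumeration to take coefficients over;
  -- transitivity then holds by recursion, before any basis is known.
  data Sp (S : PairSet n) : (Column → ℚ) → Set where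
    gen : ∀ {u v} → S u v ≡ true → Sp S (row p (u , v))
    zer : Sp S (λ _ → 0ℚ)
    lin : ∀ {v w} s → Sp S v → Sp S w → Sp S (λ x → s ⊗ v x ⊕ w x)
    ext : ∀ {v w} → (∀ x → v x ≡ w x) → Sp S v → Sp S w

  Sp-trans : ∀ {S T} → (∀ u v → T u v ≡ true → Sp S (row p (u , v))) → ∀ {w} → Sp T w → Sp S w
  Sp-trans h (gen t) = h _ _ t
  Sp-trans h zer = zer
  Sp-trans h (lin s a b) = lin s (Sp-trans h a) (Sp-trans h b)
  Sp-trans h (ext e a) = ext e (Sp-trans h a)

  Sp⇒InSpan : ∀ {S σ} {b : Fin σ → Column → ℚ} → (∀ u v → S u v ≡ true → InSpan b (row p (u , v))) →
    ∀ {w} → Sp S w → InSpan b w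
  Sp⇒InSpan h (gen t) = h _ _ t
  Sp⇒InSpan h zer = InSpan-zero
  Sp⇒InSpan h (lin s a b) = InSpan-lin s (Sp⇒InSpan h a) (Sp⇒InSpan h b)
  Sp⇒InSpan h (ext e a) = InSpan-cong e (Sp⇒InSpan h a)

  Sp-∑ : ∀ {S} k (c : Fin k → ℚ) (v : Fin k → Column → ℚ) → (∀ i → Sp S (v i)) → Sp S (λ x → ∑ k (λ i → c i ⊗ v i x))
  Sp-∑ zero c v h = ext (λ x → sym (∑-zero 0 (λ ()))) zer
  Sp-∑ (suc k) c v h = ext (λ x → sym (∑-suc k _)) (lin (c zero) (h zero) (Sp-∑ k (c ∘ suc) (v ∘ suc) (h ∘ suc)))

  InSpan⇒Sp : ∀ {S σ} (b : Fin σ → Column → ℚ) → (∀ i → Sp S (b i)) → ∀ {w} → InSpan b w → Sp S w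
  InSpan⇒Sp {σ = σ} b h (z , e) = ext (λ x → sym (e x)) (Sp-∑ σ z b h)

  Sp-scale : ∀ {S v} s → Sp S v → Sp S (λ x → s ⊗ v x)
  Sp-scale s a = ext (λ x → ⊕-idʳ _) (lin s a zer)

  Sp-sym : ∀ {S u v} → Sp S (row p (u , v)) → Sp S (row p (v , u))
  Sp-sym = ext (λ (x , k) → row-symmetric _ _ _ _)

  Sp-loop : ∀ {S} u → Sp S (row p (u , u))
  Sp-loop u = ext (λ (x , k) → sym (loop-difference _ _)) zer

  record Basis (S : PairSet n) : Set where
    field
      size : ℕ
      elem : Fin size → Fin n × Fin n
      elem-in : ∀ i → S (proj₁ (elem i)) (proj₂ (elem i)) ≡ true
      elem-ind : Ind (Rows p elem)
      spanning : ∀ u v → S u v ≡ true → InSpan (Rows p elem) (row p (u , v))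
  open Basis

  -- Greedy growth. Fuel `n * d + 1` cannot run out, since no independent family of rows is that
  -- long.
  ∃Basis : ∀ S → NN (Basis S)
  ∃Basis S = grow (suc (n * d)) 0 (λ ()) (ℕP.≤-reflexive (sym (ℕP.+-identityʳ _))) (λ ()) (λ c _ ())
    where
    grow : ∀ fuel ρ (us : Fin ρ → Fin n × Fin n) → suc (n * d) ≤ fuel + ρ →
      (∀ i → S (proj₁ (us i)) (proj₂ (us i)) ≡ true) → Ind (Rows p us) → NN (Basis S)
    grow zero ρ us le _ ind = ⊥-elim (ℕP.<⇒≱ le (Rows-size p us ind))
    grow (suc fuel) ρ us le mem ind =
      em (∃ λ u → ∃ λ v → S u v ≡ true × ¬ InSpan (Rows p us) (row p (u , v))) >>= λ where
        (yes (u , v , s , out)) → grow fuel (suc ρ) ((u , v) ◂ us)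
          (subst (suc (n * d) ≤_) (sym (ℕP.+-suc fuel ρ)) le) (λ { zero → s ; (suc i) → mem i })
          (Ind-cong (λ { zero x → refl ; (suc i) x → refl }) (Ind-◂ (row p (u , v)) (Rows p us) ind out))
        (no none) → nn-Fin n (λ u → nn-Fin n (λ v → em (S u v ≡ true) >>= λ where
            (yes s) → (λ k → none (u , v , s , λ z → k (λ _ → z)))
            (no ¬s) → return (λ s → ⊥-elim (¬s s)))) >>= λ sp →
          return (record { elem = us ; elem-in = mem ; elem-ind = ind ; spanning = sp })

  Basis-cong : ∀ {S T} → (∀ u v → S u v ≡ T u v) → Basis S → Basis T
  Basis-cong e b = record { elem = elem b ; elem-in = λ i → trans (sym (e _ _)) (elem-in b i)
    ; elem-ind = elem-ind b ; spanning = λ u v t → spanning b u v (trans (e u v) t) }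

  module FromBases (basis : ∀ S → Basis S) (Sp? : ∀ S u v → Dec (Sp S (row p (u , v)))) where
    rank : PairSet n → ℕ
    rank S = size (basis S)

    rank-≥ : ∀ S {ρ} (us : Fin ρ → Fin n × Fin n) → Ind (Rows p us) → (∀ i → Sp S (row p (us i))) → ρ ≤ rank S
    rank-≥ S us ind h = steinitz (Rows p us) (Rows p (elem (basis S))) ind (λ i → Sp⇒InSpan (spanning (basis S)) (h i))

    rank-≤ : ∀ S {σ} (b : Fin σ → Column → ℚ) → (∀ u v → S u v ≡ true → InSpan b (row p (u , v))) → rank S ≤ σ
    rank-≤ S b h = steinitz (Rows p (elem (basis S))) b (elem-ind (basis S)) (λ i → h _ _ (elem-in (basis S) i))

    elem-Sp : ∀ S i → Sp S (row p (elem (basis S) i))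
    elem-Sp S i = gen (elem-in (basis S) i)

    Rows-⧺ : ∀ q {ρ σ} (us : Fin ρ → Fin n × Fin n) (vs : Fin σ → Fin n × Fin n) → Ind (Rows q us ⧺ Rows q vs) → Ind (Rows q (us ⧺ vs))
    Rows-⧺ q {ρ} us vs = Ind-cong (λ i x → lem i x)
      where
      lem : ∀ i x → (Rows q us ⧺ Rows q vs) i x ≡ Rows q (us ⧺ vs) i x
      lem i x with splitAt ρ i
      ... | inj₁ _ = refl
      ... | inj₂ _ = refl

    avoid-row : ∀ q {a b v} k → a ≢ v → b ≢ v → row q (a , b) (v , k) ≡ 0ℚ
    avoid-row q {a} {b} {v} k na nb = trans (cong₂ (λ s t → (s ⊕ ⊖ t) ⊗ (q a k ⊕ ⊖ q b k)) (δ-neq (na ∘ sym)) (δ-neq (nb ∘ sym))) (zero-difference _)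

    elem-avoid : ∀ S v → Avoids S v → ∀ i → proj₁ (elem (basis S) i) ≢ v × proj₂ (elem (basis S) i) ≢ v
    elem-avoid S v av i = (λ e → true≢false (elem-in (basis S) i) (subst (λ a → S a (proj₂ (elem (basis S) i)) ≡ false) (sym e) (proj₂ (av _)))) ,
      (λ e → true≢false (elem-in (basis S) i) (subst (λ a → S (proj₁ (elem (basis S) i)) a ≡ false) (sym e) (proj₁ (av _))))

    star-row : ∀ q {v u} k → v ≢ u → row q (v , u) (v , k) ≡ q v k ⊕ ⊖ q u k
    star-row q {v} {u} k ne = trans (cong₂ (λ s t → (s ⊕ ⊖ t) ⊗ (q v k ⊕ ⊖ q u k)) (δ-refl v) (δ-neq ne)) (unit-difference _)

    star-mem : ∀ S v (N : Subset n) u → N u ≡ true → (S ∪ star v N) v u ≡ true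
    star-mem S v N u h = ∨-inr {S v u} (∧-intro (==-refl v) h)

    -- Only the star rows are nonzero in the columns of `v`, so a relation restricted to these
    -- columns involves the star alone.
    star-column : ∀ q {ρ σ} (us : Fin ρ → Fin n × Fin n) v (w : Fin σ → Fin n) →
      (∀ i → proj₁ (us i) ≢ v × proj₂ (us i) ≢ v) → (∀ i → v ≢ w i) →
      (c : Fin (ρ + σ) → ℚ) → (∀ x → ∑ (ρ + σ) (λ i → c i ⊗ (Rows q us ⧺ Rows q (λ i → v , w i)) i x) ≡ 0ℚ) →
      ∀ k → ∑ σ (λ i → c (ρ ↑ʳ i) ⊗ (q v k ⊕ ⊖ q (w i) k)) ≡ 0ℚ
    star-column q {ρ} {σ} us v w av ne c ker k = begin
      ∑ σ (λ i → c (ρ ↑ʳ i) ⊗ (q v k ⊕ ⊖ q (w i) k))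
        ≡⟨ ∑-cong σ (λ i → cong (c (ρ ↑ʳ i) ⊗_) (sym (star-row q k (ne i)))) ⟩
      ∑ σ (λ i → c (ρ ↑ʳ i) ⊗ row q (v , w i) (v , k))
        ≡⟨ sym (⊕-idˡ _) ⟩
      0ℚ ⊕ ∑ σ (λ i → c (ρ ↑ʳ i) ⊗ row q (v , w i) (v , k))
        ≡⟨ cong₂ _⊕_ (sym (∑-zero ρ (λ i → trans (cong (c (i ↑ˡ σ) ⊗_) (avoid-row q k (proj₁ (av i)) (proj₂ (av i)))) (⊗-zeroʳ _)))) refl ⟩
      _ ≡⟨ sym (∑-⧺ (Rows q us) (Rows q (λ i → v , w i)) (λ b → b (v , k)) c) ⟩
      _ ≡⟨ ker (v , k) ⟩
      0ℚ ∎
      where open ≡-Reasoning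

    -- A relation among the differences is an affine dependence of `v` and the `w i`, with weight
    -- `Σ c` at `v` and `-c i` at `w i`; at most `d + 1` points are involved.
    star-independent : ∀ {j} v (w : Fin j → Fin n) → j ≤ d → Inj (v ◂ w) → Ind (λ i k → p v k ⊕ ⊖ p (w i) k)
    star-independent {j} v w le inj c ker i = ⊖-involutive-0 _ (affine generic (s≤s le) (v ◂ w) inj l mass moment (suc i))
      where
      l : Fin (suc j) → ℚ
      l = ∑ j c ◂ (λ i → ⊖ (c i))
      mass : ∑ (suc j) l ≡ 0ℚ
      mass = trans (∑-suc j l) (trans (cong₂ _⊕_ refl (∑-⊖ j c)) (⊕-inverseʳ _))
      moment : ∀ k → ∑ (suc j) (λ i → l i ⊗ p ((v ◂ w) i) k) ≡ 0ℚ
      moment k = begin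
        ∑ (suc j) (λ i → l i ⊗ p ((v ◂ w) i) k) ≡⟨ ∑-suc j _ ⟩
        ∑ j c ⊗ p v k ⊕ ∑ j (λ i → (⊖ (c i)) ⊗ p (w i) k) ≡⟨ cong₂ _⊕_ (sym (∑-⊗ʳ j (p v k) c)) refl ⟩
        ∑ j (λ i → c i ⊗ p v k) ⊕ ∑ j (λ i → (⊖ (c i)) ⊗ p (w i) k) ≡⟨ sym (∑-⊕ j _ _) ⟩
        ∑ j (λ i → c i ⊗ p v k ⊕ (⊖ (c i)) ⊗ p (w i) k) ≡⟨ ∑-cong j (λ i → sym (spread (c i) (p v k) (p (w i) k))) ⟩
        ∑ j (λ i → c i ⊗ (p v k ⊕ ⊖ p (w i) k)) ≡⟨ ker k ⟩
        0ℚ ∎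
        where open ≡-Reasoning

    ◂-Inj : ∀ {j} v (w : Fin j → Fin n) → (∀ i → v ≢ w i) → Inj w → Inj (v ◂ w)
    ◂-Inj v w ne inj zero zero e = refl
    ◂-Inj v w ne inj zero (suc i′) e = ⊥-elim (ne i′ e)
    ◂-Inj v w ne inj (suc i) zero e = ⊥-elim (ne i (sym e))
    ◂-Inj v w ne inj (suc i) (suc i′) e = cong suc (inj i i′ e)

    enum-≢ : ∀ (N : Subset n) v → N v ≡ false → ∀ i → v ≢ enum n N i
    enum-≢ N v out i e = true≢false (enum-in n N i) (subst (λ u → N u ≡ false) e out)

    ∪-left : ∀ S T {w} → Sp S w → Sp (S ∪ T) w
    ∪-left S T = Sp-trans (λ u v s → gen (∨-inl s))

    extend₀′ : ∀ S v N → Avoids S v → N v ≡ false → count n N ≤ d → rank S + count n N ≤ rank (S ∪ star v N)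
    extend₀′ S v N av out le = rank-≥ (S ∪ star v N) (us ⧺ vs)
      (Rows-⧺ p us vs (Ind-⧺ (Rows p us) (Rows p vs) (λ i k → p v k ⊕ ⊖ p (w i) k)
        (star-column p us v w (elem-avoid S v av) (enum-≢ N v out))
        (star-independent v w le (◂-Inj v w (enum-≢ N v out) (enum-inj n N)))
        (elem-ind (basis S))))
      (⧺-all (λ e → Sp (S ∪ star v N) (row p e)) us vs (λ i → ∪-left S _ (elem-Sp S i))
        (λ i → gen (star-mem S v N (w i) (enum-in n N i))))
      where
      us = elem (basis S)
      w = enum n N
      vs : Fin (count n N) → Fin n × Fin n
      vs i = v , w i

    -- Independence is shown at the special placement `q`, which puts `v` on the line through `a`
    -- and `b`, and then transferred by genericity. At `q` the edges `va` and `vb` act on the other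
    -- vertices like a multiple of the row of `ab`, and that row is independent of `S` by
    -- assumption.
    extend₁′ : ∀ S v N a b → Avoids S v → N v ≡ false → count n N ≡ suc d → N a ≡ true → N b ≡ true → a ≢ b →
      ¬ Sp S (row p (a , b)) → rank S + suc d ≤ rank (S ∪ star v N)
    extend₁′ S v N a b av out size-N Na Nb a≢b unlinked = subst (λ t → rank S + t ≤ rank (S ∪ star v N)) size-w
      (rank-≥ (S ∪ star v N) (us ⧺ vs)
        (generic-rows generic (us ⧺ vs) (q , Rows-⧺ q us vs independent))
        (⧺-all (λ e → Sp (S ∪ star v N) (row p e)) us vs (λ i → ∪-left S _ (elem-Sp S i))
          (λ i → gen (star-mem S v N (w i) (w-in i)))))
      where
      us = elem (basis S)
      ρ = rank S
      N₁ = N ─ a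
      N₂ = N₁ ─ b
      j = count n N₂
      w : Fin (2 + j) → Fin n
      w = a ◂ b ◂ enum n N₂
      vs : Fin (2 + j) → Fin n × Fin n
      vs i = v , w i
      N₁b : N₁ b ≡ true
      N₁b = ─-in {S = N} Nb (a≢b ∘ sym)
      size-w : 2 + j ≡ suc d
      size-w = trans (cong suc (sym (count-─ N₁ b N₁b))) (trans (sym (count-─ N a Na)) size-N)
      w-in : ∀ i → N (w i) ≡ true
      w-in zero = Na
      w-in (suc zero) = Nb
      w-in (suc (suc i)) = ∧-fst (∧-fst {a = N₁ _} (enum-in n N₂ i))
      v≢w : ∀ i → v ≢ w i
      v≢w i e = true≢false (w-in i) (subst (λ u → N u ≡ false) e out)
      w-inj : Inj w
      w-inj = ◂-Inj a _ (λ { zero → a≢b ; (suc i) → enum-≢₁ i })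
        (◂-Inj b _ (λ i e → ─-ne {S = N₁} (enum-in n N₂ i) (sym e)) (enum-inj n N₂))
        where
        enum-≢₁ : ∀ i → a ≢ enum n N₂ i
        enum-≢₁ i e = ─-ne {S = N} (∧-fst {a = N₁ _} (enum-in n N₂ i)) (sym e)
      -- The reflection of `b` in `a`, with affine coordinates 2 and -1 on `a` and `b`.
      mid : Fin d → ℚ
      mid k = (p a k ⊕ p a k) ⊕ ⊖ p b k
      q : Placement
      q x k = if x == v then mid k else p x k
      q-v : ∀ k → q v k ≡ mid k
      q-v k = cong (if_then mid k else p v k) (==-refl v)
      q-other : ∀ {x} k → x ≢ v → q x k ≡ p x k
      q-other {x} k ne = cong (if_then mid k else p x k) (==-neq ne)
      independent : Ind (Rows q us ⧺ Rows q vs)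
      independent c ker = ↑-all (λ i → c i ≡ 0ℚ) (λ i → relation (suc i))
          (λ { zero → γ₀≡0 ; (suc zero) → γ₁≡0 ; (suc (suc i)) → γs≡0 i })
        where
        open ≡-Reasoning
        γ : Fin (2 + j) → ℚ
        γ i = c (ρ ↑ʳ i)
        Γ = ∑ (2 + j) γ
        -- `Γ` times the affine coordinates of `mid`. Subtracting `γ` turns the equations in the
        -- columns of `v` into an affine dependence of the `d + 1` points `w`, which must be
        -- trivial.
        base : Fin (2 + j) → ℚ
        base = (Γ ⊕ Γ) ◂ (⊖ Γ) ◂ (λ _ → 0ℚ)
        ∑-two : ∀ (f : Fin (2 + j) → ℚ) → (∀ i → f (suc (suc i)) ≡ 0ℚ) → ∑ (2 + j) f ≡ f zero ⊕ (f (suc zero) ⊕ 0ℚ)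
        ∑-two f h = trans (∑-suc _ f) (cong₂ _⊕_ refl (trans (∑-suc _ _) (cong₂ _⊕_ refl (∑-zero j h))))
        l : Fin (2 + j) → ℚ
        l i = base i ⊕ ⊖ γ i
        mass : ∑ (2 + j) l ≡ 0ℚ
        mass = begin
          ∑ (2 + j) l ≡⟨ ∑-⊕ (2 + j) base (λ i → ⊖ γ i) ⟩
          ∑ (2 + j) base ⊕ ∑ (2 + j) (λ i → ⊖ γ i) ≡⟨ cong₂ _⊕_ (∑-two base (λ _ → refl)) (∑-⊖ (2 + j) γ) ⟩
          ((Γ ⊕ Γ) ⊕ ((⊖ Γ) ⊕ 0ℚ)) ⊕ ⊖ Γ ≡⟨ midpoint-mass Γ Γ ⟩
          Γ ⊕ ⊖ Γ ≡⟨ ⊕-inverseʳ Γ ⟩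
          0ℚ ∎
        column : ∀ k → ∑ (2 + j) (λ i → γ i ⊗ (mid k ⊕ ⊖ p (w i) k)) ≡ 0ℚ
        column k = trans (∑-cong (2 + j) (λ i → cong (γ i ⊗_) (cong₂ (λ s t → s ⊕ ⊖ t) (sym (q-v k)) (sym (q-other k (v≢w i ∘ sym))))))
          (star-column q us v w (elem-avoid S v av) v≢w c ker k)
        moment : ∀ k → ∑ (2 + j) (λ i → l i ⊗ p (w i) k) ≡ 0ℚ
        moment k = begin
          ∑ (2 + j) (λ i → l i ⊗ p (w i) k)
            ≡⟨ trans (∑-cong (2 + j) (λ i → ⊗-distribʳ _ _ _)) (∑-⊕ (2 + j) _ _) ⟩
          ∑ (2 + j) (λ i → base i ⊗ p (w i) k) ⊕ ∑ (2 + j) (λ i → (⊖ γ i) ⊗ p (w i) k)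
            ≡⟨ cong₂ _⊕_ (trans (∑-two (λ i → base i ⊗ p (w i) k) (λ i → ⊗-zeroˡ _)) (trans (midpoint-moment Γ (p a k) (p b k)) (sym (∑-⊗ʳ (2 + j) (mid k) γ)))) refl ⟩
          ∑ (2 + j) (λ i → γ i ⊗ mid k) ⊕ ∑ (2 + j) (λ i → (⊖ γ i) ⊗ p (w i) k)
            ≡⟨ sym (∑-⊕ (2 + j) _ _) ⟩
          ∑ (2 + j) (λ i → γ i ⊗ mid k ⊕ (⊖ γ i) ⊗ p (w i) k)
            ≡⟨ ∑-cong (2 + j) (λ i → sym (spread (γ i) (mid k) (p (w i) k))) ⟩
          ∑ (2 + j) (λ i → γ i ⊗ (mid k ⊕ ⊖ p (w i) k))
            ≡⟨ column k ⟩
          0ℚ ∎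
        l≡0 : ∀ i → l i ≡ 0ℚ
        l≡0 = affine generic (ℕP.≤-reflexive size-w) w w-inj l mass moment
        γs≡0 : ∀ i → γ (suc (suc i)) ≡ 0ℚ
        γs≡0 i = ⊖-involutive-0 _ (trans (sym (⊕-idˡ _)) (l≡0 (suc (suc i))))
        γ₁ = γ (suc zero)
        γ₀-eq : γ zero ≡ ⊖ (γ₁ ⊕ γ₁)
        γ₀-eq = weight-relation Γ (γ zero) γ₁ (l≡0 zero) (l≡0 (suc zero))
        q-elem : ∀ i x → row q (us i) x ≡ row p (us i) x
        q-elem i (x , k) = cong₂ (λ s t → (δ x (proj₁ (us i)) ⊕ ⊖ δ x (proj₂ (us i))) ⊗ (s ⊕ ⊖ t))
          (q-other k (proj₁ (elem-avoid S v av i))) (q-other k (proj₂ (elem-avoid S v av i)))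
        coefficients : Fin (suc ρ) → ℚ
        coefficients = (γ₁ ⊕ γ₁) ◂ (λ i → c (i ↑ˡ (2 + j)))
        to-v : ∀ u x k → x ≢ v → u ≢ v → row q (v , u) (x , k) ≡ (0ℚ ⊕ ⊖ δ x u) ⊗ (mid k ⊕ ⊖ p u k)
        to-v u x k ne ne′ = cong₂ _⊗_ (cong (_⊕ ⊖ δ x u) (δ-neq ne)) (cong₂ (λ s t → s ⊕ ⊖ t) (q-v k) (q-other k ne′))
        -- Now `γ` lives on `a` and `b` only, in the ratio -2 to 1, and `edge-split` merges the two
        -- star rows into the row of `ab`.
        star-part : ∀ x k → x ≢ v → ∑ (2 + j) (λ i → γ i ⊗ row q (vs i) (x , k)) ≡ (γ₁ ⊕ γ₁) ⊗ row p (a , b) (x , k)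
        star-part x k ne = begin
          ∑ (2 + j) (λ i → γ i ⊗ row q (vs i) (x , k))
            ≡⟨ ∑-two (λ i → γ i ⊗ row q (vs i) (x , k)) (λ i → trans (cong (_⊗ row q (vs (suc (suc i))) (x , k)) (γs≡0 i)) (⊗-zeroˡ _)) ⟩
          γ zero ⊗ row q (v , a) (x , k) ⊕ (γ₁ ⊗ row q (v , b) (x , k) ⊕ 0ℚ)
            ≡⟨ cong₂ _⊕_ (cong₂ _⊗_ γ₀-eq (to-v a x k ne (v≢w zero ∘ sym)))
                 (cong₂ _⊕_ (cong (γ₁ ⊗_) (to-v b x k ne (v≢w (suc zero) ∘ sym))) refl) ⟩
          _ ≡⟨ edge-split γ₁ (δ x a) (δ x b) (p a k) (p b k) ⟩
          (γ₁ ⊕ γ₁) ⊗ row p (a , b) (x , k) ∎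
        kernel : ∀ x → ∑ (suc ρ) (λ i → coefficients i ⊗ (row p (a , b) ◂ Rows p us) i x) ≡ 0ℚ
        kernel (x , k) with x FinP.≟ v
        ... | yes refl = ∑-zero (suc ρ) λ where
          zero → trans (cong ((γ₁ ⊕ γ₁) ⊗_) (avoid-row p k (v≢w zero ∘ sym) (v≢w (suc zero) ∘ sym))) (⊗-zeroʳ _)
          (suc i) → trans (cong (c (i ↑ˡ (2 + j)) ⊗_) (avoid-row p k (proj₁ (elem-avoid S v av i)) (proj₂ (elem-avoid S v av i)))) (⊗-zeroʳ _)
        ... | no ne = begin
          ∑ (suc ρ) (λ i → coefficients i ⊗ (row p (a , b) ◂ Rows p us) i (x , k)) ≡⟨ ∑-suc ρ _ ⟩
          (γ₁ ⊕ γ₁) ⊗ row p (a , b) (x , k) ⊕ ∑ ρ (λ i → c (i ↑ˡ (2 + j)) ⊗ row p (us i) (x , k))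
            ≡⟨ cong₂ _⊕_ (sym (star-part x k ne)) (∑-cong ρ (λ i → cong (c (i ↑ˡ (2 + j)) ⊗_) (sym (q-elem i (x , k))))) ⟩
          ∑ (2 + j) (λ i → γ i ⊗ row q (vs i) (x , k)) ⊕ ∑ ρ (λ i → c (i ↑ˡ (2 + j)) ⊗ row q (us i) (x , k))
            ≡⟨ ⊕-comm _ _ ⟩
          _ ≡⟨ sym (∑-⧺ (Rows q us) (Rows q vs) (λ t → t (x , k)) c) ⟩
          _ ≡⟨ ker (x , k) ⟩
          0ℚ ∎
        relation : ∀ i → coefficients i ≡ 0ℚ
        relation = Ind-◂ (row p (a , b)) (Rows p us) (elem-ind (basis S))
          (λ sp → unlinked (InSpan⇒Sp (Rows p us) (elem-Sp S) sp)) coefficients kernel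
        γ₁≡0 : γ₁ ≡ 0ℚ
        γ₁≡0 = double-0 γ₁ (relation zero)
        γ₀≡0 : γ zero ≡ 0ℚ
        γ₀≡0 = trans γ₀-eq (trans (cong ⊖_ (relation zero)) ⊖-zero)

    -- The `d + 2` points, lifted to `d + 1` coordinates, satisfy a nontrivial dependence `l`. The
    -- stress built from `l` has a nonzero coefficient at `xu`, hence expresses that row through
    -- rows already in the span.
    simplex′ : ∀ S N x u → count n N ≡ d → N x ≡ false → N u ≡ false → x ≢ u →
      (∀ a b → N a ≡ true → N b ≡ true → Sp S (row p (a , b))) →
      (∀ a → N a ≡ true → Sp S (row p (x , a))) → (∀ a → N a ≡ true → Sp S (row p (u , a))) → Sp S (row p (x , u))
    simplex′ S N x u size-N Nx Nu x≢u NN-linked x-linked u-linked = decidable-stable (Sp? S x u)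
      (¬Ind⇒ lifted (λ ind → ℕP.1+n≰n (subst (λ t → suc t ≤ d) size-N (ℕP.≤-pred (Ind-size lifted ind)))) >>= λ (l , k , e , ne) →
        return (conclude l k e ne))
      where
      j = count n N
      w : Fin (2 + j) → Fin n
      w = x ◂ u ◂ enum n N
      coord : Fin n → Fin (suc d) → ℚ
      coord v zero = 1ℚ
      coord v (suc k) = p v k
      lifted : Fin (2 + j) → Fin (suc d) → ℚ
      lifted i = coord (w i)
      u-inj : Inj (u ◂ enum n N)
      u-inj = ◂-Inj u _ (enum-≢ N u Nu) (enum-inj n N)
      x-inj : Inj (x ◂ enum n N)
      x-inj = ◂-Inj x _ (enum-≢ N x Nx) (enum-inj n N)
      module _ (l : Fin (2 + j) → ℚ) (k : ∀ y → ∑ (2 + j) (λ i → l i ⊗ lifted i y) ≡ 0ℚ) (e : Fin (2 + j)) (ne : l e ≢ 0ℚ) where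
        open ≡-Reasoning
        mass : ∑ (2 + j) l ≡ 0ℚ
        mass = trans (∑-cong (2 + j) (λ i → trans (sym (⊗-idˡ _)) (⊗-comm _ _))) (k zero)
        tail-∑ : ∀ (f : Fin (2 + j) → ℚ) → f zero ≡ 0ℚ → ∑ (2 + j) f ≡ 0ℚ → ∑ (suc j) (f ∘ suc) ≡ 0ℚ
        tail-∑ f f₀ h = trans (sym (⊕-idˡ _)) (trans (cong₂ _⊕_ (sym f₀) refl) (trans (sym (∑-suc (suc j) f)) h))
        mid-∑ : ∀ (f : Fin (2 + j) → ℚ) → f (suc zero) ≡ 0ℚ → ∑ (2 + j) f ≡ 0ℚ → ∑ (suc j) (f ∘ punchIn (suc zero)) ≡ 0ℚ
        mid-∑ f f₁ h = trans (sym (⊕-idˡ _)) (trans (cong₂ _⊕_ (sym f₁) refl) (trans (sym (∑-punch (suc j) (suc zero) f)) h))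
        0⊗ : ∀ {s} t → s ≡ 0ℚ → s ⊗ t ≡ 0ℚ
        0⊗ t refl = ⊗-zeroˡ t
        l₀ = l zero
        l₁ = l (suc zero)
        -- If the weight at `x` vanished, `l` would be an affine dependence of the remaining `d + 1`
        -- generic points. The same holds for `u` and `l₁`.
        l₀≢0 : l₀ ≢ 0ℚ
        l₀≢0 z = ne (all e)
          where
          all : ∀ i → l i ≡ 0ℚ
          all zero = z
          all (suc i) = affine generic (s≤s (ℕP.≤-reflexive size-N)) (u ◂ enum n N) u-inj (l ∘ suc)
            (tail-∑ l z mass)
            (λ y → trans (∑-cong (suc j) (λ { zero → refl ; (suc _) → refl })) (tail-∑ (λ i → l i ⊗ lifted i (suc y)) (0⊗ _ z) (k (suc y)))) i
        l₁≢0 : l₁ ≢ 0ℚ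
        l₁≢0 z = ne (all e)
          where
          rest : ∀ i → l (punchIn (suc zero) i) ≡ 0ℚ
          rest = affine generic (s≤s (ℕP.≤-reflexive size-N)) (x ◂ enum n N) x-inj (l ∘ punchIn (suc zero))
            (mid-∑ l z mass)
            (λ y → trans (∑-cong (suc j) (λ { zero → refl ; (suc _) → refl })) (mid-∑ (λ i → l i ⊗ lifted i (suc y)) (0⊗ _ z) (k (suc y))))
          all : ∀ i → l i ≡ 0ℚ
          all zero = rest zero
          all (suc zero) = z
          all (suc (suc i)) = rest (suc i)
        R : Fin (2 + j) → Fin (2 + j) → Column → ℚ
        R i i′ = row p (w i , w i′)
        -- The products l i ⊗ l i′ form an equilibrium stress.
        stress : ∀ y → ∑ (2 + j) (λ i → ∑ (2 + j) (λ i′ → (l i ⊗ l i′) ⊗ R i i′ y)) ≡ 0ℚ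
        stress (v , t) = begin
          ∑ (2 + j) (λ i → ∑ (2 + j) (λ i′ → (l i ⊗ l i′) ⊗ R i i′ (v , t)))
            ≡⟨ ∑-cong (2 + j) (λ i → trans (∑-cong (2 + j) (λ i′ → stress-expand (l i) (l i′) (X i) (X i′) (P i) (P i′)))
                 (trans (∑-⊕ (2 + j) _ _) (cong₂ _⊕_ (trans (∑-⊕ (2 + j) _ _) (inner₁ i)) (∑-⊕ (2 + j) _ _)))) ⟩
          ∑ (2 + j) (λ i → 0ℚ ⊕ (∑ (2 + j) (λ i′ → (⊖ (l i ⊗ P i)) ⊗ (l i′ ⊗ X i′)) ⊕ ∑ (2 + j) (λ i′ → l i ⊗ (l i′ ⊗ (X i′ ⊗ P i′)))))
            ≡⟨ ∑-cong (2 + j) (λ i → trans (⊕-idˡ _) (cong₂ _⊕_ (∑-⊗ˡ (2 + j) (⊖ (l i ⊗ P i)) _) (∑-⊗ˡ (2 + j) (l i) _))) ⟩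
          ∑ (2 + j) (λ i → (⊖ (l i ⊗ P i)) ⊗ LX ⊕ l i ⊗ LXP)
            ≡⟨ ∑-⊕ (2 + j) _ _ ⟩
          ∑ (2 + j) (λ i → (⊖ (l i ⊗ P i)) ⊗ LX) ⊕ ∑ (2 + j) (λ i → l i ⊗ LXP)
            ≡⟨ cong₂ _⊕_ (∑-const-0 (2 + j) _ LX (trans (∑-⊖ (2 + j) _) (trans (cong ⊖_ (k (suc t))) ⊖-zero))) (∑-const-0 (2 + j) l LXP mass) ⟩
          0ℚ ⊕ 0ℚ ≡⟨ ⊕-idˡ _ ⟩
          0ℚ ∎
          where
          X P : Fin (2 + j) → ℚ
          X i = δ v (w i)
          P i = p (w i) t
          LX = ∑ (2 + j) (λ i → l i ⊗ X i)
          LXP = ∑ (2 + j) (λ i → l i ⊗ (X i ⊗ P i))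
          inner₁ : ∀ i → ∑ (2 + j) (λ i′ → (l i ⊗ (X i ⊗ P i)) ⊗ l i′) ⊕ ∑ (2 + j) (λ i′ → (⊖ (l i ⊗ X i)) ⊗ (l i′ ⊗ P i′)) ≡ 0ℚ
          inner₁ i = trans (cong₂ _⊕_
            (trans (∑-⊗ˡ (2 + j) _ l) (trans (cong₂ _⊗_ refl mass) (⊗-zeroʳ _)))
            (trans (∑-⊗ˡ (2 + j) _ _) (trans (cong₂ _⊗_ refl (k (suc t))) (⊗-zeroʳ _)))) (⊕-idˡ _)
        w₂-in : ∀ i → N (w (suc (suc i))) ≡ true
        w₂-in = enum-in n N
        x-row : ∀ i → Sp S (R zero (suc (suc i)))
        x-row i = x-linked _ (w₂-in i)
        u-row : ∀ i → Sp S (R (suc zero) (suc (suc i)))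
        u-row i = u-linked _ (w₂-in i)
        rest-row : ∀ i i′ → Sp S (R (suc (suc i)) i′)
        rest-row i zero = Sp-sym (x-row i)
        rest-row i (suc zero) = Sp-sym (u-row i)
        rest-row i (suc (suc i′)) = NN-linked _ _ (w₂-in i) (w₂-in i′)
        b-part c-part e-part : Column → ℚ
        b-part y = ∑ j (λ i → (l₀ ⊗ l (suc (suc i))) ⊗ R zero (suc (suc i)) y)
        c-part y = ∑ j (λ i → (l₁ ⊗ l (suc (suc i))) ⊗ R (suc zero) (suc (suc i)) y)
        e-part y = ∑ j (λ i → ∑ (2 + j) (λ i′ → (l (suc (suc i)) ⊗ l i′) ⊗ R (suc (suc i)) i′ y))
        others : Column → ℚ
        others y = (l₀ ⊗ l₀) ⊗ R zero zero y ⊕ (1ℚ ⊗ b-part y ⊕ ((l₁ ⊗ l₁) ⊗ R (suc zero) (suc zero) y ⊕ (1ℚ ⊗ c-part y ⊕ e-part y)))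
        others-Sp : Sp S others
        others-Sp = lin _ (Sp-loop x) (lin _ (Sp-∑ j _ _ x-row) (lin _ (Sp-loop u) (lin _ (Sp-∑ j _ _ u-row)
          (ext (λ y → ∑-cong j (λ i → ⊗-idˡ _)) (Sp-∑ j (λ _ → 1ℚ) _ (λ i → Sp-∑ (2 + j) _ _ (rest-row i)))))))
        -- The pair occurs in both orders, with the same row each time.
        τ = l₀ ⊗ l₁ ⊕ l₀ ⊗ l₁
        balance : ∀ y → τ ⊗ R zero (suc zero) y ⊕ others y ≡ 0ℚ
        balance y@(v , t) = begin
          _ ≡⟨ sym (isolate l₀ l₁ (R zero (suc zero) y) (R zero zero y) (b-part y) (R (suc zero) (suc zero) y) (c-part y) (e-part y)) ⟩
          _ ≡⟨ cong₂ _⊕_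
                 (sym (trans (∑-suc (suc j) _) (cong₂ _⊕_ refl (∑-suc j _))))
                 (cong (_⊕ e-part y) (trans (cong₂ _⊕_ (cong ((l₁ ⊗ l₀) ⊗_) (row-symmetric _ _ _ _)) refl)
                   (sym (trans (∑-suc (suc j) _) (cong₂ _⊕_ refl (∑-suc j _)))))) ⟩
          _ ≡⟨ sym (trans (∑-suc (suc j) (λ i → ∑ (2 + j) (λ i′ → (l i ⊗ l i′) ⊗ R i i′ y))) (cong₂ _⊕_ refl (∑-suc j _))) ⟩
          _ ≡⟨ stress y ⟩
          0ℚ ∎
        τ≢0 : τ ≢ 0ℚ
        τ≢0 z = l₁≢0 (⊗-cancel-0 l₀≢0 (double-0 _ z))
        conclude : Sp S (row p (x , u))
        conclude = let (i , iτ≡1) = recip τ≢0 in ext (λ y → begin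
          (i ⊗ ⊖ 1ℚ) ⊗ others y ≡⟨ ⊗-assoc _ _ _ ⟩
          i ⊗ ((⊖ 1ℚ) ⊗ others y) ≡⟨ cong (i ⊗_) (trans (⊖-⊗ 1ℚ _) (cong ⊖_ (⊗-idˡ _))) ⟩
          i ⊗ ⊖ (others y) ≡⟨ cong (i ⊗_) (sym (⊖-unique _ _ (trans (⊕-comm _ _) (balance y)))) ⟩
          i ⊗ (τ ⊗ row p (x , u) y) ≡⟨ sym (⊗-assoc _ _ _) ⟩
          (i ⊗ τ) ⊗ row p (x , u) y ≡⟨ cong (_⊗ row p (x , u) y) iτ≡1 ⟩
          1ℚ ⊗ row p (x , u) y ≡⟨ ⊗-idˡ _ ⟩
          row p (x , u) y ∎) (Sp-scale (i ⊗ ⊖ 1ℚ) others-Sp)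

    -- Pinning all shared vertices but one costs at most `d` rows of the second basis per vertex;
    -- the last shared vertex is free because translations make each row sum to zero. What survives
    -- is independent in the columns of `B` alone, where `E₁` vanishes, so it can be glued to a
    -- basis of `E₁`.
    separate′ : ∀ E₁ E₂ (A B : Subset n) → (∀ v → B v ≡ true → Avoids E₁ v) → (∀ v → A v ≡ true → Avoids E₂ v) →
      rank E₁ + rank E₂ ≤ rank (E₁ ∪ E₂) + d * (count n (λ v → not (A v) ∧ not (B v)) ∸ 1)
    separate′ E₁ E₂ A B av₁ av₂ = decidable-stable (_ ℕP.≤? _)
        (drop-columns (count n X′ * d) ρ₂ kept dropped pinned >>= λ (ρ′ , g , le , ind) → return (begin
          ρ₁ + ρ₂ ≤⟨ ℕP.+-monoʳ-≤ ρ₁ le ⟩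
          ρ₁ + (ρ′ + count n X′ * d) ≡⟨ sym (ℕP.+-assoc ρ₁ ρ′ _) ⟩
          (ρ₁ + ρ′) + count n X′ * d ≤⟨ ℕP.+-mono-≤ (glue ρ′ g ind) (ℕP.≤-reflexive (trans (ℕP.*-comm (count n X′) d) (cong (d *_) count-X′))) ⟩
          rank (E₁ ∪ E₂) + d * (count n X ∸ 1) ∎))
      where
      open ℕP.≤-Reasoning
      X : Subset n
      X v = not (A v) ∧ not (B v)
      us₁ = elem (basis E₁)
      us₂ = elem (basis E₂)
      ρ₁ = rank E₁
      ρ₂ = rank E₂
      root? : Dec (∃ λ v → X v ≡ true)
      root? = FinP.any? (λ v → X v Data.Bool.≟ true)
      prune : Dec (∃ λ v → X v ≡ true) → Subset n
      prune (yes (x₀ , _)) = X ─ x₀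
      prune (no _) = X
      X′ : Subset n
      X′ = prune root?
      count-X′ : count n X′ ≡ count n X ∸ 1
      count-X′ with root?
      ... | yes (x₀ , i) = cong (_∸ 1) (sym (count-─ X x₀ i))
      ... | no none = trans empty (cong (_∸ 1) (sym empty))
        where
        empty : count n X ≡ 0
        empty = count-∅ n (λ v → ¬true⇒false (λ i → none (v , i)))
      kept : Fin ρ₂ → Column → ℚ
      kept i (v , k) = if B v then row p (us₂ i) (v , k) else 0ℚ
      dropped : Fin ρ₂ → Fin (count n X′ * d) → ℚ
      dropped i y = row p (us₂ i) (enum n X′ (proj₁ (remQuot d y)) , proj₂ (remQuot {count n X′} d y))
      -- Translations are infinitesimal motions: this recovers the columns of the one shared vertex
      -- that `prune` leaves out.
      column-total : ∀ e k → ∑ n (λ v → row p e (v , k)) ≡ 0ℚ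
      column-total (u , w) k = trans (∑-⊗ʳ n (p u k ⊕ ⊖ p w k) (λ v → δ v u ⊕ ⊖ δ v w))
        (trans (cong (_⊗ (p u k ⊕ ⊖ p w k)) (trans (∑-⊕ n _ _) (trans (cong₂ _⊕_ (∑δ u) (trans (∑-⊖ n (λ v → δ v w)) (cong ⊖_ (∑δ w)))) (⊕-inverseʳ 1ℚ)))) (⊗-zeroˡ _))
        where
        ∑δ : ∀ u → ∑ n (λ v → δ v u) ≡ 1ℚ
        ∑δ u = trans (∑-single n u (λ v → δ v u) (λ v → δ-neq)) (δ-refl u)
      pinned : ∀ (c : Fin ρ₂ → ℚ) → (∀ x → ∑ ρ₂ (λ i → c i ⊗ kept i x) ≡ 0ℚ) →
        (∀ y → ∑ ρ₂ (λ i → c i ⊗ dropped i y) ≡ 0ℚ) → ∀ i → c i ≡ 0ℚ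
      pinned c k₁ k₂ = elem-ind (basis E₂) c (λ (v , k) → load≡0 v k)
        where
        load : Fin n → Fin d → ℚ
        load v k = ∑ ρ₂ (λ i → c i ⊗ row p (us₂ i) (v , k))
        total : ∀ k → ∑ n (λ v → load v k) ≡ 0ℚ
        total k = trans (∑-swap n ρ₂ _) (∑-zero ρ₂ (λ i → trans (∑-⊗ˡ n (c i) _) (trans (cong (c i ⊗_) (column-total (us₂ i) k)) (⊗-zeroʳ _))))
        load-A : ∀ v k → A v ≡ true → load v k ≡ 0ℚ
        load-A v k a = ∑-zero ρ₂ (λ i → let (na , nb) = elem-avoid E₂ v (av₂ v a) i in
          trans (cong (c i ⊗_) (avoid-row p k na nb)) (⊗-zeroʳ _))
        load-B : ∀ v k → B v ≡ true → load v k ≡ 0ℚ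
        load-B v k b = trans (∑-cong ρ₂ (λ i → cong (c i ⊗_) (sym (cong (if_then row p (us₂ i) (v , k) else 0ℚ) b)))) (k₁ (v , k))
        load-X′ : ∀ v k → X′ v ≡ true → load v k ≡ 0ℚ
        load-X′ v k x with enum-surj n X′ v x
        ... | i , refl = subst (λ y → ∑ ρ₂ (λ i → c i ⊗ row p (us₂ i) (enum n X′ (proj₁ y) , proj₂ y)) ≡ 0ℚ)
          (FinP.remQuot-combine i k) (k₂ (combine i k))
        classify : ∀ v → (A v ≡ true ⊎ B v ≡ true) ⊎ X v ≡ true
        classify v with A v | B v
        ... | true | _ = inj₁ (inj₁ refl)
        ... | false | true = inj₁ (inj₂ refl)
        ... | false | false = inj₂ refl
        load≡0 : ∀ v k → load v k ≡ 0ℚ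
        load≡0 v k with classify v
        ... | inj₁ (inj₁ a) = load-A v k a
        ... | inj₁ (inj₂ b) = load-B v k b
        ... | inj₂ x with X′ v Data.Bool.≟ true
        ... | yes x′ = load-X′ v k x′
        ... | no ¬x′ = trans (sym (∑-single n v (λ v → load v k) others)) (total k)
          where
          only : ∀ (dec : Dec (∃ λ v → X v ≡ true)) {v v′} → X v ≡ true → ¬ (prune dec v ≡ true) →
            X v′ ≡ true → v′ ≢ v → prune dec v′ ≡ true
          only (yes (x₀ , i₀)) {v} {v′} xv ¬pv xv′ ne = ─-in {S = X} xv′ (λ e → ¬pv (─-in {S = X} xv (λ e′ → ne (trans e (sym e′)))))
          only (no none) xv ¬pv xv′ ne = xv′
          others : ∀ v′ → v′ ≢ v → load v′ k ≡ 0ℚ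
          others v′ ne with classify v′
          ... | inj₁ (inj₁ a) = load-A v′ k a
          ... | inj₁ (inj₂ b) = load-B v′ k b
          ... | inj₂ x″ = load-X′ v′ k (only root? x ¬x′ x″ ne)
      glue : ∀ ρ′ (g : Fin ρ′ → Fin ρ₂) → Ind (kept ∘ g) → ρ₁ + ρ′ ≤ rank (E₁ ∪ E₂)
      glue ρ′ g ind = rank-≥ (E₁ ∪ E₂) (us₁ ⧺ (us₂ ∘ g))
        (Rows-⧺ p us₁ (us₂ ∘ g) (Ind-⧺ (Rows p us₁) (Rows p (us₂ ∘ g)) (kept ∘ g) see ind (elem-ind (basis E₁))))
        (⧺-all (λ e → Sp (E₁ ∪ E₂) (row p e)) us₁ (us₂ ∘ g) (λ i → ∪-left E₁ E₂ (elem-Sp E₁ i))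
          (λ i → Sp-trans (λ u v s → gen (∨-inr {E₁ u v} s)) (elem-Sp E₂ (g i))))
        where
        see : ∀ (c : Fin (ρ₁ + ρ′) → ℚ) → (∀ x → ∑ (ρ₁ + ρ′) (λ i → c i ⊗ (Rows p us₁ ⧺ Rows p (us₂ ∘ g)) i x) ≡ 0ℚ) →
          ∀ y → ∑ ρ′ (λ i → c (ρ₁ ↑ʳ i) ⊗ kept (g i) y) ≡ 0ℚ
        see c ker (v , k) with B v in eq
        ... | false = ∑-zero ρ′ (λ i → ⊗-zeroʳ _)
        ... | true = trans (sym (⊕-idˡ _)) (trans (cong₂ _⊕_ (sym (∑-zero ρ₁ (λ i → let (na , nb) = elem-avoid E₁ v (av₁ v eq) i in
            trans (cong (c (i ↑ˡ ρ′) ⊗_) (avoid-row p k na nb)) (⊗-zeroʳ _)))) refl)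
          (trans (sym (∑-⧺ (Rows p us₁) (Rows p (us₂ ∘ g)) (λ b → b (v , k)) c)) (ker (v , k))))

    rigidityRank : RigidityRank n d
    rigidityRank = record
      { r = rank
      ; Lk = λ S u v → Sp S (row p (u , v))
      ; Lk? = Sp?
      ; Lk-in = gen
      ; Lk-trans = λ h → Sp-trans h
      ; Lk-sym = Sp-sym
      ; Lk-loop = Sp-loop
      ; r-span = λ {S} {T} h → rank-≥ S (elem (basis T)) (elem-ind (basis T)) (λ i → h _ _ (elem-in (basis T) i))
      ; r-∪ = λ S T → rank-≤ (S ∪ T) (Rows p (elem (basis S)) ⧺ Rows p (elem (basis T))) (λ u v s → [ (λ a → InSpan-⧺ˡ _ _ (spanning (basis S) u v a)) , (λ a → InSpan-⧺ʳ _ _ (spanning (basis T) u v a)) ]′ (∨-elim s))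
      ; r-star = λ v N → rank-≤ (star v N) (Rows p (λ i → v , enum n N i)) (star-span v N)
      ; extend₀ = extend₀′
      ; extend₁ = extend₁′
      ; simplex = simplex′
      ; separate = separate′
      }
      where
      star-span : ∀ v N a b → star v N a b ≡ true → InSpan (Rows p (λ i → v , enum n N i)) (row p (a , b))
      star-span v N a b s with ==-elim {x = a} (∧-fst s) | enum-surj n N b (∧-snd {a = a == v} s)
      ... | refl | i , refl = InSpan-mem (Rows p (λ i → v , enum n N i)) i

-- From edge sets of a graph to sets of vertex pairs

∑-reindex : ∀ {ρ k} (g : Fin ρ → Fin k) → (∀ i i′ → g i ≡ g i′ → i ≡ i′) →
  (f : Fin k → ℚ) → (∀ e → (∀ i → g i ≢ e) → f e ≡ 0ℚ) → ∑ k f ≡ ∑ ρ (f ∘ g)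
∑-reindex {ρ} {k} g inj f off = begin
  ∑ k f ≡⟨ ∑-cong k pointwise ⟩
  ∑ k (λ e → ∑ ρ (λ i → δ (g i) e ⊗ f e)) ≡⟨ ∑-swap k ρ _ ⟩
  ∑ ρ (λ i → ∑ k (λ e → δ (g i) e ⊗ f e)) ≡⟨ ∑-cong ρ (λ i → trans
      (∑-single k (g i) _ (λ e ne → trans (cong (_⊗ f e) (δ-neq (ne ∘ sym))) (⊗-zeroˡ _)))
      (trans (cong (_⊗ f (g i)) (δ-refl (g i))) (⊗-idˡ _))) ⟩
  ∑ ρ (f ∘ g) ∎
  where
  open ≡-Reasoning
  pointwise : ∀ e → f e ≡ ∑ ρ (λ i → δ (g i) e ⊗ f e)
  pointwise e with FinP.any? (λ i → g i FinP.≟ e)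
  ... | yes (i , refl) = sym (trans (∑-single ρ i _ (λ i′ ne → trans (cong (_⊗ f (g i)) (δ-neq (ne ∘ inj _ _))) (⊗-zeroˡ _)))
      (trans (cong (_⊗ f (g i)) (δ-refl (g i))) (⊗-idˡ _)))
  ... | no none = trans (off e (λ i h → none (i , h)))
      (sym (∑-zero ρ (λ i → trans (cong (δ (g i) e ⊗_) (off e (λ i h → none (i , h)))) (⊗-zeroʳ _))))

samePair? : ∀ {k} (x y : Fin k × Fin k) → Dec (SamePair x y)
samePair? (a , b) (c , d) = ((a FinP.≟ c) ×-dec (b FinP.≟ d)) ⊎-dec ((a FinP.≟ d) ×-dec (b FinP.≟ c))

pairs? : (G : Graph) (S : Subset (m G)) (u v : Fin (n G)) → Dec (∃ λ e → S e ≡ true × SamePair (ends G e) (u , v))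
pairs? G S u v = FinP.any? (λ e → (S e Data.Bool.≟ true) ×-dec samePair? (ends G e) (u , v))

opaque
  pairs : (G : Graph) → Subset (m G) → PairSet (n G)
  pairs G S u v = does (pairs? G S u v)

  pairs-in : ∀ G S {u v} e → S e ≡ true → SamePair (ends G e) (u , v) → pairs G S u v ≡ true
  pairs-in G S {u} {v} e s sp = dec-true (pairs? G S u v) (e , s , sp)

  pairs-out : ∀ G S {u v} → pairs G S u v ≡ true → ∃ λ e → S e ≡ true × SamePair (ends G e) (u , v)
  pairs-out G S {u} {v} = does-elim (pairs? G S u v)

module GraphRank (d : ℕ) (G : Graph) (p : Placements.Placement (n G) d) (generic : Placements.Generic (n G) d p) where
  open Placements (n G) d
  open Ranks (n G) d p generic

  rigEntry≡row : ∀ q e v k → rigEntry d G q e v k ≡ row q (ends G e) (v , k)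
  rigEntry≡row q e v k with ends G e | loopless G e
  ... | u , w | u≢w with v FinP.≟ u
  ... | yes refl with v FinP.≟ w
  ... | yes refl = ⊥-elim (u≢w refl)
  ... | no _ = trans (sym (-unfold _ _)) (sym (unit-difference _))
  rigEntry≡row q e v k | u , w | u≢w | no _ with v FinP.≟ w
  ... | yes refl = trans (sym (-unfold _ _)) (sym (trans (row-symmetric 0ℚ 1ℚ (q u k) (q v k)) (unit-difference _)))
  ... | no _ = sym (zero-difference _)

  sum≡∑ : ∀ q (c : Fin (m G) → ℚ) v k →
    sumℚ (m G) (λ e → c e ℚ.* rigEntry d G q e v k) ≡ ∑ (m G) (λ e → c e ⊗ row q (ends G e) (v , k))
  sum≡∑ q c v k = trans (sym (∑-unfold (m G) _))
    (∑-cong (m G) (λ e → trans (sym (⊗-unfold _ _)) (cong (c e ⊗_) (rigEntry≡row q e v k))))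

  RowsIndependent⇒Ind : ∀ q I → RowsIndependent d G q I → Ind (Rows q (ends G ∘ enum (m G) I))
  RowsIndependent⇒Ind q I ri c ker i = trans (sym (extend-enum i)) (ri extend extend-off
      (λ v k → trans (sum≡∑ q extend v k) (trans (∑-reindex (enum (m G) I) (enum-inj (m G) I) _
          (λ e none → trans (cong (_⊗ row q (ends G e) (v , k)) (extend-none e none)) (⊗-zeroˡ _)))
        (trans (∑-cong ρ (λ i → cong (_⊗ row q (ends G (enum (m G) I i)) (v , k)) (extend-enum i))) (ker (v , k)))))
      (enum (m G) I i))
    where
    ρ = count (m G) I
    extend : Fin (m G) → ℚ
    extend e = ∑ ρ (λ i → δ (enum (m G) I i) e ⊗ c i)
    extend-none : ∀ e → (∀ i → enum (m G) I i ≢ e) → extend e ≡ 0ℚ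
    extend-none e none = ∑-zero ρ (λ i → trans (cong (_⊗ c i) (δ-neq (none i))) (⊗-zeroˡ _))
    extend-off : ∀ e → I e ≡ false → extend e ≡ 0ℚ
    extend-off e off = extend-none e (λ i h → true≢false (enum-in (m G) I i) (subst (λ x → I x ≡ false) (sym h) off))
    extend-enum : ∀ i → extend (enum (m G) I i) ≡ c i
    extend-enum i = trans (∑-single ρ i _ (λ i′ ne → trans (cong (_⊗ c i′) (δ-neq (ne ∘ enum-inj (m G) I _ _))) (⊗-zeroˡ _)))
      (trans (cong (_⊗ c i) (δ-refl (enum (m G) I i))) (⊗-idˡ _))

  module _ (basis : ∀ S → Basis S) (Sp? : ∀ S u v → Dec (Sp S (row p (u , v)))) where
    open FromBases basis Sp?
    open Basis

    rank-upper : ∀ S I → I ⊆ S → Indep d G I → count (m G) I ≤ rank (pairs G S)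
    rank-upper S I sub (q , ri) = rank-≥ (pairs G S) (ends G ∘ enum (m G) I)
      (generic-rows generic _ (q , RowsIndependent⇒Ind q I ri))
      (λ i → gen (pairs-in G S (enum (m G) I i) (sub _ (enum-in (m G) I i)) (inj₁ (refl , refl))))

    -- The witness consists of the edges that carry the chosen basis. Two basis elements cannot come
    -- from one edge, for their rows would then agree and their difference would be a relation.
    hasRank : ∀ S → HasRank d G S (rank (pairs G S))
    hasRank S = (I , I⊆S , (p , independent) , ℕP.≤-antisym (rank-upper S I I⊆S (p , independent))
        (inj⇒≤count (m G) I ρ edge edge-inj edge-in)) , rank-upper S
      where
      B = basis (pairs G S)
      ρ = size B
      edge : Fin ρ → Fin (m G)
      edge i = proj₁ (pairs-out G S (elem-in B i))
      edge-S : ∀ i → S (edge i) ≡ true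
      edge-S i = proj₁ (proj₂ (pairs-out G S (elem-in B i)))
      edge-row : ∀ i x → row p (ends G (edge i)) x ≡ row p (elem B i) x
      edge-row i (v , k) with ends G (edge i) | proj₂ (proj₂ (pairs-out G S (elem-in B i)))
      ... | _ | inj₁ (refl , refl) = refl
      ... | _ | inj₂ (refl , refl) = row-symmetric _ _ _ _
      edge-ind : Ind (Rows p (ends G ∘ edge))
      edge-ind = Ind-cong (λ i x → sym (edge-row i x)) (elem-ind B)
      I : Subset (m G)
      I e = does (FinP.any? (λ i → edge i FinP.≟ e))
      edge-in : ∀ i → I (edge i) ≡ true
      edge-in i = dec-true (FinP.any? _) (i , refl)
      I⊆S : I ⊆ S
      I⊆S e h with does-elim (FinP.any? (λ i → edge i FinP.≟ e)) h
      ... | i , refl = edge-S i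
      edge-inj : ∀ i i′ → edge i ≡ edge i′ → i ≡ i′
      edge-inj i i′ h with i FinP.≟ i′
      ... | yes e = e
      ... | no ne = ⊥-elim (case trans (sym (trans (cong₂ (λ s t → s ⊕ ⊖ t) (δ-refl i) (δ-neq (ne ∘ sym))) one)) (edge-ind c ker i) of λ ())
        where
        c : Fin ρ → ℚ
        c j = δ i j ⊕ ⊖ δ i′ j
        one : 1ℚ ⊕ ⊖ 0ℚ ≡ 1ℚ
        one = trans (cong (1ℚ ⊕_) ⊖-zero) (⊕-idʳ _)
        pick : ∀ i x → ∑ ρ (λ j → δ i j ⊗ row p (ends G (edge j)) x) ≡ row p (ends G (edge i)) x
        pick i x = trans (∑-single ρ i _ (λ j ne → trans (cong (_⊗ row p (ends G (edge j)) x) (δ-neq (ne ∘ sym))) (⊗-zeroˡ _)))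
          (trans (cong (_⊗ row p (ends G (edge i)) x) (δ-refl i)) (⊗-idˡ _))
        ker : ∀ x → ∑ ρ (λ j → c j ⊗ row p (ends G (edge j)) x) ≡ 0ℚ
        ker x = begin
          ∑ ρ (λ j → c j ⊗ row p (ends G (edge j)) x)
            ≡⟨ ∑-cong ρ (λ j → trans (⊗-distribʳ _ _ _) (cong₂ _⊕_ refl (⊖-⊗ _ _))) ⟩
          ∑ ρ (λ j → δ i j ⊗ row p (ends G (edge j)) x ⊕ ⊖ (δ i′ j ⊗ row p (ends G (edge j)) x))
            ≡⟨ ∑-⊕ ρ _ _ ⟩
          ∑ ρ (λ j → δ i j ⊗ row p (ends G (edge j)) x) ⊕ ∑ ρ (λ j → ⊖ (δ i′ j ⊗ row p (ends G (edge j)) x))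
            ≡⟨ cong₂ _⊕_ (trans (pick i x) (trans (cong (λ e → row p (ends G e) x) h) (sym (pick i′ x)))) refl ⟩
          ∑ ρ (λ j → δ i′ j ⊗ row p (ends G (edge j)) x) ⊕ ∑ ρ (λ j → ⊖ (δ i′ j ⊗ row p (ends G (edge j)) x))
            ≡⟨ trans (sym (∑-⊕ ρ _ _)) (∑-zero ρ (λ j → ⊕-inverseʳ _)) ⟩
          0ℚ ∎
          where open ≡-Reasoning
      independent : RowsIndependent d G p I
      independent c off ker e with I e in eq
      ... | false = off e eq
      ... | true with does-elim (FinP.any? (λ i → edge i FinP.≟ e)) eq
      ... | i , refl = edge-ind (c ∘ edge) (λ (v , k) → trans (sym (∑-reindex edge edge-inj (λ e → c e ⊗ row p (ends G e) (v , k))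
          (λ e none → trans (cong (_⊗ row p (ends G e) (v , k)) (off e (dec-false (FinP.any? _) (λ (i , h) → none i h)))) (⊗-zeroˡ _))))
        (trans (sym (sum≡∑ p c v k)) (ker v k))) i

-- Pair sets are functions; coding them in a finite type allows `nn-Fin` to provide bases and span
-- decisions for all of them under a single double negation.
decodeSet : ∀ {n} → Fin (2 ^ (n * n)) → PairSet n
decodeSet c u v = finToFun c (combine u v) == suc zero

encodeSet : ∀ {n} → PairSet n → Fin (2 ^ (n * n))
encodeSet {n} S = funToFin (λ i → if S (proj₁ (remQuot {n} n i)) (proj₂ (remQuot {n} n i)) then suc zero else zero)

decode-encode : ∀ {n} (S : PairSet n) u v → decodeSet (encodeSet S) u v ≡ S u v
decode-encode {n} S u v = trans (cong (_== suc zero) (trans (FinP.finToFun-funToFin _ (combine u v))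
  (cong (λ i → if S (proj₁ i) (proj₂ i) then suc zero else zero) (FinP.remQuot-combine {n} u v)))) (lem (S u v))
  where
  lem : ∀ b → ((if b then suc zero else zero) == suc {1} zero) ≡ b
  lem true = refl
  lem false = refl

∃RigidityRank : ∀ d G → NN (Σ (RigidityRank (n G) d) λ R → ∀ S → HasRank d G S (RigidityRank.r R (pairs G S)))
∃RigidityRank d G = ∃Generic >>= λ (p , generic) → let open Ranks (n G) d p generic in
  nn-Fin (2 ^ (n G * n G)) (λ c → ∃Basis (decodeSet c)) >>= λ bases →
  nn-Fin (2 ^ (n G * n G)) (λ c → nn-Fin (n G) (λ u → nn-Fin (n G) (λ v → em (Sp (decodeSet c) (row p (u , v)))))) >>= λ decs →
  let basis : ∀ S → Basis S
      basis S = Basis-cong (decode-encode S) (bases (encodeSet S))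
      Sp? : ∀ S u v → Dec (Sp S (row p (u , v)))
      Sp? S u v = map′
        (Sp-trans (λ a b s → gen (trans (sym (decode-encode S a b)) s)))
        (Sp-trans (λ a b s → gen (trans (decode-encode S a b) s)))
        (decs (encodeSet S) u v)
  in return (FromBases.rigidityRank basis Sp? , GraphRank.hasRank d G p generic basis Sp?)
  where open Placements (n G) d

-- Rank bounds for cliques, stars and vertex additions

remove-one : ∀ {k j} (A : Subset k) → count k A ≡ suc j → ∃ λ v → A v ≡ true × count k (A ─ v) ≡ j
remove-one {k} A h with count-pos k A (subst (0 <_) (sym h) (s≤s z≤n))
... | v , a = v , a , ℕP.suc-injective (trans (sym (count-─ A v a)) h)

infix 7 _↾_
_↾_ : ∀ {n} → PairSet n → Subset n → PairSet n
(S ↾ A) u v = S u v ∧ (A u ∧ A v)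

K : ∀ {n} → Subset n → PairSet n
K A u v = A u ∧ A v

↾-in : ∀ {n} (S : PairSet n) A {u v} → S u v ≡ true → A u ≡ true → A v ≡ true → (S ↾ A) u v ≡ true
↾-in S A s a b = ∧-intro s (∧-intro a b)

↾-set : ∀ {n} (S : PairSet n) A {u v} → (S ↾ A) u v ≡ true → S u v ≡ true
↾-set S A h = ∧-fst h

↾-fst : ∀ {n} (S : PairSet n) A {u v} → (S ↾ A) u v ≡ true → A u ≡ true
↾-fst S A {u} {v} h = ∧-fst (∧-snd {a = S u v} h)

↾-snd : ∀ {n} (S : PairSet n) A {u v} → (S ↾ A) u v ≡ true → A v ≡ true
↾-snd S A {u} {v} h = ∧-snd {a = A u} (∧-snd {a = S u v} h)

↾-avoids : ∀ {n} (S : PairSet n) A {v} → A v ≡ false → Avoids (S ↾ A) v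
↾-avoids S A out u = ¬true⇒false (λ h → true≢false (↾-snd S A h) out) , ¬true⇒false (λ h → true≢false (↾-fst S A h) out)

↾-mono : ∀ {n} (S : PairSet n) {A B} → A ⊆ B → (S ↾ A) ⊑ (S ↾ B)
↾-mono S {A} {B} h u v s = ↾-in S B (↾-set S A s) (h u (↾-fst S A s)) (h v (↾-snd S A s))

⊔-count : ∀ {k} (A B : Subset k) → (∀ i → A i ≡ true → B i ≡ true → ⊥) → count k (A ⊔ B) ≡ count k A + count k B
⊔-count {k} A B dj = ℕP.≤-antisym (count-∪≤ k (A ⊔ B) A B (λ i → ∨-elim))
  (count-∪≥ k (A ⊔ B) A B (λ i → ∨-inl) (λ i → ∨-inr {A i}) dj)

-- The rank of a complete graph on `w` vertices, built vertex by vertex: `w (w - 1) / 2` up to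
-- `w = d + 1`, and `d w - d (d + 1) / 2` from there on.
cliqueRank : ℕ → ℕ → ℕ
cliqueRank d zero = 0
cliqueRank d (suc w) = cliqueRank d w + d ⊓ w

module RankLemmas {n d : ℕ} (R : RigidityRank n d) where
  open RigidityRank R

  f : ℕ → ℕ
  f = cliqueRank d

  r-mono : ∀ {S T} → S ⊑ T → r S ≤ r T
  r-mono h = r-span (λ u v s → Lk-in (h u v s))

  gain₀ : ∀ {S T} {v} (N : Subset n) → Avoids S v → S ⊑ T → N v ≡ false → (∀ u → N u ≡ true → T v u ≡ true) →
    ∀ b → b ≤ d → b ≤ count n N → r S + b ≤ r T
  gain₀ {S} {T} {v} N av sub out nb b b≤d b≤N with choose n N b b≤N
  ... | N′ , N′⊆N , refl = ℕP.≤-trans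
    (extend₀ S v N′ av (¬true⇒false (λ h → true≢false (N′⊆N v h) out)) b≤d)
    (r-mono (λ a c s → [ sub a c , (λ t → subst (λ a → T a c ≡ true) (sym (==-elim {x = a} (∧-fst t))) (nb c (N′⊆N c (∧-snd {a = a == v} t)))) ]′ (∨-elim s)))

  gain₁ : ∀ {S T} {v a b} (N : Subset n) → 1 ≤ d → Avoids S v → S ⊑ T → N v ≡ false → (∀ u → N u ≡ true → T v u ≡ true) →
    suc d ≤ count n N → N a ≡ true → N b ≡ true → a ≢ b → ¬ Lk S a b → r S + suc d ≤ r T
  gain₁ {S} {T} {v} {a} {b} N (s≤s {n = d′} z≤n) av sub out nb size Na Nb a≢b unl = go (choose n (N ─ a ─ b) d′ bound)
    where
    bound : d′ ≤ count n (N ─ a ─ b)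
    bound = ℕP.≤-pred (ℕP.≤-pred (subst (suc (suc d′) ≤_)
      (trans (count-─ N a Na) (cong suc (count-─ (N ─ a) b (─-in {S = N} Nb (a≢b ∘ sym))))) size))
    go : (∃ λ T → T ⊆ (N ─ a ─ b) × count n T ≡ d′) → r S + suc (suc d′) ≤ r T
    go (M , M⊆ , cM) = ℕP.≤-trans
      (extend₁ S v N′ a b av (¬true⇒false (λ h → true≢false (N′⊆N v h) out)) size′ N′a N′b a≢b unl)
      (r-mono (λ x c s → [ sub x c , (λ t → subst (λ x → T x c ≡ true) (sym (==-elim {x = x} (∧-fst t))) (nb c (N′⊆N c (∧-snd {a = x == v} t)))) ]′ (∨-elim s)))
      where
      -- The unlinked pair and `d - 1` further neighbours: exactly the `d + 1` neighbours that
      -- `extend₁` asks for.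
      N′ : Subset n
      N′ = (⟦ a ⟧ ⊔ ⟦ b ⟧) ⊔ M
      N′⊆N : N′ ⊆ N
      N′⊆N x h with ∨-elim {⟦ a ⟧ x ∨ ⟦ b ⟧ x} h
      ... | inj₂ mx = ∧-fst (∧-fst {a = (N ─ a) x} (M⊆ x mx))
      ... | inj₁ ab with ∨-elim {⟦ a ⟧ x} ab
      ... | inj₁ e = subst (λ y → N y ≡ true) (sym (==-elim {x = x} e)) Na
      ... | inj₂ e = subst (λ y → N y ≡ true) (sym (==-elim {x = x} e)) Nb
      N′a : N′ a ≡ true
      N′a = ∨-inl (∨-inl (==-refl a))
      N′b : N′ b ≡ true
      N′b = ∨-inl (∨-inr {⟦ a ⟧ b} (==-refl b))
      size′ : count n N′ ≡ suc (suc d′)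
      size′ = trans (⊔-count _ M (λ i ab mi → clash i mi (∨-elim {⟦ a ⟧ i} ab)))
        (cong₂ _+_ (trans (⊔-count ⟦ a ⟧ ⟦ b ⟧ (λ i x y → a≢b (trans (sym (==-elim {x = i} x)) (==-elim {x = i} y))))
          (cong₂ _+_ (count-⟦⟧ n a) (count-⟦⟧ n b))) cM)
        where
        clash : ∀ i → M i ≡ true → ⟦ a ⟧ i ≡ true ⊎ ⟦ b ⟧ i ≡ true → ⊥
        clash i mi (inj₁ e) = ─-ne {S = N} (∧-fst {a = (N ─ a) i} (M⊆ i mi)) (==-elim {x = i} e)
        clash i mi (inj₂ e) = ─-ne {S = N ─ a} (M⊆ i mi) (==-elim {x = i} e)

  -- By simplex, d edges from a new vertex to a clique span all the others.
  clique-rank-≤ : ∀ w (A : Subset n) → count n A ≡ suc w → r (K A) ≤ f (suc w)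
  clique-rank-≤ w A size with remove-one A size
  clique-rank-≤ zero A size | v , Av , c = ℕP.≤-trans
    (r-span {S = star v ∅} (λ x y s → subst₂ (Lk _) (sym (only x (∧-fst s))) (sym (only y (∧-snd {a = A x} s))) (Lk-loop v)))
    (ℕP.≤-trans (subst (r (star v ∅) ≤_) (count-∅ n (λ _ → refl)) (r-star v ∅)) z≤n)
    where
    only : ∀ x → A x ≡ true → x ≡ v
    only x Ax with x FinP.≟ v
    ... | yes e = e
    ... | no ne = ⊥-elim (ℕP.<⇒≢ (count-in n (A ─ v) x (─-in {S = A} Ax ne)) (sym c))
  clique-rank-≤ (suc w) A size | v , Av , c with choose n (A ─ v) (d ⊓ suc w) (subst (d ⊓ suc w ≤_) (sym c) (ℕP.m⊓n≤n d (suc w)))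
  ... | N , N⊆ , cN = begin
    r (K A) ≤⟨ r-span linked ⟩
    r (K (A ─ v) ∪ star v N) ≤⟨ r-∪ _ _ ⟩
    r (K (A ─ v)) + r (star v N) ≤⟨ ℕP.+-mono-≤ (clique-rank-≤ w (A ─ v) c) (subst (r (star v N) ≤_) cN (r-star v N)) ⟩
    f (suc w) + d ⊓ suc w ∎
    where
    open ℕP.≤-Reasoning
    B = K (A ─ v) ∪ star v N
    old : ∀ x y → (A ─ v) x ≡ true → (A ─ v) y ≡ true → Lk B x y
    old x y a b = Lk-in (∨-inl (∧-intro a b))
    new : ∀ y → N y ≡ true → Lk B v y
    new y ny = Lk-in (∨-inr {K (A ─ v) v y} (∧-intro (==-refl v) ny))
    N-v : N v ≡ false
    N-v = ¬true⇒false (λ h → ─-ne {S = A} (N⊆ v h) refl)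
    from-v : ∀ y → (A ─ v) y ≡ true → Lk B v y
    from-v y a with N y Data.Bool.≟ true
    ... | yes ny = new y ny
    ... | no ¬ny = simplex B N v y (trans cN (ℕP.m≤n⇒m⊓n≡m (ℕP.<⇒≤ d<w))) N-v (¬true⇒false ¬ny) (λ e → ─-ne {S = A} a (sym e))
        (λ a b x y → old a b (N⊆ a x) (N⊆ b y)) new (λ b x → old y b a (N⊆ b x))
      where
      d<w : d < suc w
      d<w = ℕP.≰⇒> (λ le → ¬ny (⊆-full le))
        where
        ⊆-full : suc w ≤ d → N y ≡ true
        ⊆-full le with N y in eq
        ... | true = refl
        ... | false = ⊥-elim (ℕP.1+n≰n (begin
          suc (count n (A ─ v)) ≡⟨ cong suc (trans c (sym (ℕP.m≥n⇒m⊓n≡n le))) ⟩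
          suc (d ⊓ suc w) ≡⟨ cong suc (sym cN) ⟩
          suc (count n N) ≤⟨ s≤s (count-mono n (λ z nz → ─-in {S = A ─ v} (N⊆ z nz) (λ { refl → true≢false nz eq }))) ⟩
          suc (count n ((A ─ v) ─ y)) ≡⟨ sym (count-─ (A ─ v) y a) ⟩
          count n (A ─ v) ∎))
    linked : ∀ x y → K A x y ≡ true → Lk B x y
    linked x y s with x FinP.≟ v | y FinP.≟ v
    ... | yes refl | yes refl = Lk-loop v
    ... | yes refl | no ne = from-v y (─-in {S = A} (∧-snd {a = A x} s) ne)
    ... | no ne | yes refl = Lk-sym (from-v x (─-in {S = A} (∧-fst s) ne))
    ... | no ne | no ne′ = old x y (─-in {S = A} (∧-fst s) ne) (─-in {S = A} (∧-snd {a = A x} s) ne′)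

  ↾-new : ∀ (T : PairSet n) t → (∀ (S : PairSet n) → S ⊑ T → Avoids S t → S ⊑ (T ↾ (full ─ t)))
  ↾-new T t S sub av u v s = ↾-in T (full ─ t) (sub u v s)
    (─-in {S = full} {t} {u} refl (λ { refl → true≢false s (proj₂ (av v)) }))
    (─-in {S = full} {t} {v} refl (λ { refl → true≢false s (proj₁ (av u)) }))

  ↾-keep : ∀ (T : PairSet n) t {u v} → T u v ≡ true → u ≢ t → v ≢ t → (T ↾ (full ─ t)) u v ≡ true
  ↾-keep T t s nu nv = ↾-in T (full ─ t) s (─-in {S = full} refl nu) (─-in {S = full} refl nv)

  -- Each vertex of `X` arrives with all of `Y` and the earlier part of `X` as neighbours, so its
  -- gain is precisely the next increment of `f`. The telescoped sum is stated without subtraction.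
  add-clique : ∀ k (S T : PairSet n) (X Y : Subset n) → count n X ≡ k → (∀ t → X t ≡ true → Y t ≡ true → ⊥) →
    (∀ t → X t ≡ true → Avoids S t) → S ⊑ T →
    (∀ t u → X t ≡ true → Y u ≡ true → T t u ≡ true) → (∀ t u → X t ≡ true → X u ≡ true → T t u ≡ true) →
    r S + f (count n Y + k) ≤ r T + f (count n Y)
  add-clique zero S T X Y cX dj av sub XY XX = ℕP.+-mono-≤ (r-mono sub) (ℕP.≤-reflexive (cong f (ℕP.+-identityʳ (count n Y))))
  add-clique (suc k) S T X Y cX dj av sub XY XX with remove-one X cX
  ... | t , Xt , c = begin
    r S + f (q + suc k) ≡⟨ cong (λ z → r S + f z) (ℕP.+-suc q k) ⟩
    r S + (f (q + k) + d ⊓ (q + k)) ≡⟨ sym (ℕP.+-assoc (r S) _ _) ⟩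
    r S + f (q + k) + d ⊓ (q + k) ≤⟨ ℕP.+-monoˡ-≤ _ ih ⟩
    r T′ + f q + d ⊓ (q + k) ≡⟨ trans (ℕP.+-assoc (r T′) _ _) (trans (cong (r T′ +_) (ℕP.+-comm (f q) _)) (sym (ℕP.+-assoc (r T′) _ _))) ⟩
    r T′ + d ⊓ (q + k) + f q ≤⟨ ℕP.+-monoˡ-≤ _ (gain₀ N (↾-avoids T (full ─ t) (─-self {S = full} {t})) (λ u v s → ↾-set T (full ─ t) s) Nt N-nb
         (d ⊓ (q + k)) (ℕP.m⊓n≤m d _) (ℕP.≤-trans (ℕP.m⊓n≤n d (q + k)) (ℕP.≤-reflexive (sym cN)))) ⟩
    r T + f q ∎
    where
    open ℕP.≤-Reasoning
    q = count n Y
    T′ = T ↾ (full ─ t)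
    X′ = X ─ t
    N = Y ⊔ X′
    cN : count n N ≡ q + k
    cN = trans (⊔-count Y X′ (λ i y x → dj i (∧-fst x) y)) (cong (q +_) c)
    Nt : N t ≡ false
    Nt = ¬true⇒false (λ h → [ dj t Xt , (λ x → ─-ne {S = X} x refl) ]′ (∨-elim {Y t} h))
    N-nb : ∀ u → N u ≡ true → T t u ≡ true
    N-nb u h = [ XY t u Xt , (λ x → XX t u Xt (∧-fst x)) ]′ (∨-elim {Y u} h)
    ih : r S + f (q + k) ≤ r T′ + f q
    ih = add-clique k S T′ X′ Y c (λ i x y → dj i (∧-fst x) y) (λ i x → av i (∧-fst x)) (↾-new T t S sub (av t Xt))
      (λ i u x y → ↾-keep T t (XY i u (∧-fst x) y) (─-ne {S = X} x) (λ { refl → dj u Xt y }))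
      (λ i u x y → ↾-keep T t (XX i u (∧-fst x) (∧-fst y)) (─-ne {S = X} x) (─-ne {S = X} y))

  -- The chosen neighbours lie outside `X`, so the vertices of `X` do not interfere and may be added
  -- in any order.
  add-each : ∀ k b → b ≤ d → (S T : PairSet n) (X : Subset n) → count n X ≡ k →
    (∀ t → X t ≡ true → Avoids S t) → S ⊑ T →
    (∀ t → X t ≡ true → ∃ λ (N : Subset n) → b ≤ count n N × (∀ u → N u ≡ true → X u ≡ false × T t u ≡ true)) →
    r S + b * k ≤ r T
  add-each zero b b≤d S T X cX av sub nb = ℕP.≤-trans (ℕP.≤-reflexive (trans (cong (r S +_) (ℕP.*-zeroʳ b)) (ℕP.+-identityʳ _))) (r-mono sub)
  add-each (suc k) b b≤d S T X cX av sub nb with remove-one X cX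
  ... | t , Xt , c with nb t Xt
  ... | N , b≤N , N-ok = begin
    r S + b * suc k ≡⟨ cong (r S +_) (trans (ℕP.*-suc b k) (ℕP.+-comm b _)) ⟩
    r S + (b * k + b) ≡⟨ sym (ℕP.+-assoc (r S) _ _) ⟩
    r S + b * k + b ≤⟨ ℕP.+-monoˡ-≤ b ih ⟩
    r T′ + b ≤⟨ gain₀ N (↾-avoids T (full ─ t) (─-self {S = full} {t})) (λ u v s → ↾-set T (full ─ t) s)
         (¬true⇒false (λ h → true≢false Xt (proj₁ (N-ok t h)))) (λ u h → proj₂ (N-ok u h)) b b≤d b≤N ⟩
    r T ∎
    where
    open ℕP.≤-Reasoning
    T′ = T ↾ (full ─ t)
    ih : r S + b * k ≤ r T′
    ih = add-each k b b≤d S T′ (X ─ t) c (λ i x → av i (∧-fst x)) (↾-new T t S sub (av t Xt)) λ i x →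
      let (M , b≤M , ok) = nb i (∧-fst x) in M , b≤M , λ u h →
        ¬true⇒false (λ x′ → true≢false (∧-fst x′) (proj₁ (ok u h))) ,
        ↾-keep T t (proj₂ (ok u h)) (─-ne {S = X} x) (λ { refl → true≢false Xt (proj₁ (ok u h)) })

  clique-rank-≥ : ∀ (A : Subset n) (T : PairSet n) → (∀ u v → A u ≡ true → A v ≡ true → T u v ≡ true) → f (count n A) ≤ r T
  clique-rank-≥ A T h = begin
    f (count n A) ≡⟨ cong (λ z → f (z + count n A)) (sym none) ⟩
    f (count n ∅ + count n A) ≤⟨ ℕP.m≤n+m _ (r (λ _ _ → false)) ⟩
    r (λ _ _ → false) + f (count n ∅ + count n A)
      ≤⟨ add-clique (count n A) (λ _ _ → false) T A ∅ refl (λ _ _ ()) (λ _ _ _ → refl , refl) (λ _ _ ()) (λ _ _ _ ()) h ⟩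
    r T + f (count n ∅) ≡⟨ trans (cong (λ z → r T + f z) none) (ℕP.+-identityʳ _) ⟩
    r T ∎
    where
    open ℕP.≤-Reasoning
    none : count n ∅ ≡ 0
    none = count-∅ n (λ _ → refl)

  -- The leaves play the role of the new vertices, each joined by a single edge to the centre.
  star-rank-≥ : 1 ≤ d → ∀ v (N : Subset n) (T : PairSet n) → N v ≡ false → (∀ u → N u ≡ true → T u v ≡ true) → count n N ≤ r T
  star-rank-≥ 1≤d v N T out h = begin
    count n N ≡⟨ sym (ℕP.*-identityˡ _) ⟩
    1 * count n N ≤⟨ ℕP.m≤n+m _ (r (λ _ _ → false)) ⟩
    r (λ _ _ → false) + 1 * count n N
      ≤⟨ add-each (count n N) 1 1≤d (λ _ _ → false) T N refl (λ _ _ _ → refl , refl) (λ _ _ ()) (λ t Nt →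
           ⟦ v ⟧ , ℕP.≤-reflexive (sym (count-⟦⟧ n v)) , λ u e → subst (λ z → N z ≡ false × T t z ≡ true) (sym (==-elim {x = u} e)) (out , h t Nt)) ⟩
    r T ∎
    where open ℕP.≤-Reasoning

  f-mono : ∀ {a b} → a ≤ b → f a ≤ f b
  f-mono {a} {b} le = go (ℕP.≤⇒≤′ le)
    where
    go : ∀ {b} → a ℕ.≤′ b → f a ≤ f b
    go ℕ.≤′-refl = ℕP.≤-refl
    go (ℕ.≤′-step p) = ℕP.≤-trans (go p) (ℕP.m≤m+n _ _)

  f-≤ : ∀ w → f (suc w) ≤ d * w
  f-≤ zero = ℕP.≤-trans (ℕP.≤-reflexive (ℕP.⊓-zeroʳ d)) z≤n
  f-≤ (suc w) = ℕP.≤-trans (ℕP.+-mono-≤ (f-≤ w) (ℕP.m⊓n≤m d (suc w)))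
    (ℕP.≤-reflexive (trans (ℕP.+-comm (d * w) d) (sym (ℕP.*-suc d w))))

  f-≥ : 1 ≤ d → ∀ w → w ≤ f (suc w)
  f-≥ 1≤d zero = z≤n
  f-≥ 1≤d (suc w) = subst (_≤ f (suc w) + d ⊓ suc w) (ℕP.+-comm w 1) (ℕP.+-mono-≤ (f-≥ 1≤d w) (ℕP.⊓-glb 1≤d (s≤s z≤n)))

  -- Since `f 0` and `f 1` are both zero, injectivity starts at one vertex; from there every
  -- increment is positive because `d ≥ 1`.
  f-cancel-≤ : 1 ≤ d → ∀ a b → f (suc a) ≤ f (suc b) → a ≤ b
  f-cancel-≤ 1≤d a b h with a ℕP.≤? b
  ... | yes le = le
  ... | no ¬le = ⊥-elim (ℕP.<⇒≱ (ℕP.≤-trans strict (f-mono (s≤s (ℕP.≰⇒> ¬le)))) h)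
    where
    strict : f (suc b) < f (suc (suc b))
    strict = subst (_≤ f (suc b) + d ⊓ suc b) (ℕP.+-comm (f (suc b)) 1) (ℕP.+-monoʳ-≤ (f (suc b)) (ℕP.⊓-glb 1≤d (s≤s z≤n)))

-- Closed non-rigid graphs have a large boundary

infixr 9 _∙_
_∙_ : Bool → ℕ → ℕ
b ∙ k = if b then k else 0

∙-mono : ∀ {b b′ k l} → (b ≡ true → b′ ≡ true × k ≤ l) → b ∙ k ≤ b′ ∙ l
∙-mono {false} h = z≤n
∙-mono {true} {b′} h rewrite proj₁ (h refl) = proj₂ (h refl)

∙-+ : ∀ b k l → b ∙ (k + l) ≡ b ∙ k + b ∙ l
∙-+ true k l = refl
∙-+ false k l = refl

sum-mono : ∀ {k} {g h : Fin k → ℕ} → (∀ i → g i ≤ h i) → sum g ≤ sum h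
sum-mono {zero} le = z≤n
sum-mono {suc k} le = ℕP.+-mono-≤ (le zero) (sum-mono (le ∘ suc))

sum-zero : ∀ {k} {g : Fin k → ℕ} → (∀ i → g i ≡ 0) → sum g ≡ 0
sum-zero {zero} h = refl
sum-zero {suc k} h = cong₂ _+_ (h zero) (sum-zero (h ∘ suc))

∙-sum : ∀ {k} b (g : Fin k → ℕ) → b ∙ sum g ≡ sum (λ i → b ∙ g i)
∙-sum true g = refl
∙-sum {k} false g = sym (sum-zero {k} (λ _ → refl))

sumOn : ∀ {k} → Subset k → (Fin k → ℕ) → ℕ
sumOn U h = sum (λ x → U x ∙ h x)

sumOn-mono : ∀ {k} (U V : Subset k) {g h : Fin k → ℕ} → (∀ i → U i ≡ true → V i ≡ true × g i ≤ h i) → sumOn U g ≤ sumOn V h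
sumOn-mono U V le = sum-mono (λ i → ∙-mono (le i))

sumOn-const : ∀ {k} (U : Subset k) c → sumOn U (λ _ → c) ≡ count k U * c
sumOn-const {zero} U c = refl
sumOn-const {suc k} U c with U zero
... | true = cong (c +_) (sumOn-const (U ∘ suc) c)
... | false = sumOn-const (U ∘ suc) c

sumOn-≥ : ∀ {k} (U : Subset k) (h : Fin k → ℕ) c → (∀ i → U i ≡ true → c ≤ h i) → count k U * c ≤ sumOn U h
sumOn-≥ U h c le = subst (_≤ sumOn U h) (sumOn-const U c) (sumOn-mono U U (λ i u → u , le i u))

sumOn-≤ : ∀ {k} (U : Subset k) (h : Fin k → ℕ) c → (∀ i → U i ≡ true → h i ≤ c) → sumOn U h ≤ count k U * c
sumOn-≤ U h c le = subst (sumOn U h ≤_) (sumOn-const U c) (sumOn-mono U U (λ i u → u , le i u))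

sumOn-+ : ∀ {k} (U : Subset k) (g h : Fin k → ℕ) → sumOn U (λ i → g i + h i) ≡ sumOn U g + sumOn U h
sumOn-+ U g h = trans (sum-cong-≗ (λ i → ∙-+ (U i) (g i) (h i))) (∑-distrib-+ (λ i → U i ∙ g i) (λ i → U i ∙ h i))

sumOn-split : ∀ {k} (U V : Subset k) (h : Fin k → ℕ) → sumOn (U ∩ V) h + sumOn (U ∖ V) h ≡ sumOn U h
sumOn-split U V h = trans (sym (∑-distrib-+ (λ i → (U ∩ V) i ∙ h i) (λ i → (U ∖ V) i ∙ h i))) (sum-cong-≗ (λ i → lem (U i) (V i) (h i)))
  where
  lem : ∀ a b k → (a ∧ b) ∙ k + (a ∧ not b) ∙ k ≡ a ∙ k
  lem false b k = refl
  lem true true k = ℕP.+-identityʳ k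
  lem true false k = refl

sumOn-remove : ∀ {k} (U : Subset k) (h : Fin k → ℕ) x → U x ≡ true → h x + sumOn (U ─ x) h ≤ sumOn U h
sumOn-remove U h x Ux = subst (h x + sumOn (U ─ x) h ≤_) (sumOn-split U ⟦ x ⟧ h) (ℕP.+-monoˡ-≤ _ single)
  where
  single : h x ≤ sumOn (U ∩ ⟦ x ⟧) h
  single = ℕP.≤-trans (ℕP.≤-reflexive (sym (trans (cong (_* h x) (count-⟦⟧ _ x)) (ℕP.*-identityˡ _))))
    (ℕP.≤-trans (sumOn-≥ ⟦ x ⟧ h (h x) (λ i e → ℕP.≤-reflexive (cong h (sym (==-elim {x = i} e)))))
      (sumOn-mono ⟦ x ⟧ (U ∩ ⟦ x ⟧) (λ i e → ∧-intro (subst (λ z → U z ≡ true) (sym (==-elim {x = i} e)) Ux) e , ℕP.≤-refl)))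

-- Both sides run over the ordered pairs of distinct elements of `W`.
sumOn-swap : ∀ {k} (W : Subset k) (F : Fin k → Fin k → ℕ) →
  sumOn W (λ x → sumOn (W ─ x) (F x)) ≡ sumOn W (λ v → sumOn (W ─ v) (λ x → F x v))
sumOn-swap {k} W F = begin
  sumOn W (λ x → sumOn (W ─ x) (F x))
    ≡⟨ sum-cong-≗ (λ x → ∙-sum (W x) (λ v → (W ─ x) v ∙ F x v)) ⟩
  sum (λ x → sum (λ v → W x ∙ (W ─ x) v ∙ F x v))
    ≡⟨ ∑-comm (λ x v → W x ∙ (W ─ x) v ∙ F x v) ⟩
  sum (λ v → sum (λ x → W x ∙ (W ─ x) v ∙ F x v))
    ≡⟨ sum-cong-≗ (λ v → trans (sum-cong-≗ (λ x → lem x v)) (sym (∙-sum (W v) (λ x → (W ─ v) x ∙ F x v)))) ⟩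
  sumOn W (λ v → sumOn (W ─ v) (λ x → F x v)) ∎
  where
  open ≡-Reasoning
  ==-sym : ∀ (x v : Fin k) → (x == v) ≡ (v == x)
  ==-sym x v = bool-ext (λ e → dec-true (v FinP.≟ x) (sym (==-elim {x = x} e))) (λ e → dec-true (x FinP.≟ v) (sym (==-elim {x = v} e)))
  shuffle : ∀ a b c k → a ∙ (b ∧ c) ∙ k ≡ b ∙ (a ∧ c) ∙ k
  shuffle true true c k = refl
  shuffle true false c k = refl
  shuffle false true c k = refl
  shuffle false false c k = refl
  lem : ∀ x v → W x ∙ (W ─ x) v ∙ F x v ≡ W v ∙ (W ─ v) x ∙ F x v
  lem x v = trans (shuffle (W x) (W v) (not (v == x)) (F x v)) (cong (λ t → W v ∙ (W x ∧ not t) ∙ F x v) (==-sym v x))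

opaque
  -- `L` is the factorial of `N` and `inv s` stands for `L / s`; scaling by `2 L` turns the expected
  -- gains into natural numbers.
  common-multiple : ∀ N → Σ ℕ λ L → 0 < L × Σ (ℕ → ℕ) λ inv → ∀ s → 1 ≤ s → s ≤ N → s * inv s ≡ L
  common-multiple zero = 1 , s≤s z≤n , (λ _ → 0) , λ { .zero () z≤n }
  common-multiple (suc N) with common-multiple N
  ... | L , pos , inv , ok = suc N * L , ℕP.*-mono-< {0} {suc N} {0} {L} (s≤s z≤n) pos , inv′ , ok′
    where
    inv′ : ℕ → ℕ
    inv′ s with s ℕP.≟ suc N
    ... | yes _ = L
    ... | no _ = suc N * inv s
    ok′ : ∀ s → 1 ≤ s → s ≤ suc N → s * inv′ s ≡ suc N * L
    ok′ s lo hi with s ℕP.≟ suc N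
    ... | yes refl = refl
    ... | no ne = trans (solve 3 (λ s a b → s :* (a :* b) := a :* (s :* b)) refl s (suc N) (inv s))
        (cong (suc N *_) (ok s lo (ℕP.≤-pred (ℕP.≤∧≢⇒< hi ne))))
      where open ℕSolver.+-*-Solver

-- Lower bounds, scaled by 2 L, for the expected rank gain of a vertex with s
-- neighbours in a random vertex order: Γ if they form a clique, Θ otherwise.
module Weights (d : ℕ) (1≤d : 1 ≤ d) (N L : ℕ) (inv : ℕ → ℕ) (inv-ok : ∀ s → 1 ≤ s → s ≤ N → s * inv s ≡ L) where
  open ℕSolver.+-*-Solver

  D : ℕ
  D = d * suc d

  opaque
    -- For `s ≥ d`, divided by `2 L`: `Γ` is `d - D / (2 (s + 1))`, the mean of `min d i` for `i`
    -- uniform on `0, ..., s`, and `Θ` is `d + 1/2 - D / (2 s)`, which solves the recurrence of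
    -- `mixed-step`. Both equal `s / 2` at `s = d`, where the linear branch takes over.
    Γ Θ : ℕ → ℕ
    Γ s with s ℕP.≤? d
    ... | yes _ = s * L
    ... | no _ = 2 * d * L ∸ D * inv (suc s)
    Θ s with s ℕP.≤? d
    ... | yes _ = s * L
    ... | no _ = (2 * d + 1) * L ∸ D * inv s

    Γ-low : ∀ s → s ≤ d → Γ s ≡ s * L
    Γ-low s le with s ℕP.≤? d
    ... | yes _ = refl
    ... | no ¬le = ⊥-elim (¬le le)

    Θ-low : ∀ s → s ≤ d → Θ s ≡ s * L
    Θ-low s le with s ℕP.≤? d
    ... | yes _ = refl
    ... | no ¬le = ⊥-elim (¬le le)

    Γ-eq : ∀ s → d ≤ s → s < N → Γ s + D * inv (suc s) ≡ 2 * d * L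
    Γ-eq s lo hi with s ℕP.≤? d
    ... | yes le = subst (λ s → s * L + D * inv (suc s) ≡ 2 * d * L) (ℕP.≤-antisym lo le) (begin
      d * L + d * suc d * inv (suc d) ≡⟨ cong (d * L +_) (ℕP.*-assoc d (suc d) _) ⟩
      d * L + d * (suc d * inv (suc d)) ≡⟨ cong (λ z → d * L + d * z) (inv-ok (suc d) (s≤s z≤n) (ℕP.≤-trans (s≤s lo) hi)) ⟩
      d * L + d * L ≡⟨ solve 2 (λ d L → d :* L :+ d :* L := con 2 :* d :* L) refl d L ⟩
      2 * d * L ∎)
      where open ≡-Reasoning
    ... | no _ = ℕP.m∸n+n≡m (begin
      d * suc d * inv (suc s) ≡⟨ ℕP.*-assoc d (suc d) _ ⟩
      d * (suc d * inv (suc s)) ≤⟨ ℕP.*-monoʳ-≤ d (ℕP.*-monoˡ-≤ (inv (suc s)) (s≤s lo)) ⟩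
      d * (suc s * inv (suc s)) ≡⟨ cong (d *_) (inv-ok (suc s) (s≤s z≤n) hi) ⟩
      d * L ≤⟨ ℕP.m≤n+m _ _ ⟩
      d * L + d * L ≡⟨ solve 2 (λ d L → d :* L :+ d :* L := con 2 :* d :* L) refl d L ⟩
      2 * d * L ∎)
      where open ℕP.≤-Reasoning

    Θ-eq : ∀ s → d ≤ s → s ≤ N → Θ s + D * inv s ≡ (2 * d + 1) * L
    Θ-eq s lo hi with s ℕP.≤? d
    ... | yes le = subst (λ s → s * L + D * inv s ≡ (2 * d + 1) * L) (ℕP.≤-antisym lo le) (begin
      d * L + d * suc d * inv d ≡⟨ cong (d * L +_) (solve 3 (λ d e i → d :* e :* i := e :* (d :* i)) refl d (suc d) (inv d)) ⟩
      d * L + suc d * (d * inv d) ≡⟨ cong (λ z → d * L + suc d * z) (inv-ok d 1≤d (ℕP.≤-trans lo hi)) ⟩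
      d * L + suc d * L ≡⟨ solve 2 (λ d L → d :* L :+ (con 1 :+ d) :* L := (con 2 :* d :+ con 1) :* L) refl d L ⟩
      (2 * d + 1) * L ∎)
      where open ≡-Reasoning
    ... | no _ = ℕP.m∸n+n≡m (begin
      d * suc d * inv s ≡⟨ solve 3 (λ d e i → d :* e :* i := e :* (d :* i)) refl d (suc d) (inv s) ⟩
      suc d * (d * inv s) ≤⟨ ℕP.*-monoʳ-≤ (suc d) (ℕP.*-monoˡ-≤ (inv s) lo) ⟩
      suc d * (s * inv s) ≡⟨ cong (suc d *_) (inv-ok s (ℕP.≤-trans 1≤d lo) hi) ⟩
      suc d * L ≤⟨ ℕP.m≤n+m _ (d * L) ⟩
      d * L + suc d * L ≡⟨ solve 2 (λ d L → d :* L :+ (con 1 :+ d) :* L := (con 2 :* d :+ con 1) :* L) refl d L ⟩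
      (2 * d + 1) * L ∎)
      where open ℕP.≤-Reasoning

  low-step : ∀ s → suc (suc s) * (suc s * L) ≤ 2 * L * suc s + suc s * (s * L)
  low-step s = ℕP.≤-reflexive (solve 2 (λ s L → (con 2 :+ s) :* ((con 1 :+ s) :* L) := con 2 :* L :* (con 1 :+ s) :+ (con 1 :+ s) :* (s :* L)) refl s L)

  clique-step : ∀ s → d ≤ s → suc (suc s) ≤ N → suc (suc s) * Γ (suc s) ≤ 2 * L * d + suc s * Γ s
  clique-step s lo hi = ℕP.≤-reflexive (ℕP.+-cancelʳ-≡ (D * L) _ _ (trans (Γ-mul (suc s) (ℕP.m≤n⇒m≤1+n lo) hi) (sym (begin
    2 * L * d + suc s * Γ s + D * L ≡⟨ ℕP.+-assoc (2 * L * d) _ _ ⟩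
    2 * L * d + (suc s * Γ s + D * L) ≡⟨ cong (2 * L * d +_) (Γ-mul s lo (ℕP.<⇒≤ hi)) ⟩
    2 * L * d + suc s * (2 * d * L) ≡⟨ solve 3 (λ s d L → con 2 :* L :* d :+ (con 1 :+ s) :* (con 2 :* d :* L) := (con 2 :+ s) :* (con 2 :* d :* L)) refl s d L ⟩
    suc (suc s) * (2 * d * L) ∎))))
    where
    open ≡-Reasoning
    Γ-mul : ∀ s → d ≤ s → suc s ≤ N → suc s * Γ s + D * L ≡ suc s * (2 * d * L)
    Γ-mul s lo hi = begin
      suc s * Γ s + D * L ≡⟨ cong (λ z → suc s * Γ s + D * z) (sym (inv-ok (suc s) (s≤s z≤n) hi)) ⟩
      suc s * Γ s + D * (suc s * inv (suc s)) ≡⟨ solve 4 (λ t g D i → t :* g :+ D :* (t :* i) := t :* (g :+ D :* i)) refl (suc s) (Γ s) D (inv (suc s)) ⟩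
      suc s * (Γ s + D * inv (suc s)) ≡⟨ cong (suc s *_) (Γ-eq s lo hi) ⟩
      suc s * (2 * d * L) ∎

  -- The recurrence in the worst case that `unique-defect` permits: one removal leaves a clique, the
  -- other `s` do not, and the vertex itself gains `d + 1` when it comes last.
  mixed-step : ∀ s → d ≤ s → suc (suc s) ≤ N → suc (suc s) * Θ (suc s) ≤ 2 * L * suc d + (Γ s + s * Θ s)
  mixed-step s lo hi = ℕP.≤-reflexive (ℕP.+-cancelʳ-≡ (D * L + D * inv (suc s)) _ _ (begin
    suc (suc s) * Θ (suc s) + (D * L + D * inv (suc s))
      ≡⟨ cong (λ z → suc (suc s) * Θ (suc s) + (D * z + D * inv (suc s))) (sym (inv-ok (suc s) (s≤s z≤n) (ℕP.<⇒≤ hi))) ⟩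
    suc (suc s) * Θ (suc s) + (D * (suc s * inv (suc s)) + D * inv (suc s))
      ≡⟨ solve 4 (λ t h D i → (con 1 :+ t) :* h :+ (D :* (t :* i) :+ D :* i) := (con 1 :+ t) :* (h :+ D :* i)) refl (suc s) (Θ (suc s)) D (inv (suc s)) ⟩
    suc (suc s) * (Θ (suc s) + D * inv (suc s))
      ≡⟨ cong (suc (suc s) *_) (Θ-eq (suc s) (ℕP.m≤n⇒m≤1+n lo) (ℕP.<⇒≤ hi)) ⟩
    suc (suc s) * ((2 * d + 1) * L)
      ≡⟨ solve 3 (λ s d L → (con 2 :+ s) :* ((con 2 :* d :+ con 1) :* L) := con 2 :* L :* (con 1 :+ d) :+ (con 2 :* d :* L :+ s :* ((con 2 :* d :+ con 1) :* L))) refl s d L ⟩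
    2 * L * suc d + (2 * d * L + s * ((2 * d + 1) * L))
      ≡⟨ cong₂ (λ a b → 2 * L * suc d + (a + s * b)) (sym (Γ-eq s lo (ℕP.<⇒≤ hi))) (sym (Θ-eq s lo (ℕP.<⇒≤ (ℕP.<⇒≤ hi)))) ⟩
    2 * L * suc d + ((Γ s + D * inv (suc s)) + s * (Θ s + D * inv s))
      ≡⟨ solve 7 (λ a g D i s h j → a :+ ((g :+ D :* i) :+ s :* (h :+ D :* j)) := a :+ (g :+ s :* h) :+ (D :* (s :* j) :+ D :* i)) refl (2 * L * suc d) (Γ s) D (inv (suc s)) s (Θ s) (inv s) ⟩
    2 * L * suc d + (Γ s + s * Θ s) + (D * (s * inv s) + D * inv (suc s))
      ≡⟨ cong (λ z → 2 * L * suc d + (Γ s + s * Θ s) + (D * z + D * inv (suc s))) (inv-ok s (ℕP.≤-trans 1≤d lo) (ℕP.<⇒≤ (ℕP.<⇒≤ hi))) ⟩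
    2 * L * suc d + (Γ s + s * Θ s) + (D * L + D * inv (suc s)) ∎))
    where open ≡-Reasoning

  -- Amounts to `D / s - D / (s + 1) ≤ 1`, that is `D ≤ s (s + 1)`, which follows from `d ≤ s`.
  Γ≤Θ : ∀ s → d ≤ s → s < N → Γ s ≤ Θ s
  Γ≤Θ s lo hi = ℕP.+-cancelʳ-≤ (D * inv (suc s) + D * inv s) (Γ s) (Θ s) (begin
    Γ s + (D * inv (suc s) + D * inv s) ≡⟨ sym (ℕP.+-assoc (Γ s) _ _) ⟩
    Γ s + D * inv (suc s) + D * inv s ≡⟨ cong (_+ D * inv s) (Γ-eq s lo hi) ⟩
    2 * d * L + D * inv s ≤⟨ ℕP.+-monoʳ-≤ (2 * d * L) key ⟩
    2 * d * L + (L + D * inv (suc s)) ≡⟨ solve 3 (λ d L x → con 2 :* d :* L :+ (L :+ x) := (con 2 :* d :+ con 1) :* L :+ x) refl d L (D * inv (suc s)) ⟩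
    (2 * d + 1) * L + D * inv (suc s) ≡⟨ cong (_+ D * inv (suc s)) (sym (Θ-eq s lo (ℕP.<⇒≤ hi))) ⟩
    Θ s + D * inv s + D * inv (suc s) ≡⟨ solve 3 (λ a b c → a :+ b :+ c := a :+ (c :+ b)) refl (Θ s) (D * inv s) (D * inv (suc s)) ⟩
    Θ s + (D * inv (suc s) + D * inv s) ∎)
    where
    open ℕP.≤-Reasoning
    x = inv s
    y = inv (suc s)
    sx : s * x ≡ L
    sx = inv-ok s (ℕP.≤-trans 1≤d lo) (ℕP.<⇒≤ hi)
    ty : suc s * y ≡ L
    ty = inv-ok (suc s) (s≤s z≤n) hi
    key : D * x ≤ L + D * y
    key = ℕP.*-cancelˡ-≤ (suc s) (begin
      suc s * (D * x) ≡⟨ solve 3 (λ s D x → (con 1 :+ s) :* (D :* x) := D :* (s :* x) :+ D :* x) refl s D x ⟩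
      D * (s * x) + D * x ≡⟨ cong (λ z → D * z + D * x) sx ⟩
      D * L + D * x ≤⟨ ℕP.+-monoʳ-≤ (D * L) (ℕP.*-monoˡ-≤ x (ℕP.*-mono-≤ lo (s≤s lo))) ⟩
      D * L + s * suc s * x ≡⟨ cong (D * L +_) (trans (solve 2 (λ s x → s :* (con 1 :+ s) :* x := (con 1 :+ s) :* (s :* x)) refl s x) (cong (suc s *_) sx)) ⟩
      D * L + suc s * L ≡⟨ cong (λ z → D * z + suc s * L) (sym ty) ⟩
      D * (suc s * y) + suc s * L ≡⟨ solve 4 (λ D t y L → D :* (t :* y) :+ t :* L := t :* (L :+ D :* y)) refl D (suc s) y L ⟩
      suc s * (L + D * y) ∎)

  -- The origin of `D`: the value `d + 1/2 - D / (2 s)` reaches `d` exactly at `s = D`.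
  Θ-final : ∀ s → D ≤ s → s ≤ N → 2 * L * d ≤ Θ s
  Θ-final s lo hi = ℕP.+-cancelʳ-≤ (D * inv s) (2 * L * d) (Θ s) (begin
    2 * L * d + D * inv s ≤⟨ ℕP.+-monoʳ-≤ (2 * L * d) (ℕP.*-monoˡ-≤ (inv s) lo) ⟩
    2 * L * d + s * inv s ≡⟨ cong (2 * L * d +_) (inv-ok s (ℕP.≤-trans 1≤d d≤s) hi) ⟩
    2 * L * d + L ≡⟨ solve 2 (λ d L → con 2 :* L :* d :+ L := (con 2 :* d :+ con 1) :* L) refl d L ⟩
    (2 * d + 1) * L ≡⟨ sym (Θ-eq s d≤s hi) ⟩
    Θ s + D * inv s ∎)
    where
    open ℕP.≤-Reasoning
    d≤s : d ≤ s
    d≤s = ℕP.≤-trans (ℕP.m≤m*n d (suc d)) lo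

-- Rigidity by random vertex orders

module Core {n d : ℕ} (R : RigidityRank n d) (1≤d : 1 ≤ d) (S : PairSet n) (A : Subset n) where
  open RigidityRank R
  open RankLemmas R

  link : PairSet n
  link u v = does (Lk? S u v)

  link-in : ∀ {u v} → Lk S u v → link u v ≡ true
  link-in {u} {v} = dec-true (Lk? S u v)

  link-out : ∀ {u v} → link u v ≡ true → Lk S u v
  link-out {u} {v} = does-elim (Lk? S u v)

  Nb : Fin n → Subset n
  Nb v u = A u ∧ (link v u ∧ not (u == v))

  Nb-in : ∀ {v u} → A u ≡ true → Lk S v u → u ≢ v → Nb v u ≡ true
  Nb-in a l ne = ∧-intro a (∧-intro (link-in l) (cong not (==-neq ne)))

  Nb-A : ∀ {v u} → Nb v u ≡ true → A u ≡ true
  Nb-A h = ∧-fst h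

  Nb-Lk : ∀ {v u} → Nb v u ≡ true → Lk S v u
  Nb-Lk {v} {u} h = link-out (∧-fst (∧-snd {a = A u} h))

  Nb-≢ : ∀ {v u} → Nb v u ≡ true → u ≢ v
  Nb-≢ {v} {u} h refl = not-elim (∧-snd {a = link v u} (∧-snd {a = A u} h)) (==-refl v)

  Clique : Subset n → Set
  Clique U = ∀ a b → U a ≡ true → U b ≡ true → Lk S a b

  opaque
    clique? : ∀ U → Dec (Clique U)
    clique? U = FinP.all? (λ a → FinP.all? (λ b → (U a Data.Bool.≟ true) →-dec ((U b Data.Bool.≟ true) →-dec Lk? S a b)))

  non-clique : ∀ U → ¬ Clique U → ∃ λ a → ∃ λ b → U a ≡ true × U b ≡ true × ¬ Lk S a b
  non-clique U h with FinP.any? (λ a → FinP.any? (λ b → (U a Data.Bool.≟ true) ×-dec ((U b Data.Bool.≟ true) ×-dec ¬? (Lk? S a b))))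
  ... | yes w = w
  ... | no none = ⊥-elim (h (λ a b ua ub → decidable-stable (Lk? S a b) (λ ¬l → none (a , b , ua , ub , ¬l))))

  -- The non-simplicial vertices of `A`.
  Y : Subset n
  Y v = A v ∧ not (does (clique? (Nb v)))

  Y-A : ∀ {v} → Y v ≡ true → A v ≡ true
  Y-A h = ∧-fst h

  Y-non-clique : ∀ {v} → Y v ≡ true → ¬ Clique (Nb v)
  Y-non-clique {v} h c = not-elim (∧-snd {a = A v} h) (dec-true (clique? (Nb v)) c)

  Y-in : ∀ {v} → A v ≡ true → ¬ Clique (Nb v) → Y v ≡ true
  Y-in {v} a h = ∧-intro a (not-intro (λ e → h (does-elim (clique? (Nb v)) e)))

  link-through : ∀ (M : Subset n) x y → d ≤ count n M → Clique M → M x ≡ false → M y ≡ false →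
    (∀ a → M a ≡ true → Lk S x a) → (∀ a → M a ≡ true → Lk S y a) → Lk S x y
  link-through M x y size cl Mx My hx hy with x FinP.≟ y
  ... | yes refl = Lk-loop x
  ... | no ne with choose n M d size
  ... | N , N⊆M , cN = simplex S N x y cN (¬true⇒false (λ h → true≢false (N⊆M x h) Mx)) (¬true⇒false (λ h → true≢false (N⊆M y h) My)) ne
      (λ a b na nb → cl a b (N⊆M a na) (N⊆M b nb)) (λ a na → hx a (N⊆M a na)) (λ a na → hy a (N⊆M a na))

  L : ℕ
  L = proj₁ (common-multiple (suc n))
  L-pos : 0 < L
  L-pos = proj₁ (proj₂ (common-multiple (suc n)))
  open Weights d 1≤d (suc n) L (proj₁ (proj₂ (proj₂ (common-multiple (suc n))))) (proj₂ (proj₂ (proj₂ (common-multiple (suc n))))) public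

  -- `gain U` bounds what a vertex contributes when added after all of `U`; `g U` is the scaled
  -- bound for its average over random orders.
  g gain : Subset n → ℕ
  g U = if does (clique? U) then Γ (count n U) else Θ (count n U)
  gain U = if does (clique? U) then d ⊓ count n U else suc d ⊓ count n U

  g-clique : ∀ U → Clique U → g U ≡ Γ (count n U)
  g-clique U c = cong (if_then Γ (count n U) else Θ (count n U)) (dec-true (clique? U) c)

  g-other : ∀ U → ¬ Clique U → g U ≡ Θ (count n U)
  g-other U c = cong (if_then Γ (count n U) else Θ (count n U)) (dec-false (clique? U) c)

  g-low : ∀ U → count n U ≤ d → g U ≡ count n U * L
  g-low U le with clique? U
  ... | yes c = Γ-low _ le
  ... | no c = Θ-low _ le

  g-cong : ∀ {U V : Subset n} → (∀ i → U i ≡ V i) → g U ≡ g V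
  g-cong {U} {V} e with clique? U
  ... | yes c = trans (cong Γ (count-cong n e)) (sym (g-clique V (λ a b va vb → c a b (trans (e a) va) (trans (e b) vb))))
  ... | no ¬c = trans (cong Θ (count-cong n e)) (sym (g-other V (λ c → ¬c (λ a b ua ub → c a b (trans (sym (e a)) ua) (trans (sym (e b)) ub)))))

  gain-low : ∀ U → count n U ≤ d → gain U ≡ count n U
  gain-low U le with clique? U
  ... | yes _ = ℕP.m≥n⇒m⊓n≡n le
  ... | no _ = ℕP.m≥n⇒m⊓n≡n (ℕP.m≤n⇒m≤1+n le)

  gain-bound : ∀ W v → W v ≡ true → r (link ↾ (W ─ v)) + gain (W ∩ Nb v) ≤ r (link ↾ W)
  gain-bound W v Wv = go (clique? U)
    where
    U = W ∩ Nb v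
    s = count n U
    out : U v ≡ false
    out = ¬true⇒false (λ h → Nb-≢ (∧-snd {a = W v} h) refl)
    nb : ∀ u → U u ≡ true → (link ↾ W) v u ≡ true
    nb u h = ↾-in link W (link-in (Nb-Lk (∧-snd {a = W u} h))) Wv (∧-fst h)
    av : Avoids (link ↾ (W ─ v)) v
    av = ↾-avoids link (W ─ v) (─-self {S = W} {v})
    sub : (link ↾ (W ─ v)) ⊑ (link ↾ W)
    sub = ↾-mono link {W ─ v} {W} (λ y → ∧-fst)
    go : (c? : Dec (Clique U)) → r (link ↾ (W ─ v)) + (if does c? then d ⊓ s else suc d ⊓ s) ≤ r (link ↾ W)
    go (yes c) = gain₀ U av sub out nb (d ⊓ s) (ℕP.m⊓n≤m d s) (ℕP.m⊓n≤n d s)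
    go (no ¬c) with suc d ℕP.≤? s
    ... | no ¬le = subst (λ t → r (link ↾ (W ─ v)) + t ≤ r (link ↾ W)) (sym (ℕP.m≥n⇒m⊓n≡n (ℕP.<⇒≤ (ℕP.≰⇒> ¬le))))
        (gain₀ U av sub out nb s (ℕP.≤-pred (ℕP.≰⇒> ¬le)) ℕP.≤-refl)
    ... | yes le with non-clique U ¬c
    ... | a , b , ua , ub , unl = subst (λ t → r (link ↾ (W ─ v)) + t ≤ r (link ↾ W)) (sym (ℕP.m≤n⇒m⊓n≡m le))
        (gain₁ U 1≤d av sub out nb le ua ub (λ { refl → unl (Lk-loop a) })
          (λ l → unl (Lk-trans (λ x y h → link-out (↾-set link (W ─ v) h)) l)))

  -- If both removals leave cliques, only the pair `xy` can be unlinked. But `v` together with the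
  -- other elements of `U` is a clique of size at least `d` linked to both, so `xy` is linked as
  -- well.
  unique-defect : ∀ U v → (∀ u → U u ≡ true → Lk S v u) → U v ≡ false → suc d ≤ count n U →
    ∀ x y → U x ≡ true → U y ≡ true → x ≢ y → Clique (U ─ x) → Clique (U ─ y) → Clique U
  unique-defect U v nb out size x y Ux Uy x≢y cx cy = all
    where
    M₀ = U ─ x ─ y
    M = ⟦ v ⟧ ⊔ M₀
    M₀-U : ∀ {a} → M₀ a ≡ true → U a ≡ true
    M₀-U {a} h = ∧-fst (∧-fst {a = (U ─ x) a} h)
    v-new : ∀ {a} → U a ≡ true → a ≢ v
    v-new ua refl = true≢false ua out
    size-M : d ≤ count n M
    size-M = ℕP.≤-trans (ℕP.≤-pred (subst (suc d ≤_) (trans (count-─ U x Ux) (cong suc (count-─ (U ─ x) y (─-in {S = U} Uy (x≢y ∘ sym))))) size))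
      (ℕP.≤-reflexive (sym (trans (⊔-count ⟦ v ⟧ M₀ (λ i e m → v-new (M₀-U m) (==-elim {x = i} e))) (cong (_+ count n M₀) (count-⟦⟧ n v)))))
    M-case : ∀ a → M a ≡ true → a ≡ v ⊎ M₀ a ≡ true
    M-case a h = [ (λ e → inj₁ (==-elim {x = a} e)) , inj₂ ]′ (∨-elim {⟦ v ⟧ a} h)
    M-clique : Clique M
    M-clique a b ma mb with M-case a ma | M-case b mb
    ... | inj₁ refl | inj₁ refl = Lk-loop v
    ... | inj₁ refl | inj₂ m = nb b (M₀-U m)
    ... | inj₂ m | inj₁ refl = Lk-sym (nb a (M₀-U m))
    ... | inj₂ m | inj₂ m′ = cx a b (∧-fst m) (∧-fst m′)
    M-x : M x ≡ false
    M-x = ¬true⇒false (λ h → [ v-new Ux , (λ m → ─-ne {S = U} (∧-fst {a = (U ─ x) x} m) refl) ]′ (M-case x h))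
    M-y : M y ≡ false
    M-y = ¬true⇒false (λ h → [ v-new Uy , (λ m → ─-ne {S = U ─ x} m refl) ]′ (M-case y h))
    xy : Lk S x y
    xy = link-through M x y size-M M-clique M-x M-y
      (λ a h → [ (λ { refl → Lk-sym (nb x Ux) }) , (λ m → cy x a (─-in {S = U} Ux x≢y) (─-in {S = U} (M₀-U m) (─-ne {S = U ─ x} m))) ]′ (M-case a h))
      (λ a h → [ (λ { refl → Lk-sym (nb y Uy) }) , (λ m → cx y a (─-in {S = U} Uy (x≢y ∘ sym)) (∧-fst m)) ]′ (M-case a h))
    all : Clique U
    all a b ua ub with a FinP.≟ x | b FinP.≟ x | a FinP.≟ y | b FinP.≟ y
    ... | no ax | no bx | _ | _ = cx a b (─-in {S = U} ua ax) (─-in {S = U} ub bx)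
    ... | _ | _ | no ay | no by = cy a b (─-in {S = U} ua ay) (─-in {S = U} ub by)
    ... | yes refl | _ | yes refl | _ = ⊥-elim (x≢y refl)
    ... | yes refl | _ | no _ | yes refl = xy
    ... | no _ | yes refl | _ | yes refl = ⊥-elim (x≢y refl)
    ... | no _ | yes refl | yes refl | no _ = Lk-sym xy

  -- In a random order of `v` and `U` each element is equally likely to be last: `v` last
  -- contributes `gain U`, and `x` last leaves the same question for `U ─ x`.
  g-step : ∀ U v → (∀ u → U u ≡ true → Lk S v u) → U v ≡ false →
    suc (count n U) * g U ≤ 2 * L * gain U + sumOn U (λ x → g (U ─ x))
  g-step U v nb out = go (count n U) refl
    where
    open ℕP.≤-Reasoning
    cU : ∀ {s} → count n U ≡ suc s → ∀ x → U x ≡ true → count n (U ─ x) ≡ s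
    cU eq x Ux = ℕP.suc-injective (trans (sym (count-─ U x Ux)) eq)
    bound : ∀ {s} → count n U ≡ suc s → suc (suc s) ≤ suc n
    bound eq = s≤s (subst (_≤ n) eq (count-≤-full n U))
    go : ∀ s → count n U ≡ s → suc (count n U) * g U ≤ 2 * L * gain U + sumOn U (λ x → g (U ─ x))
    go zero eq = begin
      suc (count n U) * g U ≡⟨ cong₂ (λ a b → suc a * b) eq (trans (g-low U (subst (_≤ d) (sym eq) z≤n)) (cong (_* L) eq)) ⟩
      0 ≤⟨ z≤n ⟩
      2 * L * gain U + sumOn U (λ x → g (U ─ x)) ∎
    go (suc s) eq with suc s ℕP.≤? d
    ... | yes low = begin
      suc (count n U) * g U ≡⟨ cong₂ (λ a b → suc a * b) eq (trans (g-low U (subst (_≤ d) (sym eq) low)) (cong (_* L) eq)) ⟩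
      suc (suc s) * (suc s * L) ≤⟨ low-step s ⟩
      2 * L * suc s + suc s * (s * L)
        ≤⟨ ℕP.+-mono-≤ (ℕP.≤-reflexive (cong (2 * L *_) (sym (trans (gain-low U (subst (_≤ d) (sym eq) low)) eq))))
            (subst (λ t → t * (s * L) ≤ sumOn U (λ x → g (U ─ x))) eq (sumOn-≥ U _ (s * L) (λ x Ux → ℕP.≤-reflexive (sym
              (trans (g-low (U ─ x) (subst (_≤ d) (sym (cU eq x Ux)) (ℕP.<⇒≤ low))) (cong (_* L) (cU eq x Ux))))))) ⟩
      2 * L * gain U + sumOn U (λ x → g (U ─ x)) ∎
    ... | no ¬low = high (clique? U)
      where
      lo : d ≤ s
      lo = ℕP.≤-pred (ℕP.≰⇒> ¬low)
      high : Dec (Clique U) → suc (count n U) * g U ≤ 2 * L * gain U + sumOn U (λ x → g (U ─ x))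
      high (yes c) = begin
        suc (count n U) * g U ≡⟨ cong₂ (λ a b → suc a * b) eq (trans (g-clique U c) (cong Γ eq)) ⟩
        suc (suc s) * Γ (suc s) ≤⟨ clique-step s lo (bound eq) ⟩
        2 * L * d + suc s * Γ s
          ≤⟨ ℕP.+-mono-≤ (ℕP.≤-reflexive (cong (2 * L *_) (sym (trans (cong (if_then d ⊓ count n U else suc d ⊓ count n U) (dec-true (clique? U) c))
                (trans (cong (d ⊓_) eq) (ℕP.m≤n⇒m⊓n≡m (ℕP.m≤n⇒m≤1+n lo)))))))
              (subst (λ t → t * Γ s ≤ sumOn U (λ x → g (U ─ x))) eq (sumOn-≥ U _ (Γ s) (λ x Ux → ℕP.≤-reflexive (sym
                (trans (g-clique (U ─ x) (λ a b ha hb → c a b (∧-fst ha) (∧-fst hb))) (cong Γ (cU eq x Ux))))))) ⟩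
        2 * L * gain U + sumOn U (λ x → g (U ─ x)) ∎
      high (no ¬c) = begin
        suc (count n U) * g U ≡⟨ cong₂ (λ a b → suc a * b) eq (trans (g-other U ¬c) (cong Θ eq)) ⟩
        suc (suc s) * Θ (suc s) ≤⟨ mixed-step s lo (bound eq) ⟩
        2 * L * suc d + (Γ s + s * Θ s)
          ≤⟨ ℕP.+-mono-≤ (ℕP.≤-reflexive (cong (2 * L *_) (sym (trans (cong (if_then d ⊓ count n U else suc d ⊓ count n U) (dec-false (clique? U) ¬c))
                (trans (cong (suc d ⊓_) eq) (ℕP.m≤n⇒m⊓n≡m (s≤s lo))))))) defect ⟩
        2 * L * gain U + sumOn U (λ x → g (U ─ x)) ∎
        where
        -- A removal that leaves a clique accounts for the term `Γ s`, all others for `Θ s`; if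
        -- there is none, `Γ≤Θ` gives the slack.
        defect : Γ s + s * Θ s ≤ sumOn U (λ x → g (U ─ x))
        defect with FinP.any? (λ x → (U x Data.Bool.≟ true) ×-dec clique? (U ─ x))
        ... | yes (x₀ , Ux₀ , c₀) = begin
          Γ s + s * Θ s ≡⟨ cong₂ (λ a b → a + b * Θ s) (sym (trans (g-clique (U ─ x₀) c₀) (cong Γ (cU eq x₀ Ux₀)))) (sym (cU eq x₀ Ux₀)) ⟩
          g (U ─ x₀) + count n (U ─ x₀) * Θ s
            ≤⟨ ℕP.+-monoʳ-≤ (g (U ─ x₀)) (sumOn-≥ (U ─ x₀) (λ x → g (U ─ x)) (Θ s) (λ x h → ℕP.≤-reflexive (sym
                (trans (g-other (U ─ x) (λ c → ¬c (unique-defect U v nb out (subst (suc d ≤_) (sym eq) (s≤s lo)) x₀ x Ux₀ (∧-fst h) (λ e → ─-ne {S = U} h (sym e)) c₀ c)))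
                  (cong Θ (cU eq x (∧-fst h))))))) ⟩
          g (U ─ x₀) + sumOn (U ─ x₀) (λ x → g (U ─ x)) ≤⟨ sumOn-remove U (λ x → g (U ─ x)) x₀ Ux₀ ⟩
          sumOn U (λ x → g (U ─ x)) ∎
        ... | no none = begin
          Γ s + s * Θ s ≤⟨ ℕP.+-monoˡ-≤ (s * Θ s) (Γ≤Θ s lo (ℕP.<⇒≤ (bound eq))) ⟩
          suc s * Θ s ≤⟨ subst (λ t → t * Θ s ≤ sumOn U (λ x → g (U ─ x))) eq (sumOn-≥ U _ (Θ s) (λ x Ux → ℕP.≤-reflexive (sym
              (trans (g-other (U ─ x) (λ c → none (x , Ux , c))) (cong Θ (cU eq x Ux)))))) ⟩
          sumOn U (λ x → g (U ─ x)) ∎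

  -- Averaging over the vertex of W that comes last.
  rank-average : ∀ w W → count n W ≡ w → sumOn W (λ v → g (W ∩ Nb v)) ≤ 2 * L * r (link ↾ W)
  rank-average zero W c = ℕP.≤-trans (ℕP.≤-reflexive (sum-zero (λ i → cong (_∙ g (W ∩ Nb i)) (¬true⇒false (λ h → ℕP.<⇒≢ (count-in n W i h) (sym c)))))) z≤n
  rank-average (suc w) W c = ℕP.*-cancelˡ-≤ (suc w) (begin
    suc w * sumOn W (λ v → g (W ∩ Nb v)) ≡⟨ mul-sumOn (suc w) W _ ⟩
    sumOn W (λ v → suc w * g (W ∩ Nb v)) ≤⟨ sumOn-mono W W (λ v Wv → Wv , per-vertex v Wv) ⟩
    sumOn W (λ v → 2 * L * gain (W ∩ Nb v) + sumOn (W ─ v) (λ x → g ((W ─ x) ∩ Nb v)))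
      ≡⟨ sumOn-+ W (λ v → 2 * L * gain (W ∩ Nb v)) (λ v → sumOn (W ─ v) (λ x → g ((W ─ x) ∩ Nb v))) ⟩
    sumOn W (λ v → 2 * L * gain (W ∩ Nb v)) + sumOn W (λ v → sumOn (W ─ v) (λ x → g ((W ─ x) ∩ Nb v)))
      ≡⟨ cong (sumOn W (λ v → 2 * L * gain (W ∩ Nb v)) +_) (sym (sumOn-swap W (λ x v → g ((W ─ x) ∩ Nb v)))) ⟩
    sumOn W (λ v → 2 * L * gain (W ∩ Nb v)) + sumOn W (λ x → sumOn (W ─ x) (λ v → g ((W ─ x) ∩ Nb v)))
      ≡⟨ sym (sumOn-+ W (λ v → 2 * L * gain (W ∩ Nb v)) (λ x → sumOn (W ─ x) (λ v → g ((W ─ x) ∩ Nb v)))) ⟩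
    sumOn W (λ x → 2 * L * gain (W ∩ Nb x) + sumOn (W ─ x) (λ v → g ((W ─ x) ∩ Nb v)))
      ≤⟨ sumOn-≤ W _ (2 * L * r (link ↾ W)) last ⟩
    count n W * (2 * L * r (link ↾ W)) ≡⟨ cong (_* (2 * L * r (link ↾ W))) c ⟩
    suc w * (2 * L * r (link ↾ W)) ∎)
    where
    open ℕP.≤-Reasoning
    mul-sumOn : ∀ k (U : Subset n) (h : Fin n → ℕ) → k * sumOn U h ≡ sumOn U (λ x → k * h x)
    mul-sumOn zero U h = sym (sum-zero (λ i → lem (U i)))
      where
      lem : ∀ b → b ∙ 0 ≡ 0
      lem true = refl
      lem false = refl
    mul-sumOn (suc k) U h = trans (cong (sumOn U h +_) (mul-sumOn k U h)) (sym (sumOn-+ U h (λ x → k * h x)))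
    last : ∀ x → W x ≡ true → 2 * L * gain (W ∩ Nb x) + sumOn (W ─ x) (λ v → g ((W ─ x) ∩ Nb v)) ≤ 2 * L * r (link ↾ W)
    last x Wx = begin
      2 * L * gain (W ∩ Nb x) + sumOn (W ─ x) (λ v → g ((W ─ x) ∩ Nb v))
        ≤⟨ ℕP.+-monoʳ-≤ (2 * L * gain (W ∩ Nb x)) (rank-average w (W ─ x) (ℕP.suc-injective (trans (sym (count-─ W x Wx)) c))) ⟩
      2 * L * gain (W ∩ Nb x) + 2 * L * r (link ↾ (W ─ x)) ≡⟨ sym (ℕP.*-distribˡ-+ (2 * L) _ _) ⟩
      2 * L * (gain (W ∩ Nb x) + r (link ↾ (W ─ x))) ≤⟨ ℕP.*-monoʳ-≤ (2 * L) (subst (_≤ r (link ↾ W)) (ℕP.+-comm (r (link ↾ (W ─ x))) _) (gain-bound W x Wx)) ⟩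
      2 * L * r (link ↾ W) ∎
    -- If the last vertex `x` is a neighbour of `v`, this is `g-step`; if it lies in `Z`, removing
    -- it leaves the neighbourhood of `v` unchanged.
    per-vertex : ∀ v → W v ≡ true → suc w * g (W ∩ Nb v) ≤ 2 * L * gain (W ∩ Nb v) + sumOn (W ─ v) (λ x → g ((W ─ x) ∩ Nb v))
    per-vertex v Wv = begin
      suc w * g U ≡⟨ cong (λ t → suc t * g U) (sym sizes) ⟩
      suc (count n U + count n Z) * g U ≡⟨ ℕP.*-distribʳ-+ (g U) (suc (count n U)) (count n Z) ⟩
      suc (count n U) * g U + count n Z * g U
        ≤⟨ ℕP.+-mono-≤ (g-step U v (λ u h → Nb-Lk (∧-snd {a = W u} h)) (¬true⇒false (λ h → Nb-≢ (∧-snd {a = W v} h) refl)))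
            (sumOn-≥ Z (λ x → g ((W ─ x) ∩ Nb v)) (g U) (λ x h → ℕP.≤-reflexive (g-cong (λ i → sym (outside x h i))))) ⟩
      (2 * L * gain U + sumOn U (λ x → g (U ─ x))) + sumOn Z (λ x → g ((W ─ x) ∩ Nb v))
        ≡⟨ ℕP.+-assoc (2 * L * gain U) _ _ ⟩
      2 * L * gain U + (sumOn U (λ x → g (U ─ x)) + sumOn Z (λ x → g ((W ─ x) ∩ Nb v)))
        ≤⟨ ℕP.+-monoʳ-≤ (2 * L * gain U) (ℕP.+-monoˡ-≤ _ (sumOn-mono U (W ─ v ∩ U) (λ x h → ∧-intro (U⊆ x h) h , ℕP.≤-reflexive (g-cong (inside x))))) ⟩
      2 * L * gain U + (sumOn (W ─ v ∩ U) (λ x → g ((W ─ x) ∩ Nb v)) + sumOn Z (λ x → g ((W ─ x) ∩ Nb v)))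
        ≡⟨ cong (2 * L * gain U +_) (sumOn-split (W ─ v) U (λ x → g ((W ─ x) ∩ Nb v))) ⟩
      2 * L * gain U + sumOn (W ─ v) (λ x → g ((W ─ x) ∩ Nb v)) ∎
      where
      U = W ∩ Nb v
      Z = (W ─ v) ∖ U
      U⊆ : U ⊆ (W ─ v)
      U⊆ x h = ─-in {S = W} (∧-fst h) (Nb-≢ (∧-snd {a = W x} h))
      sizes : count n U + count n Z ≡ w
      sizes = trans (cong (_+ count n Z) (count-cong n (λ i → bool-ext (λ h → ∧-intro (U⊆ i h) h) (∧-snd {a = (W ─ v) i}))))
        (trans (count-split n (W ─ v) U) (ℕP.suc-injective (trans (sym (count-─ W v Wv)) c)))
      inside : ∀ x i → (U ─ x) i ≡ ((W ─ x) ∩ Nb v) i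
      inside x i = lem (W i) (Nb v i) (not (i == x))
        where
        lem : ∀ a b c → (a ∧ b) ∧ c ≡ (a ∧ c) ∧ b
        lem true true true = refl
        lem true true false = refl
        lem true false true = refl
        lem true false false = refl
        lem false b c = refl
      outside : ∀ x → Z x ≡ true → ∀ i → ((W ─ x) ∩ Nb v) i ≡ U i
      outside x h i = bool-ext (λ k → ∧-intro (∧-fst {a = W i} (∧-fst {a = (W ─ x) i} k)) (∧-snd {a = (W ─ x) i} k))
        (λ k → ∧-intro (─-in {S = W} (∧-fst k) (λ { refl → not-elim (∧-snd {a = (W ─ v) x} h) k })) (∧-snd {a = W i} k))

  module _ (deg : ∀ v → A v ≡ true → D ≤ count n (Nb v))
           (boundary : ∀ v → A v ≡ true → Clique (Nb v) → (∃ λ u → A u ≡ true × ¬ Lk S v u) → D ≤ count n (Y ∩ Nb v)) where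

    d≤D : d ≤ D
    d≤D = ℕP.m≤m*n d (suc d)

    module _ (u₀ v₀ : Fin n) (Au₀ : A u₀ ≡ true) (Av₀ : A v₀ ≡ true) (unlinked : ¬ Lk S u₀ v₀) where

      -- A simplicial vertex linked to all of `A` would make `A` a clique and so link `u₀` to `v₀`.
      far : ∀ v → A v ≡ true → Clique (Nb v) → ∃ λ u → A u ≡ true × ¬ Lk S v u
      far v Av c with FinP.any? (λ u → (A u Data.Bool.≟ true) ×-dec ¬? (Lk? S v u))
      ... | yes w = w
      ... | no none = ⊥-elim (unlinked (uv (u₀ FinP.≟ v) (v₀ FinP.≟ v)))
        where
        near : ∀ u → A u ≡ true → Lk S v u
        near u Au = decidable-stable (Lk? S v u) (λ ¬l → none (u , Au , ¬l))
        uv : Dec (u₀ ≡ v) → Dec (v₀ ≡ v) → Lk S u₀ v₀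
        uv (yes refl) _ = near v₀ Av₀
        uv (no _) (yes refl) = Lk-sym (near u₀ Au₀)
        uv (no ne) (no ne′) = c u₀ v₀ (Nb-in Au₀ (near u₀ Au₀) ne) (Nb-in Av₀ (near v₀ Av₀) ne′)

      simplicial-boundary : ∀ v → A v ≡ true → Clique (Nb v) → D ≤ count n (Y ∩ Nb v)
      simplicial-boundary v Av c = boundary v Av c (far v Av c)

      via-simplicial : ∀ {v a x} → A v ≡ true → Nb v a ≡ true → Clique (Nb a) → Nb a x ≡ true → x ≢ v → Nb v x ≡ true
      via-simplicial {v} {a} {x} Av va ca ax ne =
        Nb-in (Nb-A ax) (ca v x (Nb-in Av (Lk-sym (Nb-Lk va)) (λ e → Nb-≢ va (sym e))) ax) ne

      -- Moves one end of an unlinked pair into `Y`. If `a` is simplicial, some non-simplicial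
      -- neighbour of `a` is unlinked from `b`; otherwise these neighbours, at least `D ≥ d` of them
      -- and forming a clique, would link `a` to `b`.
      improve : ∀ v a b → A v ≡ true → Nb v a ≡ true → Nb v b ≡ true → ¬ Lk S a b → ∃ λ a′ → Y a′ ≡ true × Nb v a′ ≡ true × ¬ Lk S a′ b
      improve v a b Av va vb unl with clique? (Nb a)
      ... | no ¬c = a , Y-in (Nb-A va) ¬c , va , unl
      ... | yes c with FinP.any? (λ x → ((Y ∩ Nb a) x Data.Bool.≟ true) ×-dec ¬? (Lk? S x b))
      ... | yes (x , h , ¬l) = x , ∧-fst h , via-simplicial Av va c (∧-snd {a = Y x} h) (λ { refl → ¬l (Nb-Lk vb) }) , ¬l
      ... | no none = ⊥-elim (unl (link-through (Y ∩ Nb a) a b (ℕP.≤-trans d≤D (simplicial-boundary a (Nb-A va) c))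
          (λ x y hx hy → c x y (∧-snd {a = Y x} hx) (∧-snd {a = Y y} hy))
          (¬true⇒false (λ h → Nb-≢ (∧-snd {a = Y a} h) refl))
          (¬true⇒false (λ h → unl (Nb-Lk (∧-snd {a = Y b} h))))
          (λ x h → Nb-Lk (∧-snd {a = Y x} h))
          (λ x h → Lk-sym (decidable-stable (Lk? S x b) (λ ¬l → none (x , h , ¬l))))))

      Y-pair : ∀ v → Y v ≡ true → ∃ λ a → ∃ λ b → (Y ∩ Nb v) a ≡ true × (Y ∩ Nb v) b ≡ true × ¬ Lk S a b
      Y-pair v Yv with non-clique (Nb v) (Y-non-clique Yv)
      ... | a , b , va , vb , unl with improve v a b (Y-A Yv) va vb unl
      ... | a′ , Ya′ , va′ , unl′ with improve v b a′ (Y-A Yv) vb va′ (unl′ ∘ Lk-sym)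
      ... | b′ , Yb′ , vb′ , unl″ = a′ , b′ , ∧-intro Ya′ va′ , ∧-intro Yb′ vb′ , unl″ ∘ Lk-sym

      -- Only a simplicial neighbour `a` needs care. Its `D` non-simplicial neighbours include `v`,
      -- and the others are neighbours of `v`. The lost `v` is replaced by some `z` outside `Nb a`,
      -- which exists because `Nb a` is a clique and `Y ∩ Nb v` is not.
      Y-degree : ∀ v → Y v ≡ true → D ≤ count n (Y ∩ Nb v)
      Y-degree v Yv with FinP.any? (λ a → (Nb v a Data.Bool.≟ true) ×-dec clique? (Nb a))
      ... | no none = ℕP.≤-trans (deg v (Y-A Yv)) (count-mono n (λ a va → ∧-intro (Y-in (Nb-A va) (λ c → none (a , va , c))) va))
      ... | yes (a , va , c) = begin
        D ≤⟨ simplicial-boundary a (Nb-A va) c ⟩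
        count n (Y ∩ Nb a) ≡⟨ count-─ (Y ∩ Nb a) v (∧-intro Yv (Nb-in (Y-A Yv) (Lk-sym (Nb-Lk va)) (λ e → Nb-≢ va (sym e)))) ⟩
        suc (count n ((Y ∩ Nb a) ─ v)) ≡⟨ cong (_+ count n ((Y ∩ Nb a) ─ v)) (sym (count-⟦⟧ n z)) ⟩
        count n ⟦ z ⟧ + count n ((Y ∩ Nb a) ─ v) ≤⟨ count-∪≥ n (Y ∩ Nb v) ⟦ z ⟧ ((Y ∩ Nb a) ─ v)
            (λ i e → subst (λ z → (Y ∩ Nb v) z ≡ true) (sym (==-elim {x = i} e)) z-in) sub
            (λ i e h → z-out (subst (λ z → Nb a z ≡ true) (==-elim {x = i} e) (in-a i h))) ⟩
        count n (Y ∩ Nb v) ∎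
        where
        open ℕP.≤-Reasoning
        in-a : ∀ i → ((Y ∩ Nb a) ─ v) i ≡ true → Nb a i ≡ true
        in-a i h = ∧-snd {a = Y i} (∧-fst {a = (Y ∩ Nb a) i} h)
        sub : ((Y ∩ Nb a) ─ v) ⊆ (Y ∩ Nb v)
        sub i h = ∧-intro (∧-fst {a = Y i} (∧-fst {a = (Y ∩ Nb a) i} h)) (via-simplicial (Y-A Yv) va c (in-a i h) (─-ne {S = Y ∩ Nb a} h))
        outsider : ∃ λ z → (Y ∩ Nb v) z ≡ true × ¬ (Nb a z ≡ true)
        outsider with Y-pair v Yv
        ... | x , y , hx , hy , unl with Nb a x Data.Bool.≟ true | Nb a y Data.Bool.≟ true
        ... | no nx | _ = x , hx , nx
        ... | yes _ | no ny = y , hy , ny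
        ... | yes ax | yes ay = ⊥-elim (unl (c x y ax ay))
        z = proj₁ outsider
        z-in = proj₁ (proj₂ outsider)
        z-out = proj₂ (proj₂ outsider)

      contradiction : ⊥
      contradiction = ℕP.<⇒≱ (ℕP.*-monoʳ-< d {{ℕ.>-nonZero 1≤d}} (ℕP.n<1+n a₀)) (begin
        d * suc a₀ ≡⟨ cong (d *_) (sym size-A) ⟩
        d * count n A ≡⟨ cong (d *_) (trans (sym (count-split n A Y)) (cong (_+ count n (A ∖ Y)) (count-cong n (λ i → bool-ext (∧-snd {a = A i}) (λ h → ∧-intro (Y-A h) h))))) ⟩
        d * (count n Y + count n (A ∖ Y)) ≡⟨ ℕP.*-distribˡ-+ d _ _ ⟩
        d * count n Y + d * count n (A ∖ Y) ≤⟨ ℕP.+-monoˡ-≤ _ Y-rank ⟩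
        r (link ↾ Y) + d * count n (A ∖ Y) ≤⟨ add-each (count n (A ∖ Y)) d ℕP.≤-refl (link ↾ Y) (link ↾ A) (A ∖ Y) refl
            (λ t h → ↾-avoids link Y (¬true⇒false (not-elim (∧-snd {a = A t} h))))
            (↾-mono link {Y} {A} (λ i → Y-A)) simplicial-star ⟩
        r (link ↾ A) ≤⟨ r-mono (λ u v h → ∧-snd {a = link u v} h) ⟩
        r (K A) ≤⟨ clique-rank-≤ a₀ A size-A ⟩
        f (suc a₀) ≤⟨ f-≤ a₀ ⟩
        d * a₀ ∎)
        where
        open ℕP.≤-Reasoning
        a₀ : ℕ
        a₀ = count n (A ─ u₀)
        size-A : count n A ≡ suc a₀
        size-A = count-─ A u₀ Au₀
        simplicial-star : ∀ t → (A ∖ Y) t ≡ true → ∃ λ N → d ≤ count n N × (∀ u → N u ≡ true → (A ∖ Y) u ≡ false × (link ↾ A) t u ≡ true)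
        simplicial-star t h = Y ∩ Nb t , ℕP.≤-trans d≤D (simplicial-boundary t At simplicial) , λ u k →
            ¬true⇒false (λ z → not-elim (∧-snd {a = A u} z) (∧-fst k)) ,
            ↾-in link A (link-in (Nb-Lk (∧-snd {a = Y u} k))) At (Nb-A (∧-snd {a = Y u} k))
          where
          At = ∧-fst h
          simplicial : Clique (Nb t)
          simplicial = decidable-stable (clique? (Nb t)) (λ ¬c → not-elim (∧-snd {a = A t} h) (Y-in At ¬c))
        Y-rank : d * count n Y ≤ r (link ↾ Y)
        Y-rank = ℕP.*-cancelˡ-≤ (2 * L) {{ℕP.m*n≢0 2 L {{_}} {{ℕ.>-nonZero L-pos}}}} (begin
          2 * L * (d * count n Y) ≡⟨ solve 3 (λ l d y → con 2 :* l :* (d :* y) := y :* (con 2 :* l :* d)) refl L d (count n Y) ⟩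
          count n Y * (2 * L * d) ≤⟨ sumOn-≥ Y (λ v → g (Y ∩ Nb v)) (2 * L * d) (λ v Yv →
              ℕP.≤-trans (Θ-final (count n (Y ∩ Nb v)) (Y-degree v Yv) (ℕP.m≤n⇒m≤1+n (count-≤-full n _)))
                (ℕP.≤-reflexive (sym (g-other (Y ∩ Nb v) (λ c → let (a , b , ha , hb , unl) = Y-pair v Yv in unl (c a b ha hb)))))) ⟩
          sumOn Y (λ v → g (Y ∩ Nb v)) ≤⟨ rank-average (count n Y) Y refl ⟩
          2 * L * r (link ↾ Y) ∎)
          where open ℕSolver.+-*-Solver

    rigid : ∀ u v → A u ≡ true → A v ≡ true → Lk S u v
    rigid u v Au Av = decidable-stable (Lk? S u v) (contradiction u v Au Av)

-- Vertex cuts and matroid separations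

Symmetric : ∀ {n} → PairSet n → Set
Symmetric S = ∀ {u v} → S u v ≡ true → S v u ≡ true

Irreflexive : ∀ {n} → PairSet n → Set
Irreflexive S = ∀ {u v} → S u v ≡ true → u ≢ v

-- The form of connectivity to which both hypotheses of the theorem are reduced; paths do not occur
-- beyond that reduction.
CutCondition : ∀ {n} → ℕ → PairSet n → Set
CutCondition {n} k S = ∀ (A B : Subset n) → (∀ x → A x ≡ true → B x ≡ true → ⊥) →
  ∀ a b → A a ≡ true → B b ≡ true → (∀ x y → A x ≡ true → B y ≡ true → S x y ≡ true → ⊥) →
  k ≤ count n (λ x → not (A x) ∧ not (B x))

missing : ∀ {n} → Subset n → ℕ
missing {n} A = count n (λ x → not (A x))

missing-─ : ∀ {n} (A : Subset n) x → missing (A ─ x) ≤ suc (missing A)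
missing-─ {n} A x = ℕP.≤-trans (count-∪≤ n _ ⟦ x ⟧ (λ y → not (A y)) lem) (ℕP.≤-reflexive (cong (_+ missing A) (count-⟦⟧ n x)))
  where
  lem : ∀ i → not ((A ─ x) i) ≡ true → ⟦ x ⟧ i ≡ true ⊎ not (A i) ≡ true
  lem i h with A i | i == x
  ... | true | true = inj₁ refl
  ... | false | _ = inj₂ refl

missing-count : ∀ {n} (A : Subset n) → count n A + missing A ≡ n
missing-count {n} A = trans (count-split n full A) (count-full n)

-- Rigidity and overlap in highly connected graphs

module Connected {n d : ℕ} (R : RigidityRank n d) (1≤d : 1 ≤ d) (S : PairSet n)
  (S-sym : Symmetric S) (S-irr : Irreflexive S) (k : ℕ) (k<n : k < n) (cut : CutCondition k S) where
  open RigidityRank R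
  open RankLemmas R

  D : ℕ
  D = d * suc d

  -- The deleted vertices and the remaining neighbours of `v` cut `v` off from its non-neighbours in
  -- `A`; if there are none, `k < n` gives the bound.
  degree : ∀ A v → A v ≡ true → k ≤ missing A + count n (S v ∩ A)
  degree A v Av with FinP.any? (λ b → ((A ─ v) ∖ S v) b Data.Bool.≟ true)
  ... | yes (b , h) = ℕP.≤-trans
      (cut ⟦ v ⟧ ((A ─ v) ∖ S v) (λ x e B → ─-ne {S = A} (∧-fst B) (==-elim {x = x} e)) v b (==-refl v) h
        (λ x y e B s → not-elim (∧-snd {a = (A ─ v) y} B) (subst (λ z → S z y ≡ true) (==-elim {x = x} e) s)))
      (count-∪≤ n _ (λ x → not (A x)) (S v ∩ A) rest)
    where
    rest : ∀ x → not (⟦ v ⟧ x) ∧ not (((A ─ v) ∖ S v) x) ≡ true → not (A x) ≡ true ⊎ (S v ∩ A) x ≡ true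
    rest x h with A x | S v x | x == v
    ... | false | _ | _ = inj₁ refl
    ... | true | true | _ = inj₂ refl
    rest x () | true | false | true
    rest x () | true | false | false
  ... | no none = ℕP.≤-pred (ℕP.≤-trans k<n (begin
      n ≡⟨ sym (missing-count A) ⟩
      count n A + missing A ≤⟨ ℕP.+-monoˡ-≤ (missing A) (ℕP.≤-trans (count-∪≤ n A ⟦ v ⟧ (S v ∩ A) cover) (ℕP.≤-reflexive (cong (_+ count n (S v ∩ A)) (count-⟦⟧ n v)))) ⟩
      suc (count n (S v ∩ A)) + missing A ≡⟨ cong suc (ℕP.+-comm (count n (S v ∩ A)) (missing A)) ⟩
      suc (missing A + count n (S v ∩ A)) ∎))
    where
    open ℕP.≤-Reasoning
    cover : ∀ x → A x ≡ true → ⟦ v ⟧ x ≡ true ⊎ (S v ∩ A) x ≡ true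
    cover x Ax with x FinP.≟ v
    ... | yes refl = inj₁ refl
    ... | no ne with S v x Data.Bool.≟ true
    ... | yes s = inj₂ (∧-intro s Ax)
    ... | no ¬s = ⊥-elim (none (x , ∧-intro (─-in {S = A} Ax ne) (not-intro ¬s)))

  -- For simplicial `v`, every link of a simplicial neighbour stays within `v` and `Nb v`. Hence `v`
  -- with these neighbours is cut off from the rest by the deleted vertices and `Y ∩ Nb v`, which
  -- bounds the latter below.
  rigid-subgraph : ∀ A → missing A + D ≤ k → ∀ u v → A u ≡ true → A v ≡ true → Lk (S ↾ A) u v
  rigid-subgraph A room = rigid deg boundary
    where
    open Core R 1≤d (S ↾ A) A hiding (D)
    cancel : ∀ {x} → k ≤ missing A + x → D ≤ x
    cancel {x} h = ℕP.+-cancelˡ-≤ (missing A) D x (ℕP.≤-trans room h)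
    deg : ∀ v → A v ≡ true → D ≤ count n (Nb v)
    deg v Av = ℕP.≤-trans (cancel (degree A v Av)) (count-mono n (λ u h →
      Nb-in (∧-snd {a = S v u} h) (Lk-in (↾-in S A (∧-fst h) Av (∧-snd {a = S v u} h))) (λ e → S-irr (∧-fst h) (sym e))))
    boundary : ∀ v → A v ≡ true → Clique (Nb v) → (∃ λ u → A u ≡ true × ¬ Lk (S ↾ A) v u) → D ≤ count n (Y ∩ Nb v)
    boundary v Av simp (u , Au , far) = cancel (ℕP.≤-trans
        (cut In Out disjoint v u (∧-intro Av (∨-inl (==-refl v)))
          (∧-intro Au (cong not (¬true⇒false (λ h → [ (λ e → far (subst (Lk _ v) (sym (==-elim {x = u} e)) (Lk-loop v))) , (λ h → far (Nb-Lk h)) ]′ (∨-elim {⟦ v ⟧ u} h))))) apart)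
        (count-∪≤ n _ (λ x → not (A x)) (Y ∩ Nb v) rest))
      where
      In Out : Subset n
      In x = A x ∧ (⟦ v ⟧ x ∨ Nb v x ∧ not (Y x))
      Out x = A x ∧ not (⟦ v ⟧ x ∨ Nb v x)
      disjoint : ∀ x → In x ≡ true → Out x ≡ true → ⊥
      disjoint x i o = not-elim (∧-snd {a = A x} o) ([ ∨-inl , (λ h → ∨-inr {⟦ v ⟧ x} (∧-fst h)) ]′ (∨-elim {⟦ v ⟧ x} (∧-snd {a = A x} i)))
      apart : ∀ x y → In x ≡ true → Out y ≡ true → S x y ≡ true → ⊥
      apart x y i o s = not-elim (∧-snd {a = A y} o) (∨-inr {⟦ v ⟧ y} (Nb-in Ay (lk (∨-elim {⟦ v ⟧ x} (∧-snd {a = A x} i))) y≢v))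
        where
        Ax = ∧-fst i
        Ay = ∧-fst o
        y≢v : y ≢ v
        y≢v refl = not-elim (∧-snd {a = A y} o) (∨-inl (==-refl y))
        xy : Lk (S ↾ A) x y
        xy = Lk-in (↾-in S A s Ax Ay)
        lk : ⟦ v ⟧ x ≡ true ⊎ Nb v x ∧ not (Y x) ≡ true → Lk (S ↾ A) v y
        lk (inj₁ e) = subst (λ z → Lk (S ↾ A) z y) (==-elim {x = x} e) xy
        lk (inj₂ h) = decidable-stable (clique? (Nb x)) (λ ¬c → not-elim (∧-snd {a = Nb v x} h) (Y-in Ax ¬c)) v y
          (Nb-in Av (Lk-sym (Nb-Lk (∧-fst h))) (λ e → Nb-≢ (∧-fst h) (sym e)))
          (Nb-in Ay xy (λ e → S-irr s (sym e)))
      rest : ∀ x → not (In x) ∧ not (Out x) ≡ true → not (A x) ≡ true ⊎ (Y ∩ Nb v) x ≡ true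
      rest x h = lem (A x) (⟦ v ⟧ x) (Nb v x) (Y x) h
        where
        lem : ∀ a e b y → not (a ∧ (e ∨ b ∧ not y)) ∧ not (a ∧ not (e ∨ b)) ≡ true → not a ≡ true ⊎ y ∧ b ≡ true
        lem false e b y h = inj₁ refl
        lem true true b y ()
        lem true false false y ()
        lem true false true true h = inj₂ refl
        lem true false true false ()

  rigid-rank : ∀ A → missing A + D ≤ k → ∀ v → A v ≡ true → r (S ↾ A) ≡ f (count n A)
  rigid-rank A room v Av = ℕP.≤-antisym
    (ℕP.≤-trans (r-mono (λ x y h → ∧-snd {a = S x y} h))
      (subst (λ t → r (K A) ≤ f t) (sym (count-─ A v Av)) (clique-rank-≤ _ A (count-─ A v Av))))
    (ℕP.≤-trans (clique-rank-≥ A (K A) (λ x y → ∧-intro))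
      (r-span (λ x y h → rigid-subgraph A room x y (∧-fst h) (∧-snd {a = A x} h))))

  -- What remains is still rigid, so its rank is that of a clique, and one more vertex adds at most
  -- `d` to a clique rank.
  rank-drop : ∀ A x → A x ≡ true → suc (missing A) + D ≤ k → r (S ↾ A) ≤ r (S ↾ (A ─ x)) + d
  rank-drop A x Ax room = begin
    r (S ↾ A) ≤⟨ r-mono (λ u v h → ∧-snd {a = S u v} h) ⟩
    r (K A) ≤⟨ clique-rank-≤ _ A (count-─ A x Ax) ⟩
    f (count n (A ─ x)) + d ⊓ count n (A ─ x) ≤⟨ ℕP.+-mono-≤ (clique-rank-≥ (A ─ x) (K (A ─ x)) (λ u v → ∧-intro)) (ℕP.m⊓n≤m d _) ⟩
    r (K (A ─ x)) + d ≤⟨ ℕP.+-monoˡ-≤ d (r-span (λ u v h → rigid-subgraph (A ─ x) (ℕP.≤-trans (ℕP.+-monoˡ-≤ D (missing-─ A x)) room) u v (∧-fst h) (∧-snd {a = (A ─ x) u} h))) ⟩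
    r (S ↾ (A ─ x)) + d ∎
    where open ℕP.≤-Reasoning

  -- The deletion budget: beyond the vertices already missing, `j` more may go while the graph stays
  -- `D`-connected.
  Room : Subset n → ℕ → Set
  Room A j = missing A + (j + D) ≤ k

  room-step : ∀ {A j} x → Room A (suc j) → Room (A ─ x) j
  room-step {A} {j} x h = ℕP.≤-trans (ℕP.+-monoˡ-≤ (j + D) (missing-─ A x)) (ℕP.≤-trans (ℕP.≤-reflexive (sym (ℕP.+-suc (missing A) (j + D)))) h)

  room-drop : ∀ {A j} → Room A (suc j) → suc (missing A) + D ≤ k
  room-drop {A} {j} h = ℕP.≤-trans (ℕP.≤-trans (ℕP.≤-reflexive (sym (ℕP.+-suc (missing A) D))) (ℕP.+-monoʳ-≤ (missing A) (s≤s (ℕP.m≤n+m D j)))) h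

  2d≤D : d + d ≤ D
  2d≤D = ℕP.≤-trans (ℕP.+-monoʳ-≤ d (ℕP.m≤m*n d d {{ℕ.>-nonZero 1≤d}})) (ℕP.≤-reflexive (sym (ℕP.*-suc d d)))

  module Cover (E₁ E₂ : PairSet n) (sym₁ : Symmetric E₁) (sym₂ : Symmetric E₂) (sub₁ : E₁ ⊑ S) (sub₂ : E₂ ⊑ S)
    (cover : ∀ {u v} → S u v ≡ true → E₁ u v ≡ true ⊎ E₂ u v ≡ true) where

    ρ ρ₁ ρ₂ : Subset n → ℕ
    ρ A = r (S ↾ A)
    ρ₁ A = r (E₁ ↾ A)
    ρ₂ A = r (E₂ ↾ A)

    d₁ d₂ : Subset n → Fin n → ℕ
    d₁ A v = count n (E₁ v ∩ A)
    d₂ A v = count n (E₂ v ∩ A)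

    subadditive : ∀ A → ρ A ≤ ρ₁ A + ρ₂ A
    subadditive A = ℕP.≤-trans (r-mono (λ u v h → [ (λ e → ∨-inl (↾-in E₁ A e (↾-fst S A h) (↾-snd S A h))) ,
      (λ e → ∨-inr {(E₁ ↾ A) u v} (↾-in E₂ A e (↾-fst S A h) (↾-snd S A h))) ]′ (cover (↾-set S A h)))) (r-∪ _ _)

    degree-sum : ∀ A j v → A v ≡ true → Room A j → j + D ≤ d₁ A v + d₂ A v
    degree-sum A j v Av room = ℕP.≤-trans
      (ℕP.+-cancelˡ-≤ (missing A) (j + D) (count n (S v ∩ A)) (ℕP.≤-trans room (degree A v Av)))
      (count-∪≤ n _ _ _ (λ i h → [ (λ e → inj₁ (∧-intro e (∧-snd {a = S v i} h))) , (λ e → inj₂ (∧-intro e (∧-snd {a = S v i} h))) ]′ (cover (∧-fst h))))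

    drop : ∀ (E : PairSet n) → E ⊑ S → ∀ A x b → A x ≡ true → b ≤ d → b ≤ count n (E x ∩ A) → r (E ↾ (A ─ x)) + b ≤ r (E ↾ A)
    drop E sub A x b Ax b≤d b≤N = gain₀ (E x ∩ A) (↾-avoids E (A ─ x) (─-self {S = A} {x})) (↾-mono E {A ─ x} {A} (λ y → ∧-fst))
      (¬true⇒false (λ h → S-irr (sub x x (∧-fst h)) refl)) (λ u h → ↾-in E A (∧-fst h) Ax (∧-snd {a = E x u} h)) b b≤d b≤N

    degree-mono : ∀ (E : PairSet n) A x v → count n (E v ∩ (A ─ x)) ≤ count n (E v ∩ A)
    degree-mono E A x v = count-mono n (λ u h → ∧-intro (∧-fst {a = E v u} h) (∧-fst {a = A u} (∧-snd {a = E v u} h)))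

    -- When the deleted vertex is put back, the parts regain at least `d + 1` together and the whole
    -- at most `d`, so the overlap grows by one.
    advance : ∀ j A A′ b c → j + ρ A′ ≤ ρ₁ A′ + ρ₂ A′ → ρ A ≤ ρ A′ + d → suc d ≤ b + c → ρ₁ A′ + b ≤ ρ₁ A → ρ₂ A′ + c ≤ ρ₂ A →
      suc j + ρ A ≤ ρ₁ A + ρ₂ A
    advance j A A′ b c ih ha hbc hx hy = begin
      suc j + ρ A ≤⟨ ℕP.+-monoʳ-≤ (suc j) ha ⟩
      suc j + (ρ A′ + d) ≡⟨ solve 3 (λ j a d → con 1 :+ j :+ (a :+ d) := (j :+ a) :+ (con 1 :+ d)) refl j (ρ A′) d ⟩
      (j + ρ A′) + suc d ≤⟨ ℕP.+-mono-≤ ih hbc ⟩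
      (ρ₁ A′ + ρ₂ A′) + (b + c) ≡⟨ solve 4 (λ x y b c → (x :+ y) :+ (b :+ c) := (x :+ b) :+ (y :+ c)) refl (ρ₁ A′) (ρ₂ A′) b c ⟩
      (ρ₁ A′ + b) + (ρ₂ A′ + c) ≤⟨ ℕP.+-mono-≤ hx hy ⟩
      ρ₁ A + ρ₂ A ∎
      where
      open ℕP.≤-Reasoning
      open ℕSolver.+-*-Solver

    two-drops : ∀ b c → 1 ≤ b → 1 ≤ c → suc d ≤ b + c → suc d ≤ d ⊓ b + d ⊓ c
    two-drops b c 1≤b 1≤c h with d ℕP.≤? b | d ℕP.≤? c
    ... | yes db | _ = ℕP.≤-trans (ℕP.≤-reflexive (ℕP.+-comm 1 d)) (ℕP.+-mono-≤ (ℕP.≤-reflexive (sym (ℕP.m≤n⇒m⊓n≡m db))) (ℕP.⊓-glb 1≤d 1≤c))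
    ... | no _ | yes dc = ℕP.+-mono-≤ (ℕP.⊓-glb 1≤d 1≤b) (ℕP.≤-reflexive (sym (ℕP.m≤n⇒m⊓n≡m dc)))
    ... | no nb | no nc = ℕP.≤-trans h (ℕP.≤-reflexive (sym (cong₂ _+_ (ℕP.m≥n⇒m⊓n≡n (ℕP.<⇒≤ (ℕP.≰⇒> nb))) (ℕP.m≥n⇒m⊓n≡n (ℕP.<⇒≤ (ℕP.≰⇒> nc))))))

    -- With one deletion to spare the degree is at least `D + 1 ≥ 2 d + 1`, so fewer than `d` edges
    -- in one part leave more than `d + 1` in the other.
    heavy : ∀ A j v → A v ≡ true → Room A (suc j) → ∀ {b c} → b + c ≡ d₁ A v + d₂ A v → c < d → suc d < b
    heavy A j v Av room {b} {c} eq c<d = ℕP.≰⇒> (λ le → ℕP.<⇒≱ c<d (ℕP.+-cancelˡ-≤ (suc d) d c (begin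
        suc d + d ≤⟨ s≤s 2d≤D ⟩
        suc D ≤⟨ s≤s (ℕP.m≤n+m D j) ⟩
        suc j + D ≤⟨ degree-sum A (suc j) v Av room ⟩
        d₁ A v + d₂ A v ≡⟨ sym eq ⟩
        b + c ≤⟨ ℕP.+-monoˡ-≤ c le ⟩
        suc d + c ∎)))
      where open ℕP.≤-Reasoning

    -- Every vertex is sparse in `E₂`, hence gains at least `d` from `E₁`. Vertices meeting `E₂` are
    -- deleted; if they run out, `E₁` is everything, and a spanning `E₁` stays spanning as vertices
    -- return.
    light : ∀ j A → Room A j → (∀ v → A v ≡ true → d₂ A v < d) → (j + ρ A ≤ ρ₁ A + ρ₂ A) ⊎ ρ A ≤ ρ₁ A
    light zero A room sparse = inj₁ (subadditive A)
    light (suc j) A room sparse with FinP.any? (λ x → (A x Data.Bool.≟ true) ×-dec (1 ℕP.≤? d₂ A x))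
    ... | no none = inj₂ (r-mono (λ u v h → [ (λ e → ↾-in E₁ A e (↾-fst S A h) (↾-snd S A h)) ,
        (λ e → ⊥-elim (none (u , ↾-fst S A h , count-in n _ v (∧-intro e (↾-snd S A h))))) ]′ (cover (↾-set S A h))))
    ... | yes (x , Ax , pos) = step′ (light j (A ─ x) (room-step {A} x room) (λ v h → ℕP.≤-<-trans (degree-mono E₂ A x v) (sparse v (∧-fst h))))
      where
      drop₁ : ρ₁ (A ─ x) + d ≤ ρ₁ A
      drop₁ = drop E₁ sub₁ A x d Ax ℕP.≤-refl (ℕP.<⇒≤ (ℕP.<-trans (ℕP.n<1+n d) (heavy A j x Ax room refl (sparse x Ax))))
      down = rank-drop A x Ax (room-drop {A} {j} room)
      step′ : (j + ρ (A ─ x) ≤ ρ₁ (A ─ x) + ρ₂ (A ─ x)) ⊎ ρ (A ─ x) ≤ ρ₁ (A ─ x) → (suc j + ρ A ≤ ρ₁ A + ρ₂ A) ⊎ ρ A ≤ ρ₁ A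
      step′ (inj₁ ih) = inj₁ (advance j A (A ─ x) d 1 ih down (ℕP.≤-reflexive (ℕP.+-comm 1 d)) drop₁ (drop E₂ sub₂ A x 1 Ax 1≤d pos))
      step′ (inj₂ ih) = inj₂ (ℕP.≤-trans down (ℕP.≤-trans (ℕP.+-monoˡ-≤ d ih) drop₁))

    -- The two sparse vertices are never deleted, so the situation persists. If no other vertex met
    -- both parts, they and the deleted vertices would separate an `E₁`-neighbour of `v₁` from an
    -- `E₂`-neighbour of `v₂`, a cut of fewer than `k` vertices.
    balanced : ∀ j A v₁ v₂ → Room A j → A v₁ ≡ true → A v₂ ≡ true → d₂ A v₁ < d → d₁ A v₂ < d → j + ρ A ≤ ρ₁ A + ρ₂ A
    balanced zero A v₁ v₂ room Av₁ Av₂ l₁ l₂ = subadditive A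
    balanced (suc j) A v₁ v₂ room Av₁ Av₂ l₁ l₂ with FinP.any? (λ x → ((A ─ v₁ ─ v₂) x Data.Bool.≟ true) ×-dec ((1 ℕP.≤? d₁ A x) ×-dec (1 ℕP.≤? d₂ A x)))
    ... | yes (x , h , p₁ , p₂) = advance j A (A ─ x) (d ⊓ d₁ A x) (d ⊓ d₂ A x)
        (balanced j (A ─ x) v₁ v₂ (room-step {A} x room) (─-in {S = A} Av₁ (λ e → ─-ne {S = A} (∧-fst {a = (A ─ v₁) x} h) (sym e)))
          (─-in {S = A} Av₂ (λ e → ─-ne {S = A ─ v₁} h (sym e)))
          (ℕP.≤-<-trans (degree-mono E₂ A x v₁) l₁) (ℕP.≤-<-trans (degree-mono E₁ A x v₂) l₂))
        (rank-drop A x Ax (room-drop {A} {j} room))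
        (two-drops (d₁ A x) (d₂ A x) p₁ p₂ (ℕP.≤-trans (s≤s (ℕP.≤-trans (ℕP.≤-trans (ℕP.m≤m+n d d) 2d≤D) (ℕP.m≤n+m D j))) (degree-sum A (suc j) x Ax room)))
        (drop E₁ sub₁ A x _ Ax (ℕP.m⊓n≤m d _) (ℕP.m⊓n≤n d _)) (drop E₂ sub₂ A x _ Ax (ℕP.m⊓n≤m d _) (ℕP.m⊓n≤n d _))
      where
      Ax : A x ≡ true
      Ax = ∧-fst (∧-fst {a = (A ─ v₁) x} h)
    ... | no none = ⊥-elim (ℕP.<⇒≱ (ℕP.≤-trans three room) (ℕP.≤-trans
        (cut B₁ B₂ disjoint x₁ x₂ B₁x₁ B₂x₂ apart) few))
      where
      open ℕP.≤-Reasoning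
      A′ = A ─ v₁ ─ v₂
      A′-A : ∀ {x} → A′ x ≡ true → A x ≡ true
      A′-A {x} h = ∧-fst (∧-fst {a = (A ─ v₁) x} h)
      B₁ B₂ : Subset n
      B₁ x = A′ x ∧ does (d₂ A x ℕP.≟ 0)
      B₂ x = A′ x ∧ does (d₁ A x ℕP.≟ 0)
      B₁-out : ∀ {x} → B₁ x ≡ true → d₂ A x ≡ 0
      B₁-out {x} h = does-elim (d₂ A x ℕP.≟ 0) (∧-snd {a = A′ x} h)
      B₂-out : ∀ {x} → B₂ x ≡ true → d₁ A x ≡ 0
      B₂-out {x} h = does-elim (d₁ A x ℕP.≟ 0) (∧-snd {a = A′ x} h)
      none₁ : ∀ x → A′ x ≡ true → 1 ≤ d₁ A x → B₁ x ≡ true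
      none₁ x h p = ∧-intro h (dec-true (d₂ A x ℕP.≟ 0) (ℕP.n<1⇒n≡0 (ℕP.≰⇒> (λ q → none (x , h , p , q)))))
      none₂ : ∀ x → A′ x ≡ true → 1 ≤ d₂ A x → B₂ x ≡ true
      none₂ x h p = ∧-intro h (dec-true (d₁ A x ℕP.≟ 0) (ℕP.n<1⇒n≡0 (ℕP.≰⇒> (λ q → none (x , h , q , p)))))
      disjoint : ∀ x → B₁ x ≡ true → B₂ x ≡ true → ⊥
      disjoint x b₁ b₂ = ℕP.<⇒≱ {0} (s≤s z≤n) (ℕP.≤-trans (degree-sum A (suc j) x (A′-A (∧-fst b₁)) room) (ℕP.≤-reflexive (cong₂ _+_ (B₂-out b₂) (B₁-out b₁))))
      apart : ∀ x y → B₁ x ≡ true → B₂ y ≡ true → S x y ≡ true → ⊥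
      apart x y b₁ b₂ s with cover s
      ... | inj₁ e = ℕP.<⇒≢ (count-in n (E₁ y ∩ A) x (∧-intro (sym₁ e) (A′-A (∧-fst b₁)))) (sym (B₂-out b₂))
      ... | inj₂ e = ℕP.<⇒≢ (count-in n (E₂ x ∩ A) y (∧-intro e (A′-A (∧-fst b₂)))) (sym (B₁-out b₁))
      neighbour : ∀ (E : PairSet n) → E ⊑ S → ∀ v w → suc d < count n (E v ∩ A) → ∃ λ x → E v x ≡ true × A x ≡ true × x ≢ v × x ≢ w
      neighbour E sub v w big with count-pos n ((E v ∩ A) ─ w) (ℕP.≤-pred (ℕP.≤-trans (s≤s 1≤d) (ℕP.≤-trans (ℕP.<⇒≤ big) (count-─≥ (E v ∩ A) w))))
      ... | x , h = x , ∧-fst (∧-fst {a = (E v ∩ A) x} h) , ∧-snd {a = E v x} (∧-fst {a = (E v ∩ A) x} h) ,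
          (λ e → S-irr (sub v x (∧-fst (∧-fst {a = (E v ∩ A) x} h))) (sym e)) , ─-ne {S = E v ∩ A} h
      n₁ = neighbour E₁ sub₁ v₁ v₂ (heavy A j v₁ Av₁ room refl l₁)
      x₁ = proj₁ n₁
      B₁x₁ : B₁ x₁ ≡ true
      B₁x₁ = let (_ , e , a , ne , ne′) = n₁ in
        none₁ x₁ (─-in {S = A ─ v₁} (─-in {S = A} a ne) ne′) (count-in n (E₁ x₁ ∩ A) v₁ (∧-intro (sym₁ e) Av₁))
      n₂ = neighbour E₂ sub₂ v₂ v₁ (heavy A j v₂ Av₂ room (ℕP.+-comm (d₂ A v₂) (d₁ A v₂)) l₂)
      x₂ = proj₁ n₂
      B₂x₂ : B₂ x₂ ≡ true
      B₂x₂ = let (_ , e , a , ne , ne′) = n₂ in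
        none₂ x₂ (─-in {S = A ─ v₁} (─-in {S = A} a ne′) ne) (count-in n (E₂ x₂ ∩ A) v₂ (∧-intro (sym₂ e) Av₂))
      three : suc (missing A + 2) ≤ missing A + (suc j + D)
      three = begin
        suc (missing A + 2) ≡⟨ sym (ℕP.+-suc (missing A) 2) ⟩
        missing A + 3 ≤⟨ ℕP.+-monoʳ-≤ (missing A) (s≤s (ℕP.≤-trans (ℕP.≤-trans (ℕP.+-mono-≤ 1≤d 1≤d) 2d≤D) (ℕP.m≤n+m D j))) ⟩
        missing A + (suc j + D) ∎
      few : count n (λ x → not (B₁ x) ∧ not (B₂ x)) ≤ missing A + 2
      few = begin
        count n (λ x → not (B₁ x) ∧ not (B₂ x)) ≤⟨ count-∪≤ n _ (λ x → not (A x)) (⟦ v₁ ⟧ ⊔ ⟦ v₂ ⟧) rest ⟩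
        missing A + count n (⟦ v₁ ⟧ ⊔ ⟦ v₂ ⟧) ≤⟨ ℕP.+-monoʳ-≤ (missing A) (ℕP.≤-trans (count-∪≤ n _ ⟦ v₁ ⟧ ⟦ v₂ ⟧ (λ i → ∨-elim {⟦ v₁ ⟧ i}))
            (ℕP.≤-reflexive (cong₂ _+_ (count-⟦⟧ n v₁) (count-⟦⟧ n v₂)))) ⟩
        missing A + 2 ∎
        where
        rest : ∀ x → not (B₁ x) ∧ not (B₂ x) ≡ true → not (A x) ≡ true ⊎ (⟦ v₁ ⟧ ⊔ ⟦ v₂ ⟧) x ≡ true
        rest x h = go (A x Data.Bool.≟ true) (x FinP.≟ v₁) (x FinP.≟ v₂)
          where
          go : Dec (A x ≡ true) → Dec (x ≡ v₁) → Dec (x ≡ v₂) → not (A x) ≡ true ⊎ (⟦ v₁ ⟧ ⊔ ⟦ v₂ ⟧) x ≡ true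
          go (no ¬a) _ _ = inj₁ (not-intro ¬a)
          go (yes a) (yes e) _ = inj₂ (∨-inl (dec-true (x FinP.≟ v₁) e))
          go (yes a) (no _) (yes e) = inj₂ (∨-inr {⟦ v₁ ⟧ x} (dec-true (x FinP.≟ v₂) e))
          go (yes a) (no ne) (no ne′) with 1 ℕP.≤? d₁ A x
          ... | yes p = ⊥-elim (not-elim (∧-fst h) (none₁ x (─-in {S = A ─ v₁} (─-in {S = A} a ne) ne′) p))
          ... | no ¬p = ⊥-elim (not-elim (∧-snd {a = not (B₁ x)} h) (∧-intro (─-in {S = A ─ v₁} (─-in {S = A} a ne) ne′) (dec-true (d₁ A x ℕP.≟ 0) (ℕP.n<1⇒n≡0 (ℕP.≰⇒> ¬p)))))

  -- Deleting a vertex that meets both parts lowers r₁ + r₂ − r by at least one.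
  connectivity : ∀ j A E₁ E₂ → Symmetric E₁ → Symmetric E₂ → E₁ ⊑ S → E₂ ⊑ S → (∀ {u v} → S u v ≡ true → E₁ u v ≡ true ⊎ E₂ u v ≡ true) →
    Room A j → (j + r (S ↾ A) ≤ r (E₁ ↾ A) + r (E₂ ↾ A)) ⊎ (r (S ↾ A) ≤ r (E₁ ↾ A) ⊎ r (S ↾ A) ≤ r (E₂ ↾ A))
  connectivity j A E₁ E₂ sym₁ sym₂ sub₁ sub₂ cover = go j A
    where
    open Cover E₁ E₂ sym₁ sym₂ sub₁ sub₂ cover
    module Swap = Cover E₂ E₁ sym₂ sym₁ sub₂ sub₁ ([ inj₂ , inj₁ ]′ ∘ cover)
    Result : ℕ → Subset n → Set
    Result j A = (j + ρ A ≤ ρ₁ A + ρ₂ A) ⊎ (ρ A ≤ ρ₁ A ⊎ ρ A ≤ ρ₂ A)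
    go : ∀ j A → Room A j → Result j A
    go zero A room = inj₁ (subadditive A)
    -- Vertices with `d` edges in both parts go first. Putting one back raises both parts by at
    -- least `d` and the whole by at most `d`, so each of the three outcomes persists.
    go (suc j) A room with FinP.any? (λ x → (A x Data.Bool.≟ true) ×-dec ((d ℕP.≤? d₁ A x) ×-dec (d ℕP.≤? d₂ A x)))
    ... | yes (x , Ax , h₁ , h₂) = up (go j (A ─ x) (room-step {A} x room))
      where
      down = rank-drop A x Ax (room-drop {A} {j} room)
      drop₁ = drop E₁ sub₁ A x d Ax ℕP.≤-refl h₁
      drop₂ = drop E₂ sub₂ A x d Ax ℕP.≤-refl h₂
      up : Result j (A ─ x) → Result (suc j) A
      up (inj₁ ih) = inj₁ (advance j A (A ─ x) d d ih down (ℕP.+-monoˡ-≤ d 1≤d) drop₁ drop₂)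
      up (inj₂ (inj₁ ih)) = inj₂ (inj₁ (ℕP.≤-trans down (ℕP.≤-trans (ℕP.+-monoˡ-≤ d ih) drop₁)))
      up (inj₂ (inj₂ ih)) = inj₂ (inj₂ (ℕP.≤-trans down (ℕP.≤-trans (ℕP.+-monoˡ-≤ d ih) drop₂)))
    -- Now each vertex is light in some part: either both kinds of lightness occur, or one part is
    -- sparse throughout.
    ... | no none with FinP.any? (λ x → (A x Data.Bool.≟ true) ×-dec (d₂ A x ℕP.<? d)) | FinP.any? (λ x → (A x Data.Bool.≟ true) ×-dec (d₁ A x ℕP.<? d))
    ... | yes (v₁ , Av₁ , l₁) | yes (v₂ , Av₂ , l₂) = inj₁ (balanced (suc j) A v₁ v₂ room Av₁ Av₂ l₁ l₂)
    ... | no ¬l₁ | _ = [ (λ h → inj₁ (ℕP.≤-trans h (ℕP.≤-reflexive (ℕP.+-comm (ρ₂ A) (ρ₁ A))))) , (λ h → inj₂ (inj₂ h)) ]′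
        (Swap.light (suc j) A room (λ v Av → ℕP.≰⇒> (λ le → none (v , Av , le , ℕP.≮⇒≥ (λ l → ¬l₁ (v , Av , l))))))
    ... | yes _ | no ¬l₂ = [ inj₁ , (λ h → inj₂ (inj₁ h)) ]′
        (light (suc j) A room (λ v Av → ℕP.≰⇒> (λ le → none (v , Av , ℕP.≮⇒≥ (λ l → ¬l₂ (v , Av , l)) , le))))

_⋂_ _⧵_ : ∀ {n} → PairSet n → PairSet n → PairSet n
(F ⋂ P) u v = F u v ∧ P u v
(F ⧵ P) u v = F u v ∧ not (P u v)

-- Graphs whose matroid has no thin separation

module Separations {n d : ℕ} (R : RigidityRank n d) (1≤d : 1 ≤ d) (F : PairSet n)
  (F-sym : Symmetric F) (F-irr : Irreflexive F) where
  open RigidityRank R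
  open RankLemmas R

  -- With r₁ = r (F ⋂ P) and r₂ = r (F ⧵ P): the connectivity r₁ + r₂ − r of the
  -- partition is at least κ, r₂ or r₁.
  NonSeparable : ℕ → Set
  NonSeparable κ = ∀ P → Symmetric P → κ + r F ≤ r (F ⋂ P) + r (F ⧵ P) ⊎ (r F ≤ r (F ⋂ P) ⊎ r F ≤ r (F ⧵ P))

  ⧵-split : ∀ P {u v} → F u v ≡ true → (F ⋂ P) u v ≡ true ⊎ (F ⧵ P) u v ≡ true
  ⧵-split P {u} {v} h with P u v
  ... | true = inj₁ (∧-intro h refl)
  ... | false = inj₂ (∧-intro h refl)

  -- Split off the star of `w`: its rank is at most the degree, and the rest loses at least
  -- `d ⊓ deg`. Overlap `κ` forces `κ + d ⊓ deg ≤ deg`, hence `deg ≥ κ + d`; a spanning star has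
  -- degree at least `r F`; the rest cannot span.
  degree-≥ : ∀ κ t → 1 ≤ κ → NonSeparable κ → t ≤ κ + d → t ≤ r F → ∀ w u → F w u ≡ true → t ≤ count n (F w)
  degree-≥ κ t 1≤κ sep t≤ t≤r w u Fwu = go (sep P (λ {a} {b} h → [ (λ e → ∨-inr {a = b == w} e) , ∨-inl ]′ (∨-elim {a == w} h)))
    where
    open ℕP.≤-Reasoning
    P : PairSet n
    P a b = (a == w) ∨ (b == w)
    deg = count n (F w)
    1≤deg : 1 ≤ deg
    1≤deg = count-in n (F w) u Fwu
    r₁≤deg : r (F ⋂ P) ≤ deg
    r₁≤deg = ℕP.≤-trans (r-span {S = star w (F w)} λ a b h → [
        (λ e → Lk-in (∧-intro e (subst (λ z → F z b ≡ true) (==-elim {x = a} e) (∧-fst h)))) ,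
        (λ e → Lk-sym (Lk-in (∧-intro e (F-sym (subst (λ z → F a z ≡ true) (==-elim {x = b} e) (∧-fst h)))))) ]′ (∨-elim {a == w} (∧-snd {a = F a b} h)))
      (r-star w (F w))
    r₂+ : r (F ⧵ P) + d ⊓ deg ≤ r F
    r₂+ = gain₀ (F w) (λ a → ¬true⇒false (λ h → not-elim (∧-snd {a = F a w} h) (∨-inr {a == w} (==-refl w))) ,
          ¬true⇒false (λ h → not-elim (∧-snd {a = F w a} h) (∨-inl (==-refl w))))
        (λ a b h → ∧-fst h) (¬true⇒false (λ h → F-irr h refl)) (λ a h → h) (d ⊓ deg) (ℕP.m⊓n≤m d deg) (ℕP.m⊓n≤n d deg)
    go : κ + r F ≤ r (F ⋂ P) + r (F ⧵ P) ⊎ (r F ≤ r (F ⋂ P) ⊎ r F ≤ r (F ⧵ P)) → t ≤ deg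
    go (inj₂ (inj₁ h)) = ℕP.≤-trans t≤r (ℕP.≤-trans h r₁≤deg)
    go (inj₂ (inj₂ h)) = ⊥-elim (ℕP.<⇒≱ (ℕP.⊓-glb 1≤d 1≤deg) (ℕP.+-cancelˡ-≤ (r (F ⧵ P)) _ 0 (ℕP.≤-trans r₂+ (ℕP.≤-trans h (ℕP.≤-reflexive (sym (ℕP.+-identityʳ _)))))))
    go (inj₁ h) with d ℕP.≤? deg
    ... | yes le = ℕP.≤-trans t≤ (subst (λ z → κ + z ≤ deg) (ℕP.m≤n⇒m⊓n≡m le) κ+≤)
      where
      κ+≤ : κ + d ⊓ deg ≤ deg
      κ+≤ = ℕP.+-cancelʳ-≤ (r (F ⧵ P)) (κ + d ⊓ deg) deg (begin
        κ + d ⊓ deg + r (F ⧵ P) ≡⟨ trans (ℕP.+-assoc κ _ _) (cong (κ +_) (ℕP.+-comm (d ⊓ deg) _)) ⟩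
        κ + (r (F ⧵ P) + d ⊓ deg) ≤⟨ ℕP.+-monoʳ-≤ κ r₂+ ⟩
        κ + r F ≤⟨ h ⟩
        r (F ⋂ P) + r (F ⧵ P) ≤⟨ ℕP.+-monoˡ-≤ _ r₁≤deg ⟩
        deg + r (F ⧵ P) ∎)
    ... | no ¬le = ⊥-elim (ℕP.<⇒≱ 1≤κ (ℕP.+-cancelʳ-≤ (deg + r (F ⧵ P)) κ 0 (begin
        κ + (deg + r (F ⧵ P)) ≡⟨ cong (κ +_) (ℕP.+-comm deg _) ⟩
        κ + (r (F ⧵ P) + deg) ≡⟨ cong (λ z → κ + (r (F ⧵ P) + z)) (sym (ℕP.m≥n⇒m⊓n≡n (ℕP.<⇒≤ (ℕP.≰⇒> ¬le)))) ⟩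
        κ + (r (F ⧵ P) + d ⊓ deg) ≤⟨ ℕP.+-monoʳ-≤ κ r₂+ ⟩
        κ + r F ≤⟨ h ⟩
        r (F ⋂ P) + r (F ⧵ P) ≤⟨ ℕP.+-monoˡ-≤ _ r₁≤deg ⟩
        deg + r (F ⧵ P) ∎)))

  -- If one part spans, the overlap is at least the rank of the other, which is at least `t ≥ κ`; so
  -- all three alternatives give the same bound.
  overlap-≥ : ∀ κ t P s → NonSeparable κ → Symmetric P → κ ≤ t → r (F ⋂ P) + r (F ⧵ P) ≤ r F + s →
    t ≤ r (F ⋂ P) → t ≤ r (F ⧵ P) → κ ≤ s
  overlap-≥ κ t P s sep P-sym κ≤t small big₁ big₂ = go (sep P P-sym)
    where
    r₁ = r (F ⋂ P)
    r₂ = r (F ⧵ P)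
    go : κ + r F ≤ r₁ + r₂ ⊎ (r F ≤ r₁ ⊎ r F ≤ r₂) → κ ≤ s
    go (inj₁ h) = ℕP.+-cancelʳ-≤ (r F) κ s (ℕP.≤-trans h (ℕP.≤-trans small (ℕP.≤-reflexive (ℕP.+-comm (r F) s))))
    go (inj₂ (inj₁ h)) = ℕP.≤-trans κ≤t (ℕP.≤-trans big₂ (ℕP.+-cancelˡ-≤ r₁ r₂ s (ℕP.≤-trans small (ℕP.+-monoˡ-≤ s h))))
    go (inj₂ (inj₂ h)) = ℕP.≤-trans κ≤t (ℕP.≤-trans big₁ (ℕP.+-cancelʳ-≤ r₂ r₁ s (ℕP.≤-trans small (ℕP.≤-trans (ℕP.+-monoˡ-≤ s h) (ℕP.≤-reflexive (ℕP.+-comm r₂ s))))))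

  active? : ∀ v → Dec (∃ λ u → F v u ≡ true)
  active? v = FinP.any? (λ u → F v u Data.Bool.≟ true)

  opaque
    -- `F` will be the image of a vertex-deleted subgraph, in which vertices of the ambient graph
    -- may be isolated.
    active : Subset n
    active v = does (active? v)

    active-in : ∀ {v u} → F v u ≡ true → active v ≡ true
    active-in {v} {u} h = dec-true (active? v) (u , h)

    active-out : ∀ {v} → active v ≡ true → ∃ λ u → F v u ≡ true
    active-out {v} = does-elim (active? v)

  module _ (κ : ℕ) (κ-eq : suc κ ≡ d * (d * suc d)) (sep : NonSeparable κ) (big : κ + d ≤ r F) where
    open Core R 1≤d F active

    1≤κ : 1 ≤ κ
    1≤κ = ℕP.≤-pred (subst (2 ≤_) (sym κ-eq) (ℕP.*-mono-≤ {1} {d} {2} 1≤d (ℕP.*-mono-≤ {1} {d} {2} 1≤d (s≤s 1≤d))))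

    D≤κ+d : D ≤ κ + d
    D≤κ+d = ℕP.≤-trans (ℕP.m≤n*m D d {{ℕ.>-nonZero 1≤d}}) (ℕP.≤-trans (ℕP.≤-reflexive (trans (sym κ-eq) (ℕP.+-comm 1 κ))) (ℕP.+-monoʳ-≤ κ 1≤d))

    star-size : ∀ v → active v ≡ true → κ + d ≤ count n (F v)
    star-size v h = let (u , Fvu) = active-out h in degree-≥ κ (κ + d) 1≤κ sep ℕP.≤-refl big v u Fvu

    F-Nb : ∀ {v u} → F v u ≡ true → Nb v u ≡ true
    F-Nb h = Nb-in (active-in (F-sym h)) (Lk-in h) (λ e → F-irr h (sym e))

    -- Split off the pairs inside `Q`, that is `v` and its neighbours. The simplicial members `X` of
    -- `Q` have no edges leaving `Q`, so they can be added back to the other part, gaining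
    -- `f (count n Q) - f q`; the overlap is thus at most `f q`. The stars of `v` and of the distant
    -- `u` make both parts large. For `q < D` this contradicts `κ = dD - 1`, since
    -- `f q ≤ d (D - 2)`.
    boundary-size : ∀ v → active v ≡ true → Clique (Nb v) → (∃ λ u → active u ≡ true × ¬ Lk F v u) → D ≤ count n (Y ∩ Nb v)
    boundary-size v Av simp (u , Au , far) = ℕP.≮⇒≥ λ q<D → absurd q<D (overlap-≥ κ (κ + d) P (f q) sep (λ {a} {b} → P-sym {a} {b}) (ℕP.m≤m+n κ d) thin
        (ℕP.≤-trans (star-size v Av) (star-rank-≥ 1≤d v (F v) (F ⋂ P) (¬true⇒false (λ h → F-irr h refl))
          (λ x h → ∧-intro (F-sym h) (∧-intro (∨-inr {⟦ v ⟧ x} (F-Nb h)) (∨-inl (==-refl v))))))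
        (ℕP.≤-trans (star-size u Au) (star-rank-≥ 1≤d u (F u) (F ⧵ P) (¬true⇒false (λ h → F-irr h refl))
          (λ x h → ∧-intro (F-sym h) (not-intro (λ z → Q-far (∧-snd {a = Q x} z)))))))
      where
      open ℕP.≤-Reasoning
      q = count n (Y ∩ Nb v)
      Q X : Subset n
      Q = ⟦ v ⟧ ⊔ Nb v
      X = Q ∖ (Y ∩ Nb v)
      P : PairSet n
      P = K Q
      P-sym : Symmetric P
      P-sym {a} {b} h = ∧-intro (∧-snd {a = Q a} h) (∧-fst h)
      Q-case : ∀ x → Q x ≡ true → x ≡ v ⊎ Nb v x ≡ true
      Q-case x h = [ (λ e → inj₁ (==-elim {x = x} e)) , inj₂ ]′ (∨-elim {⟦ v ⟧ x} h)
      Q-far : Q u ≡ true → ⊥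
      Q-far h = [ (λ { refl → far (Lk-loop u) }) , (λ h → far (Nb-Lk h)) ]′ (Q-case u h)
      Q-clique : ∀ x y → Q x ≡ true → Q y ≡ true → Lk F x y
      Q-clique x y hx hy with Q-case x hx | Q-case y hy
      ... | inj₁ refl | inj₁ refl = Lk-loop x
      ... | inj₁ refl | inj₂ b = Nb-Lk b
      ... | inj₂ a | inj₁ refl = Lk-sym (Nb-Lk a)
      ... | inj₂ a | inj₂ b = simp x y a b
      X-closed : ∀ t y → X t ≡ true → Lk F t y → active y ≡ true → Q y ≡ true
      X-closed t y h l Ay = go (y FinP.≟ v) (y FinP.≟ t) (Q-case t (∧-fst h))
        where
        go : Dec (y ≡ v) → Dec (y ≡ t) → t ≡ v ⊎ Nb v t ≡ true → Q y ≡ true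
        go (yes e) _ _ = ∨-inl (dec-true (y FinP.≟ v) e)
        go (no y≢v) _ (inj₁ refl) = ∨-inr {⟦ v ⟧ y} (Nb-in Ay l y≢v)
        go (no y≢v) (yes refl) (inj₂ b) = ∨-inr {⟦ v ⟧ y} b
        go (no y≢v) (no y≢t) (inj₂ b) = ∨-inr {⟦ v ⟧ y} (Nb-in Ay (decidable-stable (clique? (Nb t))
            (λ ¬c → not-elim (∧-snd {a = Q t} h) (∧-intro (Y-in (Nb-A b) ¬c) b)) v y
            (Nb-in Av (Lk-sym (Nb-Lk b)) (λ e → Nb-≢ b (sym e))) (Nb-in Ay l y≢t)) y≢v)
      size-Q : count n Q ≡ q + count n X
      size-Q = trans (sym (count-split n Q (Y ∩ Nb v))) (cong (_+ count n X) (count-cong n (λ i → bool-ext (∧-snd {a = Q i})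
        (λ h → ∧-intro (∨-inr {⟦ v ⟧ i} (∧-snd {a = Y i} h)) h))))
      thin : r (F ⋂ P) + r (F ⧵ P) ≤ r F + f q
      thin = begin
        r (F ⋂ P) + r (F ⧵ P) ≤⟨ ℕP.+-monoˡ-≤ _ (ℕP.≤-trans (r-mono (λ a b h → ∧-snd {a = F a b} h))
            (subst (λ z → r (K Q) ≤ f z) (sym (count-─ Q v (∨-inl (==-refl v)))) (clique-rank-≤ _ Q (count-─ Q v (∨-inl (==-refl v)))))) ⟩
        f (count n Q) + r (F ⧵ P) ≡⟨ trans (ℕP.+-comm (f (count n Q)) _) (cong (λ z → r (F ⧵ P) + f z) size-Q) ⟩
        r (F ⧵ P) + f (q + count n X) ≤⟨ add-clique (count n X) (F ⧵ P) link X (Y ∩ Nb v) refl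
            (λ t x y → not-elim (∧-snd {a = Q t} x) y)
            (λ t x a → ¬true⇒false (λ h → avoid t x (F-sym (∧-fst h)) (not-elim (∧-snd {a = F a t} h)) (inj₁ refl)) ,
              ¬true⇒false (λ h → avoid t x (∧-fst h) (not-elim (∧-snd {a = F t a} h)) (inj₂ refl)))
            (λ a b h → link-in (Lk-in (∧-fst h)))
            (λ t y x h → link-in (Q-clique t y (∧-fst x) (∨-inr {⟦ v ⟧ y} (∧-snd {a = Y y} h))))
            (λ t y x h → link-in (Q-clique t y (∧-fst x) (∧-fst h))) ⟩
        r link + f q ≤⟨ ℕP.+-monoˡ-≤ (f q) (r-span (λ a b h → link-out h)) ⟩
        r F + f q ∎
        where
        avoid : ∀ t {a c} → X t ≡ true → F t a ≡ true → (c ≡ true → ⊥) → c ≡ K Q a t ⊎ c ≡ K Q t a → ⊥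
        avoid t {a} x Fta ¬c (inj₁ refl) = ¬c (∧-intro (X-closed t a x (Lk-in Fta) (active-in (F-sym Fta))) (∧-fst x))
        avoid t {a} x Fta ¬c (inj₂ refl) = ¬c (∧-intro (∧-fst x) (X-closed t a x (Lk-in Fta) (active-in (F-sym Fta))))
      absurd : q < D → κ ≤ f q → ⊥
      absurd q<D h = small D (ℕP.*-mono-≤ {1} {d} {2} 1≤d (s≤s 1≤d)) κ-eq q<D
        where
        small : ∀ D → 2 ≤ D → suc κ ≡ d * D → q < D → ⊥
        small (suc zero) (s≤s ()) eq lt
        small (suc (suc D′)) _ eq lt = ℕP.<⇒≱ (ℕP.+-mono-≤ 1≤d 1≤d) (ℕP.+-cancelˡ-≤ (d * D′) (d + d) 1 (begin
          d * D′ + (d + d) ≡⟨ solve 2 (λ d D → d :* D :+ (d :+ d) := d :* (con 2 :+ D)) refl d D′ ⟩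
          d * suc (suc D′) ≡⟨ sym eq ⟩
          suc κ ≤⟨ s≤s (ℕP.≤-trans h (ℕP.≤-trans (f-mono (ℕP.≤-pred lt)) (f-≤ D′))) ⟩
          suc (d * D′) ≡⟨ ℕP.+-comm 1 _ ⟩
          d * D′ + 1 ∎))
          where open ℕSolver.+-*-Solver

    active-rigid : ∀ u v → active u ≡ true → active v ≡ true → Lk F u v
    active-rigid = rigid (λ v Av → ℕP.≤-trans D≤κ+d (ℕP.≤-trans (star-size v Av) (count-mono n (λ u h → F-Nb h)))) boundary-size

    active-rank : ∀ v → active v ≡ true → r F ≡ f (count n active)
    active-rank v Av = ℕP.≤-antisym
      (ℕP.≤-trans (r-mono (λ a b h → ∧-intro (active-in h) (active-in (F-sym h))))
        (subst (λ z → r (K active) ≤ f z) (sym (count-─ active v Av)) (clique-rank-≤ _ active (count-─ active v Av))))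
      (ℕP.≤-trans (clique-rank-≥ active (K active) (λ x y → ∧-intro)) (r-span (λ x y h → active-rigid x y (∧-fst h) (∧-snd {a = active x} h))))

-- Edges, incidence and vertex cuts

SamePair-swap : ∀ {k} (x : Fin k × Fin k) {a b} → SamePair x (a , b) → SamePair x (b , a)
SamePair-swap x (inj₁ (p , q)) = inj₂ (p , q)
SamePair-swap x (inj₂ (p , q)) = inj₁ (p , q)

module _ (G : Graph) where
  pairs-sym : ∀ S → Symmetric (pairs G S)
  pairs-sym S {u} {v} h with pairs-out G S {u} {v} h
  ... | e , s , sp = pairs-in G S e s (SamePair-swap (ends G e) sp)

  pairs-irr : ∀ S → Irreflexive (pairs G S)
  pairs-irr S {u} {v} h refl with pairs-out G S {u} {v} h
  ... | e , s , inj₁ (p , q) = loopless G e (trans p (sym q))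
  ... | e , s , inj₂ (p , q) = loopless G e (trans p (sym q))

  pairs-ends : ∀ S e → S e ≡ true → pairs G S (proj₁ (ends G e)) (proj₂ (ends G e)) ≡ true
  pairs-ends S e s = pairs-in G S e s (inj₁ (refl , refl))

  pairs-mono : ∀ {S T} → S ⊆ T → pairs G S ⊑ pairs G T
  pairs-mono {S} {T} h u v s with pairs-out G S {u} {v} s
  ... | e , i , sp = pairs-in G T e (h e i) sp

  atEnds : PairSet (n G) → Subset (m G)
  atEnds P e = P (proj₁ (ends G e)) (proj₂ (ends G e))

  atEnds-in : ∀ P → Symmetric P → ∀ e {u v} → SamePair (ends G e) (u , v) → P u v ≡ true → atEnds P e ≡ true
  atEnds-in P P-sym e (inj₁ (refl , refl)) h = h
  atEnds-in P P-sym e (inj₂ (refl , refl)) h = P-sym h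

  atEnds-out : ∀ P → Symmetric P → ∀ e {u v} → SamePair (ends G e) (u , v) → atEnds P e ≡ true → P u v ≡ true
  atEnds-out P P-sym e (inj₁ (refl , refl)) h = h
  atEnds-out P P-sym e (inj₂ (refl , refl)) h = P-sym h

  pairs-⋂ : ∀ J P → Symmetric P → (pairs G J ⋂ P) ⊑ pairs G (J ∩ atEnds P)
  pairs-⋂ J P P-sym u v h with pairs-out G J {u} {v} (∧-fst h)
  ... | e , j , sp = pairs-in G _ e (∧-intro j (atEnds-in P P-sym e sp (∧-snd {a = pairs G J u v} h))) sp

  pairs-⋂⁻¹ : ∀ J P → Symmetric P → pairs G (J ∩ atEnds P) ⊑ (pairs G J ⋂ P)
  pairs-⋂⁻¹ J P P-sym u v h with pairs-out G (J ∩ atEnds P) {u} {v} h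
  ... | e , j , sp = ∧-intro (pairs-in G J e (∧-fst j) sp) (atEnds-out P P-sym e sp (∧-snd {a = J e} j))

  Complement : PairSet (n G) → PairSet (n G)
  Complement P u v = not (P u v)

  Complement-sym : ∀ P → Symmetric P → Symmetric (Complement P)
  Complement-sym P P-sym {u} {v} h = not-intro (λ p → not-elim h (P-sym p))

  Incident : Fin (m G) → Fin (n G) → Set
  Incident e v = proj₁ (ends G e) ≡ v ⊎ proj₂ (ends G e) ≡ v

  incident? : ∀ e v → Dec (Incident e v)
  incident? e v = (proj₁ (ends G e) FinP.≟ v) ⊎-dec (proj₂ (ends G e) FinP.≟ v)

  incident-pair : ∀ e {u v} → u ≢ v → Incident e u → Incident e v → SamePair (ends G e) (u , v)
  incident-pair e ne (inj₁ p) (inj₁ q) = ⊥-elim (ne (trans (sym p) q))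
  incident-pair e ne (inj₁ p) (inj₂ q) = inj₁ (p , q)
  incident-pair e ne (inj₂ p) (inj₁ q) = inj₂ (q , p)
  incident-pair e ne (inj₂ p) (inj₂ q) = ⊥-elim (ne (trans (sym p) q))

  samePair-incident : ∀ e {u v} → SamePair (ends G e) (u , v) → Incident e u
  samePair-incident e (inj₁ (p , q)) = inj₁ p
  samePair-incident e (inj₂ (p , q)) = inj₂ q

  -- A path from `a` that avoids the cut can never leave `A`, as no edge joins `A` to `B`; so it
  -- does not reach `b`.
  KConnected⇒cut : ∀ k → KConnected k G → CutCondition k (pairs G full)
  KConnected⇒cut k (_ , conn) A B disjoint a b Aa Bb apart = ℕP.≮⇒≥ λ small →
      disjoint b (stays (conn X small a b (off-A Aa) (off-B Bb)) Aa) Bb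
    where
    X : Subset (n G)
    X x = not (A x) ∧ not (B x)
    off-A : ∀ {x} → A x ≡ true → X x ≡ false
    off-A h rewrite h = refl
    off-B : ∀ {x} → B x ≡ true → X x ≡ false
    off-B {x} h = ¬true⇒false (λ z → not-elim (∧-snd {a = not (A x)} z) h)
    start : ∀ {x y} → Reach G X x y → X x ≡ false
    start (here p) = p
    start (step p _ _) = p
    stays : ∀ {x y} → Reach G X x y → A x ≡ true → A y ≡ true
    stays (here _) h = h
    stays (step {x} {y} _ (e , sp) rest) h = stays rest (¬¬A (λ ¬Ay → true≢false
        (∧-intro (not-intro ¬Ay) (not-intro (λ By → apart x y h By (pairs-in G full e refl sp)))) (start rest)))
      where
      ¬¬A : ¬ ¬ (A y ≡ true) → A y ≡ true
      ¬¬A = decidable-stable (A y Data.Bool.≟ true)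

HasRank-unique : ∀ {d G S ρ ρ′} → HasRank d G S ρ → HasRank d G S ρ′ → ρ ≡ ρ′
HasRank-unique ((I , sub , ind , refl) , up) ((I′ , sub′ , ind′ , refl) , up′) = ℕP.≤-antisym (up′ I sub ind) (up I′ sub′ ind′)

-- Vertical connectivity implies vertex connectivity

module Vertical (d : ℕ) (1≤d : 1 ≤ d) (G : Graph) (R : RigidityRank (n G) d)
  (hasRank : ∀ S → HasRank d G S (RigidityRank.r R (pairs G S))) where
  open RigidityRank R
  open RankLemmas R
  F : PairSet (n G)
  F = pairs G full
  open Separations R 1≤d F (λ {u} {v} → pairs-sym G full {u} {v}) (λ {u} {v} → pairs-irr G full {u} {v})
    using (NonSeparable; degree-≥; overlap-≥; ⧵-split)

  -- If neither part spans, the partition is a vertical separation of order `k′ = r₁ + r₂ - r + 1`: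
  -- that `k′` is at most either rank says precisely that the other part does not span. Hence `k′`
  -- exceeds `κ`.
  nonSeparable : ∀ κ → VerticallyConnected d G (suc κ) → NonSeparable κ
  nonSeparable κ (_ , none) P P-sym = go (r F ℕP.≤? r (F ⋂ P)) (r F ℕP.≤? r (F ⧵ P))
    where
    I : Subset (m G)
    I = atEnds G P
    r₁ = r (pairs G I)
    r₂ = r (pairs G (λ e → not (I e)))
    r₁-eq : r₁ ≡ r (F ⋂ P)
    r₁-eq = ℕP.≤-antisym (r-mono (pairs-⋂⁻¹ G full P P-sym)) (r-mono (pairs-⋂ G full P P-sym))
    r₂-eq : r₂ ≡ r (F ⧵ P)
    r₂-eq = ℕP.≤-antisym (r-mono (pairs-⋂⁻¹ G full (Complement G P) (λ {u} {v} → Complement-sym G P P-sym {u} {v})))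
      (r-mono (pairs-⋂ G full (Complement G P) (λ {u} {v} → Complement-sym G P P-sym {u} {v})))
    sub : r F ≤ r (F ⋂ P) + r (F ⧵ P)
    sub = ℕP.≤-trans (r-mono (λ u v h → [ ∨-inl , ∨-inr {(F ⋂ P) u v} ]′ (⧵-split P {u} {v} h))) (r-∪ _ _)
    go : Dec (r F ≤ r (F ⋂ P)) → Dec (r F ≤ r (F ⧵ P)) → κ + r F ≤ r (F ⋂ P) + r (F ⧵ P) ⊎ (r F ≤ r (F ⋂ P) ⊎ r F ≤ r (F ⧵ P))
    go (yes h) _ = inj₂ (inj₁ h)
    go (no _) (yes h) = inj₂ (inj₂ h)
    go (no h₁) (no h₂) = inj₁ (ℕP.≤-pred (begin
        suc κ + r F ≤⟨ ℕP.+-monoˡ-≤ (r F) κ<k′ ⟩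
        k′ + r F ≡⟨ ℕP.m∸n+n≡m (ℕP.m≤n⇒m≤1+n sub) ⟩
        suc (r (F ⋂ P) + r (F ⧵ P)) ∎))
      where
      open ℕP.≤-Reasoning
      k′ = suc (r (F ⋂ P) + r (F ⧵ P)) ∸ r F
      bound₁ : k′ ≤ r (F ⋂ P)
      bound₁ = ℕP.m≤n+o⇒m∸n≤o _ (r F) (subst (suc (r (F ⋂ P) + r (F ⧵ P)) ≤_) (ℕP.+-comm (r (F ⋂ P)) (r F))
        (subst (_≤ r (F ⋂ P) + r F) (ℕP.+-suc _ _) (ℕP.+-monoʳ-≤ (r (F ⋂ P)) (ℕP.≰⇒> h₂))))
      bound₂ : k′ ≤ r (F ⧵ P)
      bound₂ = ℕP.m≤n+o⇒m∸n≤o _ (r F) (ℕP.+-monoˡ-≤ (r (F ⧵ P)) (ℕP.≰⇒> h₁))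
      κ<k′ : suc κ ≤ k′
      κ<k′ = ℕP.≮⇒≥ λ k′<K → none k′ (ℕP.m<n⇒0<n∸m (s≤s sub)) k′<K
        (I , r₁ , r₂ , r F , hasRank I , hasRank _ , hasRank full ,
          subst (k′ ≤_) (sym r₁-eq) bound₁ , subst (k′ ≤_) (sym r₂-eq) bound₂ ,
          (begin
            r₁ + r₂ + 1 ≡⟨ trans (ℕP.+-comm (r₁ + r₂) 1) (cong₂ (λ a b → suc (a + b)) r₁-eq r₂-eq) ⟩
            suc (r (F ⋂ P) + r (F ⧵ P)) ≡⟨ sym (ℕP.m+[n∸m]≡n (ℕP.m≤n⇒m≤1+n sub)) ⟩
            r F + k′ ∎))

  module _ (k : ℕ) (2≤k : 2 ≤ k) (κ : ℕ) (κ-eq : suc κ ≡ d * k) (vc : VerticallyConnected d G (suc κ)) where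
    sep : NonSeparable κ
    sep = nonSeparable κ vc

    K≤r : suc κ ≤ r F
    K≤r = proj₁ vc (r F) (hasRank full)

    1≤κ : 1 ≤ κ
    1≤κ = ℕP.≤-pred (subst (2 ≤_) (sym κ-eq) (ℕP.*-mono-≤ {1} {d} {2} {k} 1≤d 2≤k))

    star-size : ∀ v u → F v u ≡ true → suc κ ≤ count (n G) (F v)
    star-size = degree-≥ κ (suc κ) 1≤κ sep (ℕP.≤-trans (ℕP.≤-reflexive (ℕP.+-comm 1 κ)) (ℕP.+-monoʳ-≤ κ 1≤d)) K≤r

    vertex-star : ∀ v → suc κ ≤ count (n G) (F v)
    vertex-star v with noIsolated G v
    ... | e , inj₁ refl = star-size _ _ (pairs-ends G full e refl)
    ... | e , inj₂ refl = star-size _ _ (pairs-sym G full {proj₁ (ends G e)} (pairs-ends G full e refl))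

    vertical-size : k < n G
    vertical-size with hasRank full
    ... | (I , sub , ind , eq) , _ with count-pos (m G) I (ℕP.≤-trans (s≤s z≤n) (ℕP.≤-trans K≤r (ℕP.≤-reflexive (sym eq))))
    ... | e , _ = let v = proj₁ (ends G e) in begin
        suc k ≤⟨ s≤s (ℕP.m≤n*m k d {{ℕ.>-nonZero 1≤d}}) ⟩
        suc (d * k) ≡⟨ cong suc (sym κ-eq) ⟩
        suc (suc κ) ≤⟨ s≤s (vertex-star v) ⟩
        suc (count (n G) (F v)) ≤⟨ s≤s (count-mono (n G) (λ u h → ─-in {S = full} refl (λ eq → pairs-irr G full {v} {u} h (sym eq)))) ⟩
        suc (count (n G) (full ─ v)) ≡⟨ sym (count-─ full v refl) ⟩
        count (n G) full ≡⟨ count-full (n G) ⟩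
        n G ∎
      where open ℕP.≤-Reasoning

    -- `P` collects the pairs touching `A`, so one part avoids `B` and the other `A`, while the
    -- stars at `a` and `b` make both ranks large. A cut of size `s < k` would bound the overlap by
    -- `d (k - 2)`, less than `κ = dk - 1`.
    vertical-cut : CutCondition k F
    vertical-cut A B disjoint a b Aa Bb apart = ℕP.≮⇒≥ (λ small → absurd small
        (overlap-≥ κ (suc κ) P (d * (s ∸ 1)) sep (λ {x} {y} → P-sym {x} {y}) (ℕP.n≤1+n κ) thin
          (ℕP.≤-trans (vertex-star a) (star-rank-≥ 1≤d a (F a) (F ⋂ P) (irr a) (λ x h → ∧-intro (pairs-sym G full {a} {x} h) (∨-inr {A x} Aa))))
          (ℕP.≤-trans (vertex-star b) (star-rank-≥ 1≤d b (F b) (F ⧵ P) (irr b) (λ x h → ∧-intro (pairs-sym G full {b} {x} h)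
            (not-intro (λ z → [ (λ Ax → apart x b Ax Bb (pairs-sym G full {b} {x} h)) , (λ Ab → disjoint b Ab Bb) ]′ (∨-elim {A x} z))))))))
      where
      open ℕP.≤-Reasoning
      s = count (n G) (λ x → not (A x) ∧ not (B x))
      P : PairSet (n G)
      P x y = A x ∨ A y
      P-sym : Symmetric P
      P-sym {x} {y} h = [ ∨-inr {A y} , ∨-inl ]′ (∨-elim {A x} h)
      irr : ∀ v → F v v ≡ false
      irr v = ¬true⇒false (λ h → pairs-irr G full {v} {v} h refl)
      thin : r (F ⋂ P) + r (F ⧵ P) ≤ r F + d * (s ∸ 1)
      thin = ℕP.≤-trans (separate (F ⋂ P) (F ⧵ P) A B
          (λ v Bv u → ¬true⇒false (λ h → touch u v Bv (∧-fst h) (∨-elim {A u} (∧-snd {a = F u v} h))) ,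
            ¬true⇒false (λ h → touch u v Bv (pairs-sym G full {v} {u} (∧-fst h)) (∨-elim {A u} (P-sym {v} {u} (∧-snd {a = F v u} h)))))
          (λ v Av u → ¬true⇒false (λ h → not-elim (∧-snd {a = F u v} h) (∨-inr {A u} Av)) ,
            ¬true⇒false (λ h → not-elim (∧-snd {a = F v u} h) (∨-inl Av))))
        (ℕP.+-monoˡ-≤ _ (r-mono (λ x y h → [ (λ z → ∧-fst z) , (λ z → ∧-fst z) ]′ (∨-elim {(F ⋂ P) x y} h))))
        where
        touch : ∀ u v → B v ≡ true → F u v ≡ true → A u ≡ true ⊎ A v ≡ true → ⊥
        touch u v Bv h (inj₁ Au) = apart u v Au Bv h
        touch u v Bv h (inj₂ Av) = disjoint v Av Bv
      absurd : s < k → κ ≤ d * (s ∸ 1) → ⊥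
      absurd lt h = bad k 2≤k κ-eq lt
        where
        bad : ∀ k → 2 ≤ k → suc κ ≡ d * k → s < k → ⊥
        bad (suc zero) (s≤s ()) eq lt
        bad (suc (suc k′)) _ eq lt = ℕP.<⇒≱ (ℕP.+-mono-≤ 1≤d 1≤d) (ℕP.+-cancelˡ-≤ (d * k′) (d + d) 1 (begin
          d * k′ + (d + d) ≡⟨ solve 2 (λ d k → d :* k :+ (d :+ d) := d :* (con 2 :+ k)) refl d k′ ⟩
          d * suc (suc k′) ≡⟨ sym eq ⟩
          suc κ ≤⟨ s≤s (ℕP.≤-trans h (ℕP.*-monoʳ-≤ d (ℕP.∸-monoˡ-≤ 1 (ℕP.≤-pred lt)))) ⟩
          suc (d * k′) ≡⟨ ℕP.+-comm 1 _ ⟩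
          d * k′ + 1 ∎))
          where open ℕSolver.+-*-Solver

-- Recognising vertex stars

module RankIso (d : ℕ) (G H : Graph) (ψ : Fin (m G) ↔ Fin (m H)) (iso : MatroidIso d G H ψ) where
  open Inverse ψ using (to; from; strictlyInverseˡ; strictlyInverseʳ)

  to-inj : ∀ x y → to x ≡ to y → x ≡ y
  to-inj x y e = trans (sym (strictlyInverseʳ x)) (trans (cong from e) (strictlyInverseʳ y))

  from-inj : ∀ x y → from x ≡ from y → x ≡ y
  from-inj x y e = trans (sym (strictlyInverseˡ x)) (trans (cong to e) (strictlyInverseˡ y))

  count-from : ∀ I → count (m H) (I ∘ from) ≡ count (m G) I
  count-from I = ℕP.≤-antisym
    (inj⇒≤count (m G) I _ (from ∘ enum (m H) (I ∘ from)) (λ x y e → enum-inj (m H) (I ∘ from) x y (from-inj _ _ e)) (enum-in (m H) (I ∘ from)))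
    (inj⇒≤count (m H) (I ∘ from) _ (to ∘ enum (m G) I) (λ x y e → enum-inj (m G) I x y (to-inj _ _ e))
      (λ x → trans (cong I (strictlyInverseʳ _)) (enum-in (m G) I x)))

  Indep-cong : ∀ {S T : Subset (m H)} → (∀ e → S e ≡ T e) → Indep d H S → Indep d H T
  Indep-cong e (p , ri) = p , λ c off → ri c (λ x s → off x (trans (sym (e x)) s))

  HasRank-image : ∀ I ρ → HasRank d G I ρ → HasRank d H (I ∘ from) ρ
  HasRank-image I ρ ((B , sub , ind , eq) , up) =
    (B ∘ from , (λ j → sub (from j)) , proj₁ (iso B) ind , trans (count-from B) eq) ,
    λ J sub′ ind′ → let back : ∀ j → J j ≡ J (to (from j))
                        back j = cong J (sym (strictlyInverseˡ j)) in
      subst (_≤ ρ) (trans (sym (count-from (J ∘ to))) (count-cong (m H) (sym ∘ back)))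
        (up (J ∘ to) (λ e h → trans (cong I (sym (strictlyInverseʳ e))) (sub′ (to e) h)) (proj₂ (iso (J ∘ to)) (Indep-cong back ind′)))

module Stars (d : ℕ) (1≤d : 1 ≤ d) (G : Graph) (RG : RigidityRank (n G) d)
  (hasG : ∀ S → HasRank d G S (RigidityRank.r RG (pairs G S)))
  (k : ℕ) (k-eq : k ≡ d * (d * suc d) + d * suc d) (k<n : k < n G) (cut : CutCondition k (pairs G full))
  (H : Graph) (ψ : Fin (m G) ↔ Fin (m H)) (iso : MatroidIso d G H ψ)
  (RH : RigidityRank (n H) d) (hasH : ∀ S → HasRank d H S (RigidityRank.r RH (pairs H S))) where
  open Inverse ψ using (to; from; strictlyInverseˡ; strictlyInverseʳ)
  open RankIso d G H ψ iso
  module RG = RigidityRank RG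
  module RH = RigidityRank RH
  module LG = RankLemmas RG
  module LH = RankLemmas RH
  S : PairSet (n G)
  S = pairs G full
  module C = Connected RG 1≤d S (λ {u} {v} → pairs-sym G full {u} {v}) (λ {u} {v} → pairs-irr G full {u} {v}) k k<n cut

  D κ : ℕ
  D = d * suc d
  κ = d * D ∸ 1

  2≤D : 2 ≤ D
  2≤D = ℕP.*-mono-≤ {1} {d} {2} 1≤d (s≤s 1≤d)

  κ-eq : suc κ ≡ d * D
  κ-eq = ℕP.m+[n∸m]≡n (ℕP.≤-trans (s≤s z≤n) (ℕP.*-mono-≤ {1} {d} {2} 1≤d 2≤D))

  -- The extra one pays for deleting `v`: afterwards `κ` further deletions still leave a
  -- `D`-connected graph.
  k-κ : suc (κ + D) ≡ k
  k-κ = trans (cong (_+ D) κ-eq) (sym k-eq)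

  rank-iso : ∀ I → RG.r (pairs G I) ≡ RH.r (pairs H (I ∘ from))
  rank-iso I = HasRank-unique {d} {H} (HasRank-image I _ (hasG I)) (hasH (I ∘ from))

  inside : Subset (n G) → Subset (m G)
  inside A = atEnds G (K A)

  K-sym : ∀ (A : Subset (n G)) → Symmetric (K A)
  K-sym A {u} {v} h = ∧-intro (∧-snd {a = A u} h) (∧-fst h)

  inside-↾ : ∀ A I → pairs G (inside A ∩ I) ⊑ (pairs G I ↾ A)
  inside-↾ A I u v h with pairs-out G (inside A ∩ I) {u} {v} h
  ... | e , j , sp = ∧-intro (pairs-in G I e (∧-snd {a = inside A e} j) sp) (atEnds-out G (K A) (λ {x} {y} → K-sym A {x} {y}) e sp (∧-fst j))

  ↾-inside : ∀ A I → (pairs G I ↾ A) ⊑ pairs G (inside A ∩ I)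
  ↾-inside A I u v h with pairs-out G I {u} {v} (↾-set (pairs G I) A {u} {v} h)
  ... | e , i , sp = pairs-in G _ e (∧-intro (atEnds-in G (K A) (λ {x} {y} → K-sym A {x} {y}) e sp (∧-snd {a = pairs G I u v} h)) i) sp

  -- Used for the whole vertex set, which yields equal numbers of vertices, and for the complement
  -- of a single vertex, which yields its star.
  module Image (A : Subset (n G)) (few : missing A ≤ 1) where
    F : PairSet (n H)
    F = pairs H (inside A ∘ from)
    open Separations RH 1≤d F (λ {u} {v} → pairs-sym H _ {u} {v}) (λ {u} {v} → pairs-irr H _ {u} {v})
      using (NonSeparable; active; active-in; active-rigid; active-rank) public

    room : C.Room A κ
    room = ℕP.≤-trans (ℕP.+-monoˡ-≤ (κ + D) few) (ℕP.≤-reflexive k-κ)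

    rank-image : ∀ I → RH.r (pairs H ((inside A ∩ I) ∘ from)) ≡ RG.r (pairs G I ↾ A)
    rank-image I = trans (sym (rank-iso (inside A ∩ I))) (ℕP.≤-antisym (LG.r-mono (inside-↾ A I)) (LG.r-mono (↾-inside A I)))

    rank-F : RH.r F ≡ RG.r (S ↾ A)
    rank-F = trans (ℕP.≤-antisym (LH.r-mono (pairs-mono H (λ j h → ∧-intro h refl))) (LH.r-mono (pairs-mono H (λ j h → ∧-fst h)))) (rank-image full)

    part : PairSet (n H) → Subset (m G)
    part P e = atEnds H P (to e)

    rank-part : ∀ P → Symmetric P → RH.r (F ⋂ P) ≡ RG.r (pairs G (part P) ↾ A)
    rank-part P P-sym = trans (ℕP.≤-antisym
        (ℕP.≤-trans (LH.r-mono (pairs-⋂ H _ P P-sym)) (LH.r-mono (pairs-mono H (λ j h → ∧-intro (∧-fst h) (trans (cong (atEnds H P) (strictlyInverseˡ j)) (∧-snd {a = inside A (from j)} h))))))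
        (ℕP.≤-trans (LH.r-mono (pairs-mono H (λ j h → ∧-intro (∧-fst h) (trans (cong (atEnds H P) (sym (strictlyInverseˡ j))) (∧-snd {a = inside A (from j)} h))))) (LH.r-mono (pairs-⋂⁻¹ H _ P P-sym))))
      (rank-image (part P))

    -- The property speaks of ranks only: a partition of `F` is pulled back along `to`, the
    -- alternatives are obtained in `G` by `C.connectivity`, and the rank equalities carry them
    -- over.
    nonSeparable : NonSeparable κ
    nonSeparable P P-sym = subst (λ Z → Z) (cong₂ (λ (a : ℕ × ℕ) c → κ + proj₁ a ≤ proj₂ a + c ⊎ (proj₁ a ≤ proj₂ a ⊎ proj₁ a ≤ c))
        (sym (cong₂ _,_ rank-F (rank-part P P-sym))) (sym (rank-part (Complement H P) (λ {u} {v} → Complement-sym H P P-sym {u} {v}))))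
      (C.connectivity κ A (pairs G (part P)) (pairs G (part (Complement H P)))
        (λ {u} {v} → pairs-sym G _ {u} {v}) (λ {u} {v} → pairs-sym G _ {u} {v})
        (pairs-mono G (λ _ _ → refl)) (pairs-mono G (λ _ _ → refl)) cover room)
      where
      cover : ∀ {u v} → S u v ≡ true → pairs G (part P) u v ≡ true ⊎ pairs G (part (Complement H P)) u v ≡ true
      cover {u} {v} h with pairs-out G full {u} {v} h
      ... | e , _ , sp with bool-cases (part P e)
      ... | inj₁ p = inj₁ (pairs-in G _ e p sp)
      ... | inj₂ p = inj₂ (pairs-in G _ e (cong not p) sp)

    module _ (v₀ : Fin (n G)) (Av₀ : A v₀ ≡ true) where
      rank-A : RG.r (S ↾ A) ≡ cliqueRank d (count (n G) A)
      rank-A = C.rigid-rank A (ℕP.≤-trans (ℕP.+-monoʳ-≤ (missing A) (ℕP.m≤n+m D κ)) room) v₀ Av₀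

      k≤A : k ≤ count (n G) A
      k≤A = ℕP.≤-pred (ℕP.≤-trans k<n (ℕP.≤-trans (ℕP.≤-reflexive (sym (missing-count A)))
        (ℕP.≤-trans (ℕP.+-monoʳ-≤ (count (n G) A) few) (ℕP.≤-reflexive (ℕP.+-comm (count (n G) A) 1)))))

      big : κ + d ≤ RH.r F
      big = subst (κ + d ≤_) (sym (trans rank-F rank-A)) (begin
        κ + d ≤⟨ ℕP.+-monoʳ-≤ κ (ℕP.m≤m*n d (suc d)) ⟩
        κ + D ≤⟨ ℕP.≤-pred (ℕP.≤-trans (ℕP.≤-reflexive k-κ) (ℕP.≤-trans k≤A (ℕP.≤-reflexive (count-─ A v₀ Av₀)))) ⟩
        count (n G) (A ─ v₀) ≤⟨ LG.f-≥ 1≤d _ ⟩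
        cliqueRank d (suc (count (n G) (A ─ v₀))) ≡⟨ cong (cliqueRank d) (sym (count-─ A v₀ Av₀)) ⟩
        cliqueRank d (count (n G) A) ∎)
        where open ℕP.≤-Reasoning

      rigid-image : ∀ u v → active u ≡ true → active v ≡ true → RH.Lk F u v
      rigid-image = active-rigid κ κ-eq nonSeparable big

      some-active : ∃ λ w → active w ≡ true
      some-active with count-pos (n G) (S v₀ ∩ A) (ℕP.+-cancelˡ-≤ 1 _ _ (ℕP.≤-trans (ℕP.≤-trans (ℕP.≤-trans 2≤D (ℕP.m≤n+m D κ)) (ℕP.≤-trans (ℕP.n≤1+n _) (ℕP.≤-reflexive k-κ)))
          (ℕP.≤-trans (C.degree A v₀ Av₀) (ℕP.+-monoˡ-≤ _ few))))
      ... | u , h with pairs-out G full {v₀} {u} (∧-fst h)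
      ... | e , _ , sp = proj₁ (ends H (to e)) , active-in (pairs-ends H _ (to e) (trans (cong (inside A) (strictlyInverseʳ e))
          (atEnds-in G (K A) (λ {x} {y} → K-sym A {x} {y}) e sp (∧-intro Av₀ (∧-snd {a = S v₀ u} h)))))

      -- Both sides are rigid, so their common rank is a clique rank, which determines the number of
      -- vertices when there is at least one.
      active-size : count (n H) active ≡ count (n G) A
      active-size = same _ _ (count-─ active w Aw) (count-─ A v₀ Av₀)
        (trans (sym (active-rank κ κ-eq nonSeparable big w Aw)) (trans rank-F rank-A))
        where
        w = proj₁ some-active
        Aw = proj₂ some-active
        same : ∀ {a b} a′ b′ → a ≡ suc a′ → b ≡ suc b′ → cliqueRank d a ≡ cliqueRank d b → a ≡ b
        same a′ b′ refl refl e = cong suc (ℕP.≤-antisym (LG.f-cancel-≤ 1≤d a′ b′ (ℕP.≤-reflexive e)) (LG.f-cancel-≤ 1≤d b′ a′ (ℕP.≤-reflexive (sym e))))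

  -- As `H` has no isolated vertex, all its vertices are active in the image of the whole of `G`.
  nH≡nG : Fin (n G) → n H ≡ n G
  nH≡nG v₀ = begin
    n H ≡⟨ sym (count-full (n H)) ⟩
    count (n H) full ≡⟨ count-cong (n H) (λ w → sym (all-active w)) ⟩
    count (n H) active ≡⟨ active-size v₀ refl ⟩
    count (n G) full ≡⟨ count-full (n G) ⟩
    n G ∎
    where
    open ≡-Reasoning
    open Image full (ℕP.≤-trans (ℕP.≤-reflexive (count-∅ (n G) (λ _ → refl))) z≤n)
    all-active : ∀ w → active w ≡ true
    all-active w with noIsolated H w
    ... | j , inj₁ refl = active-in (pairs-ends H _ j refl)
    ... | j , inj₂ refl = active-in (pairs-sym H _ {proj₁ (ends H j)} (pairs-ends H _ j refl))

  StarMatch : Fin (n G) → Fin (n H) → Set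
  StarMatch v w = ∀ e → (Incident G e v → Incident H (to e) w) × (Incident H (to e) w → Incident G e v)

  other-neighbour : ∀ v v′ → ∃ λ u → S v u ≡ true × u ≢ v′
  other-neighbour v v′ with count-pos (n G) ((S v ∩ full) ─ v′) (ℕP.+-cancelˡ-≤ 1 _ _ (ℕP.≤-trans
      (ℕP.≤-trans (ℕP.≤-trans 2≤D (ℕP.m≤n+m D κ)) (ℕP.≤-trans (ℕP.n≤1+n _) (ℕP.≤-reflexive k-κ)))
      (ℕP.≤-trans (C.degree full v refl) (ℕP.≤-trans (ℕP.≤-reflexive (cong (_+ count (n G) (S v ∩ full)) (count-∅ (n G) (λ _ → refl)))) (count-─≥ (S v ∩ full) v′)))))
  ... | u , h = u , ∧-fst (∧-fst {a = (S v ∩ full) u} h) , ─-ne {S = S v ∩ full} h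

  star-distinct : ∀ v v′ → v ≢ v′ → ∃ λ e → Incident G e v × ¬ Incident G e v′
  star-distinct v v′ ne with other-neighbour v v′
  ... | u , s , u≢v′ with pairs-out G full {v} {u} s
  ... | e , _ , sp = e , samePair-incident G e sp , λ i → [ (λ eq → clash sp eq) , (λ eq → clash′ sp eq) ]′ i
    where
    clash : SamePair (ends G e) (v , u) → proj₁ (ends G e) ≡ v′ → ⊥
    clash (inj₁ (p , q)) eq = ne (trans (sym p) eq)
    clash (inj₂ (p , q)) eq = u≢v′ (trans (sym p) eq)
    clash′ : SamePair (ends G e) (v , u) → proj₂ (ends G e) ≡ v′ → ⊥
    clash′ (inj₁ (p , q)) eq = u≢v′ (trans (sym q) eq)
    clash′ (inj₂ (p , q)) eq = ne (trans (sym q) eq)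

  -- An edge missing `v` has its image in `F`, so the ends of the image are active and differ from
  -- `w`. An edge at `v` raises the rank of `G - v`; its image must meet `w`, because a pair of
  -- active vertices is already spanned by the rigid `F`.
  star-match : ∀ v → ∃ (StarMatch v)
  star-match v = w , λ e → forth e , back e
    where
    A = full ─ v
    few : missing A ≤ 1
    few = ℕP.≤-trans (missing-─ full v) (ℕP.≤-reflexive (cong suc (count-∅ (n G) (λ _ → refl))))
    open Image A few
    nb = other-neighbour v v
    v₀ = proj₁ nb
    Av₀ : A v₀ ≡ true
    Av₀ = ─-in {S = full} refl (proj₂ (proj₂ nb))
    size : suc (count (n H) active) ≡ n H
    size = trans (cong suc (active-size v₀ Av₀)) (trans (sym (count-─ full v refl)) (trans (count-full (n G)) (sym (nH≡nG v))))
    missed : ∃ λ w → full w ≡ true × active w ≡ false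
    missed = count-<-witness (n H) active full (subst (count (n H) active <_) (sym (count-full (n H))) (ℕP.≤-reflexive size))
    w = proj₁ missed
    w-out : active w ≡ false
    w-out = proj₂ (proj₂ missed)
    others : ∀ x → x ≢ w → active x ≡ true
    others x ne = decidable-stable (active x Data.Bool.≟ true) λ ¬a → ℕP.1+n≰n (begin
      suc (n H) ≡⟨ cong suc (sym size) ⟩
      2 + count (n H) active ≡⟨ cong (_+ count (n H) active) (sym (trans (⊔-count ⟦ w ⟧ ⟦ x ⟧ (λ i a b → ne (trans (sym (==-elim {x = i} b)) (==-elim {x = i} a)))) (cong₂ _+_ (count-⟦⟧ (n H) w) (count-⟦⟧ (n H) x)))) ⟩
      count (n H) (⟦ w ⟧ ⊔ ⟦ x ⟧) + count (n H) active ≤⟨ count-∪≥ (n H) full (⟦ w ⟧ ⊔ ⟦ x ⟧) active (λ _ _ → refl) (λ _ _ → refl)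
          (λ i a b → [ (λ e → true≢false (subst (λ z → active z ≡ true) (==-elim {x = i} e) b) w-out) , (λ e → ¬a (subst (λ z → active z ≡ true) (==-elim {x = i} e) b)) ]′ (∨-elim {⟦ w ⟧ i} a)) ⟩
      count (n H) full ≡⟨ count-full (n H) ⟩
      n H ∎)
      where open ℕP.≤-Reasoning
    inside-e : ∀ e → ¬ Incident G e v → inside A e ≡ true
    inside-e e ni = ∧-intro (─-in {S = full} refl (λ p → ni (inj₁ p))) (─-in {S = full} refl (λ p → ni (inj₂ p)))
    back : ∀ e → Incident H (to e) w → Incident G e v
    back e inc = decidable-stable (incident? G e v) λ ni →
      let h = pairs-ends H (inside A ∘ from) (to e) (trans (cong (inside A) (strictlyInverseʳ e)) (inside-e e ni)) in
      true≢false ([ (λ p → subst (λ z → active z ≡ true) p (active-in h)) ,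
        (λ p → subst (λ z → active z ≡ true) p (active-in (pairs-sym H (inside A ∘ from) {proj₁ (ends H (to e))} h))) ]′ inc) w-out
    forth : ∀ e → Incident G e v → Incident H (to e) w
    forth e inc = decidable-stable (incident? H (to e) w) λ ni → ℕP.1+n≰n (begin
        suc (RG.r (pairs G (inside A))) ≡⟨ ℕP.+-comm 1 _ ⟩
        RG.r (pairs G (inside A)) + 1 ≤⟨ grow inc ⟩
        RG.r (pairs G I) ≡⟨ rank-iso I ⟩
        RH.r (pairs H (I ∘ from)) ≤⟨ RH.r-span (spanned ni) ⟩
        RH.r F ≡⟨ sym (rank-iso (inside A)) ⟩
        RG.r (pairs G (inside A)) ∎)
      where
      open ℕP.≤-Reasoning
      I : Subset (m G)
      I = inside A ⊔ ⟦ e ⟧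
      avoids : Avoids (pairs G (inside A)) v
      avoids u = ¬true⇒false (λ h → out u h) , ¬true⇒false (λ h → out u (pairs-sym G (inside A) {v} {u} h))
        where
        out : ∀ u → pairs G (inside A) u v ≡ true → ⊥
        out u h with pairs-out G (inside A) {u} {v} h
        ... | e′ , j , sp = ─-ne {S = full} {v} {v} (∧-snd {a = A u} (atEnds-out G (K A) (λ {x} {y} → K-sym A {x} {y}) e′ sp j)) refl
      gain : ∀ u → SamePair (ends G e) (v , u) → u ≢ v → RG.r (pairs G (inside A)) + 1 ≤ RG.r (pairs G I)
      gain u sp ne = LG.gain₀ ⟦ u ⟧ avoids (pairs-mono G (λ x → ∨-inl)) (==-neq (ne ∘ sym))
        (λ x e′ → subst (λ z → pairs G I v z ≡ true) (sym (==-elim {x = x} e′)) (pairs-in G I e (∨-inr {inside A e} (==-refl e)) sp))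
        1 1≤d (ℕP.≤-reflexive (sym (count-⟦⟧ (n G) u)))
      grow : Incident G e v → RG.r (pairs G (inside A)) + 1 ≤ RG.r (pairs G I)
      grow (inj₁ p) = gain (proj₂ (ends G e)) (inj₁ (p , refl)) (λ q → loopless G e (trans p (sym q)))
      grow (inj₂ p) = gain (proj₁ (ends G e)) (inj₂ (refl , p)) (λ q → loopless G e (trans q (sym p)))
      spanned : ¬ Incident H (to e) w → ∀ a b → pairs H (I ∘ from) a b ≡ true → RH.Lk F a b
      spanned ni a b h = from-edge (pairs-out H (I ∘ from) {a} {b} h)
        where
        at : ∀ j {x y} → j ≡ to e → x ≡ w → SamePair (ends H j) (x , y) → Incident H (to e) w
        at j refl refl sp = samePair-incident H j sp
        from-edge : (∃ λ j → I (from j) ≡ true × SamePair (ends H j) (a , b)) → RH.Lk F a b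
        from-edge (j , i , sp) = [ old , new ]′ (∨-elim {inside A (from j)} {⟦ e ⟧ (from j)} i)
          where
          old : inside A (from j) ≡ true → RH.Lk F a b
          old h′ = RH.Lk-in {F} {a} {b} (pairs-in H (inside A ∘ from) {a} {b} j h′ sp)
          new : ⟦ e ⟧ (from j) ≡ true → RH.Lk F a b
          new h′ = rigid-image v₀ Av₀ a b (others a (λ p → ni (at j j≡ p sp))) (others b (λ p → ni (at j j≡ p (SamePair-swap (ends H j) sp))))
            where
            j≡ : j ≡ to e
            j≡ = trans (sym (strictlyInverseˡ j)) (cong to (==-elim {x = from j} {e} h′))

-- Assembling the vertex bijection

starMatch? : ∀ (G H : Graph) (t : Fin (m G) → Fin (m H)) v →
  Dec (∃ λ w → ∀ e → (Incident G e v → Incident H (t e) w) × (Incident H (t e) w → Incident G e v))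
starMatch? G H t v = FinP.any? (λ w → FinP.all? (λ e →
  (incident? G e v →-dec incident? H (t e) w) ×-dec (incident? H (t e) w →-dec incident? G e v)))

starDistinct? : ∀ (G : Graph) v v′ → Dec (∃ λ e → Incident G e v × ¬ Incident G e v′)
starDistinct? G v v′ = FinP.any? (λ e → incident? G e v ×-dec ¬? (incident? G e v′))

module Conclusion (G H : Graph) (ψ : Fin (m G) ↔ Fin (m H))
  (match : ∀ v → ∃ λ w → ∀ e → (Incident G e v → Incident H (Inverse.to ψ e) w) × (Incident H (Inverse.to ψ e) w → Incident G e v))
  (distinct : ∀ v v′ → v ≢ v′ → ∃ λ e → Incident G e v × ¬ Incident G e v′) where
  open Inverse ψ using (to; from; strictlyInverseˡ; strictlyInverseʳ)

  φ : Fin (n G) → Fin (n H)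
  φ v = proj₁ (match v)

  φ-inj : ∀ v v′ → φ v ≡ φ v′ → v ≡ v′
  φ-inj v v′ eq = decidable-stable (v FinP.≟ v′) λ ne →
    let (e , i , ni) = distinct v v′ ne in
    ni (proj₂ (proj₂ (match v′) e) (subst (Incident H (to e)) eq (proj₁ (proj₂ (match v) e) i)))

  φ-edge : ∀ e → SamePair (ends H (to e)) (φ (proj₁ (ends G e)) , φ (proj₂ (ends G e)))
  φ-edge e = incident-pair H (to e) (λ eq → loopless G e (φ-inj _ _ eq))
    (proj₁ (proj₂ (match _) e) (inj₁ refl)) (proj₁ (proj₂ (match _) e) (inj₂ refl))

  -- Every vertex of `H` lies on an edge, that edge is the image of one of `G`, and its ends are
  -- values of `φ`.
  φ-surj : ∀ w → ∃ λ v → φ v ≡ w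
  φ-surj w with noIsolated H w
  ... | j , inc = hit (φ-edge (from j)) (subst (λ z → Incident H z w) (sym (strictlyInverseˡ j)) inc)
    where
    hit : SamePair (ends H (to (from j))) (φ (proj₁ (ends G (from j))) , φ (proj₂ (ends G (from j)))) → Incident H (to (from j)) w → ∃ λ v → φ v ≡ w
    hit (inj₁ (p , q)) (inj₁ i) = _ , trans (sym p) i
    hit (inj₁ (p , q)) (inj₂ i) = _ , trans (sym q) i
    hit (inj₂ (p , q)) (inj₁ i) = _ , trans (sym p) i
    hit (inj₂ (p , q)) (inj₂ i) = _ , trans (sym q) i

  bijection : Fin (n G) ↔ Fin (n H)
  bijection = mk↔ₛ′ φ (proj₁ ∘ φ-surj) (proj₂ ∘ φ-surj) (λ v → φ-inj _ _ (proj₂ (φ-surj (φ v))))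

theorem3p11 : ∀ (d : ℕ) → 1 ≤ d → ∀ (G : Graph) →
    (KConnected (d * ((d + 1) * (d + 1))) G
    ⊎ VerticallyConnected d G ((d * (d + 1)) * (d * (d + 1)))) →
    Reconstructible d G
theorem3p11 d 1≤d G conn H ψ iso = bijection , φ-edge
  where
  k = d * ((d + 1) * (d + 1))
  open ℕSolver.+-*-Solver
  k-eq : k ≡ d * (d * suc d) + d * suc d
  k-eq = solve 1 (λ d → d :* ((d :+ con 1) :* (d :+ con 1)) := d :* (d :* (con 1 :+ d)) :+ d :* (con 1 :+ d)) refl d
  -- The vertical order in the hypothesis is `d` times the vertex connectivity `k`, the ratio
  -- required by `vertical-cut`.
  K-eq : (d * (d + 1)) * (d * (d + 1)) ≡ d * k
  K-eq = solve 1 (λ d → (d :* (d :+ con 1)) :* (d :* (d :+ con 1)) := d :* (d :* ((d :+ con 1) :* (d :+ con 1)))) refl d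
  2≤k : 2 ≤ k
  2≤k = subst (2 ≤_) (sym k-eq) (ℕP.≤-trans (ℕP.*-mono-≤ {1} {d} {2} 1≤d (s≤s 1≤d)) (ℕP.m≤n+m _ _))
  Facts : Set
  Facts = (∀ v → ∃ λ w → ∀ e → (Incident G e v → Incident H (Inverse.to ψ e) w) × (Incident H (Inverse.to ψ e) w → Incident G e v)) ×
    (∀ v v′ → v ≢ v′ → ∃ λ e → Incident G e v × ¬ Incident G e v′)
  facts : NN Facts
  facts = ∃RigidityRank d G >>= λ (RG , hasG) → ∃RigidityRank d H >>= λ (RH , hasH) →
    let (k<n , cut) = connected RG hasG conn
        open Stars d 1≤d G RG hasG k k-eq k<n cut H ψ iso RH hasH
    in return (star-match , star-distinct)
    where
    connected : (RG : RigidityRank (n G) d) → (∀ S → HasRank d G S (RigidityRank.r RG (pairs G S))) →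
      KConnected k G ⊎ VerticallyConnected d G ((d * (d + 1)) * (d * (d + 1))) → k < n G × CutCondition k (pairs G full)
    connected RG hasG (inj₁ kc) = proj₁ kc , KConnected⇒cut G k kc
    connected RG hasG (inj₂ vc) = vertical-size k 2≤k κ κ-eq vc′ , vertical-cut k 2≤k κ κ-eq vc′
      where
      open Vertical d 1≤d G RG hasG
      κ = d * k ∸ 1
      κ-eq : suc κ ≡ d * k
      κ-eq = ℕP.m+[n∸m]≡n (ℕP.≤-trans (s≤s z≤n) (ℕP.*-mono-≤ {1} {d} {2} {k} 1≤d 2≤k))
      vc′ : VerticallyConnected d G (suc κ)
      vc′ = subst (VerticallyConnected d G) (trans K-eq (sym κ-eq)) vc
  open Conclusion G H ψ
    (λ v → decidable-stable (starMatch? G H (Inverse.to ψ) v) (facts >>= λ fs → return (proj₁ fs v)))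
    (λ v v′ ne → decidable-stable (starDistinct? G v v′) (facts >>= λ fs → return (proj₂ fs v v′ ne)))
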